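{- The subspaces $\mathbf{\Pi}^B$ and $\mathbf{\Pi}^D$ of $\mathbf{W}$ are graded sub-coalgebras of $(\mathbf{W},\Delta_\odot,\epsilon_\odot)$ and are graded right module coalgebras for the bialgebra $(\mathbf{\Pi},\nabla_{\mathrm{sh}},\iota,\Delta_\odot,\epsilon_\odot)$, with the action given by the product $\nabla_{\mathrm{sh}}$ of $\mathbf{W}$.
   Context: Fix a field $\mathbb{k}$ of characteristic zero. A word is a finite sequence of positive integers. $\mathbf{W}$ is the graded $\mathbb{k}$-bialgebra with basis symbols $[x,N]$ ($N\in\mathbb{N}$, $x$ a word with letters $\le N$), $[x,N]$ of degree the length of $x$, product $\nabla_{\mathrm{sh}}([x,M]\otimes[y,N])=\sum_z[z,M+N]$ (sum with multiplicity over all shuffles $z$ of $x$ with $y\uparrow M$, the word obtained by adding $M$ to each letter of $y$), unit $\iota(1)=[\emptyset,0]$, coproduct $\Delta_\odot([x_1\cdots x_k,N])=\sum_{i=0}^k[x_1\cdots x_i,N]\otimes[x_{i+1}\cdots x_k,N]$, counit $\epsilon_\odot([x,N])=\delta_{x,\emptyset}$. For $\pi\in S_{N+1}$ (with $s_i=(i,i+1)$ and $\mathcal{R}(\pi)$ its set of reduced words), $[\pi]=\sum_{x\in\mathcal{R}(\pi)}[x,N]$, and $\mathbf{\Pi}=\operatorname{span}\{[\pi]\}$ is a graded sub-bialgebra of $\mathbf{W}$. $B_n$ is the group of signed permutations of $\{\pm1,\dots,\pm n\}$ (permutations with $\pi(-i)=-\pi(i)$), with generators $s^B_1=(-1,1)$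 and $s^B_i=(-i,-i+1)(i-1,i)$ for $2\le i\le n$; also $s^D_1=(-2,1)(-1,2)$ and $s^D_i=s^B_i$ for $2\le i\le n$, generating $D_n$. For $\pi\in B_n$, $\mathcal{R}^B(\pi)$ (resp. $\mathcal{R}^D(\pi)$) is the set of words $i_1\cdots i_l$ of minimal length with $\pi=s^B_{i_1}\cdots s^B_{i_l}$ (resp. $\pi=s^D_{i_1}\cdots s^D_{i_l}$), empty if no such word exists. Put $[\pi]_B=\sum_{w\in\mathcal{R}^B(\pi)}[w,n]$ and $[\pi]_D=\sum_{w\in\mathcal{R}^D(\pi)}[w,n]$, and $\mathbf{\Pi}^B=\bigoplus_{n\ge1}\operatorname{span}\{[\pi]_B:\pi\in B_n\}$, $\mathbf{\Pi}^D=\bigoplus_{n\ge2}\operatorname{span}\{[\pi]_D:\pi\in D_n\}$. For a (graded) bialgebra $B$ and (graded) coalgebra $M$, $M$ is a (graded) right $B$-module coalgebra if it is a (graded) right $B$-module and the multiplication map $M\otimes B\to M$ is a (graded) coalgebra morphism. -}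

module Defs where

open import Level using (Level; _⊔_)
open import Algebra.Bundles using (CommutativeRing)
open import Data.Nat using (ℕ; zero; suc; _+_; _≤_; _≟_)
open import Data.Integer as ℤ using (ℤ; ∣_∣)
open import Data.List using (List; []; _∷_; [_]; _++_; map; concatMap; foldr; foldl; length; take; drop; upTo; filter)
open import Data.List.Properties using (≡-dec)
open import Data.List.Relation.Unary.All using (All)
open import Data.List.Relation.Unary.Unique.Propositional using (Unique)
open import Data.List.Membership.Propositional using (_∈_)
open import Data.List.Relation.Binary.Permutation.Propositional using (_↭_)
open import Data.Product using (Σ; ∃; _×_; _,_)
import Data.Product.Properties as ×P
open import Data.Bool using (if_then_else_)
open import Relation.Nullary using (¬_)
open import Relation.Nullary.Decidable using (⌊_⌋)
open import Relation.Binary.PropositionalEquality using (_≡_)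

record Field (c ℓ : Level) : Set (Level.suc (c ⊔ ℓ)) where
  field
    commutativeRing : CommutativeRing c ℓ
  open CommutativeRing commutativeRing public
  field
    1≉0     : ¬ (1# ≈ 0#)
    inverse : ∀ x → ¬ (x ≈ 0#) → Σ Carrier λ y → (x * y) ≈ 1#

module _ {c ℓ} (F : Field c ℓ) where
  open Field F renaming (_+_ to _+K_)
  natK : ℕ → Carrier
  natK zero    = 0#
  natK (suc n) = 1# +K natK n

  CharZero : Set ℓ
  CharZero = ∀ n → natK n ≈ 0# → n ≡ 0

Word : Set
Word = List ℕ

Basis : Set
Basis = Word × ℕ

_≟B_ : (a b : Basis) → Relation.Nullary.Dec (a ≡ b)
_≟B_ = ×P.≡-dec (≡-dec _≟_) _≟_

shuffles : Word → Word → List Word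
shuffles []       ys       = [ ys ]
shuffles (x ∷ xs) []       = [ x ∷ xs ]
shuffles (x ∷ xs) (y ∷ ys) =
  map (x ∷_) (shuffles xs (y ∷ ys)) ++ map (y ∷_) (shuffles (x ∷ xs) ys)

InRange : ℕ → ℕ → Set
InRange n i = (1 ≤ i) × (i ≤ n)

-- Groups in window notation; a word i₁⋯iₗ evaluates to s_{i₁}⋯s_{iₗ},
-- computed by successive right multiplications starting from the identity.
-- Window of π ∈ S_{N+1}: [π(1),…,π(N+1)]; of π ∈ B_n: [π(1),…,π(n)].

swapAt : {A : Set} → ℕ → List A → List A
swapAt zero    (x ∷ y ∷ xs) = y ∷ x ∷ xs
swapAt zero    xs           = xs
swapAt (suc j) []           = []
swapAt (suc j) (x ∷ xs)     = x ∷ swapAt j xs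

-- right multiplication by s_i = (i,i+1)
stepS : ℕ → List ℕ → List ℕ
stepS zero    w = w
stepS (suc k) w = swapAt k w

-- right multiplication by s^B_i
stepB : ℕ → List ℤ → List ℤ
stepB zero          w        = w
stepB (suc zero)    []       = []
stepB (suc zero)    (x ∷ xs) = ℤ.- x ∷ xs
stepB (suc (suc k)) w        = swapAt k w

-- right multiplication by s^D_i   (s^D_1 = (-2,1)(-1,2))
stepD : ℕ → List ℤ → List ℤ
stepD zero          w            = w
stepD (suc zero)    (x ∷ y ∷ xs) = ℤ.- y ∷ ℤ.- x ∷ xs
stepD (suc zero)    w            = w
stepD (suc (suc k)) w            = swapAt k w

evalWith : {A : Set} → (ℕ → List A → List A) → List A → Word → List A
evalWith step e w = foldl (λ acc i → step i acc) e w

idS : ℕ → List ℕ          -- identity of S_{N+1}, given N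
idS N = map suc (upTo (suc N))

idB : ℕ → List ℤ
idB n = map (λ i → ℤ.+ suc i) (upTo n)

IsPermS : ℕ → List ℕ → Set
IsPermS N π = π ↭ idS N

IsSignedPerm : ℕ → List ℤ → Set
IsSignedPerm n π = map ∣_∣ π ↭ map suc (upTo n)

IsInD : ℕ → List ℤ → Set
IsInD n π = IsSignedPerm n π × ∃ λ w → All (InRange n) w × evalWith stepD (idB n) w ≡ π

Reduced : {A : Set} → (ℕ → List A → List A) → List A → ℕ → List A → Word → Set
Reduced step e n π w =
  All (InRange n) w × evalWith step e w ≡ π ×
  (∀ w' → All (InRange n) w' → evalWith step e w' ≡ π → length w ≤ length w')

ReducedS : ℕ → List ℕ → Word → Set
ReducedS N = Reduced stepS (idS N) N

ReducedB : ℕ → List ℤ → Word → Set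
ReducedB n = Reduced stepB (idB n) n

ReducedD : ℕ → List ℤ → Word → Set
ReducedD n = Reduced stepD (idB n) n

Enumerates : List Word → (Word → Set) → Set
Enumerates ws R = Unique ws × (∀ w → (w ∈ ws → R w) × (R w → w ∈ ws))

record GenS : Set where
  field
    N    : ℕ
    π    : List ℕ
    isπ  : IsPermS N π
    ws   : List Word
    enum : Enumerates ws (ReducedS N π)

record GenB : Set where
  field
    n    : ℕ
    1≤n  : 1 ≤ n
    π    : List ℤ
    isπ  : IsSignedPerm n π
    ws   : List Word
    enum : Enumerates ws (ReducedB n π)

record GenD : Set where
  field
    n    : ℕ
    2≤n  : 2 ≤ n
    π    : List ℤ
    isπ  : IsInD n π
    ws   : List Word
    enum : Enumerates ws (ReducedD n π)

-- The bialgebra W over a field, elements as finite formal combinations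
-- (lists of coefficient/basis pairs) compared coefficientwise.

module W {c ℓ} (F : Field c ℓ) where
  open Field F renaming (Carrier to K; _+_ to _+K_; _*_ to _*K_)

  Vect : Set c
  Vect = List (K × Basis)

  Tens : Set c
  Tens = List (K × Basis × Basis)

  sumK : List K → K
  sumK = foldr _+K_ 0#

  coeff : Basis → Vect → K
  coeff b v = sumK (map (λ { (k , b') → if ⌊ b ≟B b' ⌋ then k else 0# }) v)

  coeffT : Basis → Basis → Tens → K
  coeffT a b t =
    sumK (map (λ { (k , a' , b') → if ⌊ a ≟B a' ⌋ then (if ⌊ b ≟B b' ⌋ then k else 0#) else 0# }) t)

  _≈V_ : Vect → Vect → Set ℓ
  v ≈V v' = ∀ b → coeff b v ≈ coeff b v'

  _≈T_ : Tens → Tens → Set ℓ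
  t ≈T t' = ∀ a b → coeffT a b t ≈ coeffT a b t'

  scale : K → Vect → Vect
  scale k v = map (λ { (k' , b) → (k *K k' , b) }) v

  scaleT : K → Tens → Tens
  scaleT k t = map (λ { (k' , a , b) → (k *K k' , a , b) }) t

  _⊗_ : Vect → Vect → Tens
  v ⊗ u = concatMap (λ { (k , a) → map (λ { (k' , b) → (k *K k' , a , b) }) u }) v

  Δ : Vect → Tens
  Δ v = concatMap (λ { (k , x , N) →
          map (λ i → (k , (take i x , N) , (drop i x , N))) (upTo (suc (length x))) }) v

  ε : Vect → K
  ε v = sumK (map (λ { (k , [] , N) → k ; (k , _ ∷ _ , N) → 0# }) v)

  mul : Vect → Vect → Vect
  mul v u = concatMap (λ { (k , x , M) → concatMap (λ { (k' , y , N) →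
              map (λ z → (k *K k' , z , M + N)) (shuffles x (map (M +_) y)) }) u }) v

  mulT : Tens → Tens → Tens
  mulT t s = concatMap (λ { (k , (x₁ , M₁) , (x₂ , M₂)) → concatMap (λ { (k' , (y₁ , N₁) , (y₂ , N₂)) →
               concatMap (λ z₁ → map (λ z₂ → (k *K k' , (z₁ , M₁ + N₁) , (z₂ , M₂ + N₂)))
                                     (shuffles x₂ (map (M₂ +_) y₂)))
                         (shuffles x₁ (map (M₁ +_) y₁)) }) s }) t

  unitV : Vect
  unitV = [ (1# , [] , 0) ]

  proj : ℕ → Vect → Vect
  proj d v = filter (λ { (k , x , N) → length x ≟ d }) v

  Homog : ℕ → Vect → Set ℓ
  Homog d v = v ≈V proj d v

  wordSum : ℕ → List Word → Vect
  wordSum n ws = map (λ w → (1# , w , n)) ws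

  [_]S : GenS → Vect
  [ g ]S = wordSum (GenS.N g) (GenS.ws g)

  [_]B : GenB → Vect
  [ g ]B = wordSum (GenB.n g) (GenB.ws g)

  [_]D : GenD → Vect
  [ g ]D = wordSum (GenD.n g) (GenD.ws g)

  InSpan : {G : Set} → (G → Vect) → Vect → Set (c ⊔ ℓ)
  InSpan {G} gen v = Σ (List (K × G)) λ cs →
    v ≈V concatMap (λ { (k , g) → scale k (gen g) }) cs

  InSpan⊗ : {G : Set} → (G → Vect) → Tens → Set (c ⊔ ℓ)
  InSpan⊗ {G} gen t = Σ (List (K × G × G)) λ cs →
    t ≈T concatMap (λ { (k , g , h) → scaleT k (gen g ⊗ gen h) }) cs

  record IsGradedSubCoalgebra {G : Set} (gen : G → Vect) : Set (c ⊔ ℓ) where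
    field
      Δ-closed : ∀ v → InSpan gen v → InSpan⊗ gen (Δ v)
      graded   : ∀ d v → InSpan gen v → InSpan gen (proj d v)

  record IsGradedRightModuleCoalgebra {G H : Set} (genM : G → Vect) (genB : H → Vect)
         : Set (c ⊔ ℓ) where
    field
      act-closed : ∀ m b → InSpan genM m → InSpan genB b → InSpan genM (mul m b)
      act-cong   : ∀ m m' b b' → InSpan genM m → InSpan genM m' → InSpan genB b → InSpan genB b' →
                   m ≈V m' → b ≈V b' → mul m b ≈V mul m' b'
      act-+ˡ     : ∀ m m' b → InSpan genM m → InSpan genM m' → InSpan genB b →
                   mul (m ++ m') b ≈V (mul m b ++ mul m' b)
      act-+ʳ     : ∀ m b b' → InSpan genM m → InSpan genB b → InSpan genB b' →
                   mul m (b ++ b') ≈V (mul m b ++ mul m b')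
      act-scaleˡ : ∀ k m b → InSpan genM m → InSpan genB b →
                   mul (scale k m) b ≈V scale k (mul m b)
      act-scaleʳ : ∀ k m b → InSpan genM m → InSpan genB b →
                   mul m (scale k b) ≈V scale k (mul m b)
      act-assoc  : ∀ m b b' → InSpan genM m → InSpan genB b → InSpan genB b' →
                   mul (mul m b) b' ≈V mul m (mul b b')
      act-unit   : ∀ m → InSpan genM m → mul m unitV ≈V m
      act-graded : ∀ d e m b → InSpan genM m → InSpan genB b → Homog d m → Homog e b →
                   Homog (d + e) (mul m b)
      act-Δ      : ∀ m b → InSpan genM m → InSpan genB b →
                   Δ (mul m b) ≈T mulT (Δ m) (Δ b)
      act-ε      : ∀ m b → InSpan genM m → InSpan genB b →
                   ε (mul m b) ≈ (ε m *K ε b)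

{-# OPTIONS --safe #-}

-- A word is reduced if and only if each of its letters is an ascent, and any two reduced
-- words of an element are connected by braid moves. The shuffles of w ∈ R(π), π ∈ B_n or D_n,
-- with u ↑ n, u ∈ R(σ), are the words whose restrictions to the letters ≤ n and > n are w and
-- u ↑ n. When w and u vary, these words form a set closed under braid moves: a move between
-- letters on different sides that is not a commutation would require one of the two
-- restrictions to contain a repeated letter. For the same reason all these words are reduced,
-- so they form a disjoint union of sets R(τ); hence Π^B and Π^D are stable under the action.
-- Likewise the pairs (u , v) with uv ∈ R(π) form a disjoint union of sets R(α) × R(β), which
-- gives the subcoalgebras. The other axioms hold in all of W; two vectors are compared by
-- their values under arbitrary linear functionals.
module Submission where

open import Data.Bool using (Bool; true; false; T; if_then_else_)
import Data.Bool.Properties as Bool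
open import Data.Empty using (⊥; ⊥-elim)
open import Data.Integer as ℤ using (ℤ; ∣_∣)
import Data.Integer.Properties as ℤ
open import Data.List using (List; []; _∷_; _++_; [_]; length; map; concatMap; filter; foldr; foldl; reverse; take; drop; upTo; applyUpTo; cartesianProduct; cartesianProductWith; deduplicate)
open import Data.List.Properties using (∷-injective; ∷-injectiveˡ; ∷-injectiveʳ; ++-identityʳ; ++-cancelˡ; ++-cancelʳ; ≡-dec; filter-accept; filter-reject; filter-++; foldr-++; foldl-++; length-++; length-map; length-filter; length-upTo; length-applyUpTo; length-reverse; length-take; map-id; map-∘; map-cong; map-cong-local; map-injective; map-applyUpTo; reverse-foldr; reverse-involutive; reverse-map; take++drop≡id; unfold-reverse)
open import Data.List.Membership.Propositional using (_∈_; find; lose)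
open import Data.List.Membership.Propositional.Properties using (∈-filter⁺; ∈-filter⁻; ∈-map⁺; ∈-map⁻; ∈-++⁺ˡ; ∈-++⁺ʳ; ∈-++⁻; ∈-concatMap⁺; ∈-concatMap⁻; ∈-cartesianProduct⁺; ∈-cartesianProduct⁻; ∈-cartesianProductWith⁺; ∈-cartesianProductWith⁻; ∈-applyUpTo⁺; ∈-applyUpTo⁻; ∈-upTo⁺; ∈-upTo⁻; ∈-deduplicate⁺)
open import Data.List.Membership.Propositional.Properties.WithK using (unique∧set⇒bag)
open import Data.List.Relation.Binary.BagAndSetEquality using (∼bag⇒↭)
open import Data.List.Relation.Binary.Permutation.Propositional as ↭ using (_↭_; ↭-refl; ↭-sym; ↭-trans; ↭-reflexive)
import Data.List.Relation.Binary.Permutation.Propositional.Properties as ↭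
import Data.List.Relation.Binary.Permutation.Setoid.Properties as ↭Setoid
open import Data.List.Relation.Unary.All as All using (All; []; _∷_)
import Data.List.Relation.Unary.All.Properties as All
open import Data.List.Relation.Unary.AllPairs using ([]; _∷_)
open import Data.List.Relation.Unary.Any using (here; there)
import Data.List.Relation.Unary.Unique.DecPropositional.Properties as UniqueDec
open import Data.List.Relation.Unary.Unique.Propositional using (Unique)
import Data.List.Relation.Unary.Unique.Propositional.Properties as Unique
open import Data.Nat using (ℕ; zero; suc; _+_; _∸_; _≤_; _<_; _≤?_; _≡ᵇ_; _≟_; z≤n; s≤s)
import Data.Nat.Properties as ℕ
open import Data.Nat.Properties using (≤-refl; ≤-trans; ≤-reflexive; <-irrefl; ≰⇒>; n≤1+n; m≤m+n; suc-injective; +-suc; +-cancelˡ-≤; +-cancelʳ-≤; +-cancelˡ-≡; m+[n∸m]≡n; m+n∸m≡n)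
open import Data.Product using (Σ; ∃; ∃₂; _×_; _,_; proj₁; proj₂)
import Data.Product.Properties as ×
open import Data.Sum using (_⊎_; inj₁; inj₂)
open import Data.Unit using (⊤; tt)
open import Function using (mk⇔)
open import Relation.Binary.Definitions using (DecidableEquality; Transitive; Asymmetric; Trichotomous; tri<; tri≈; tri>)
open import Relation.Binary.PropositionalEquality as ≡ using (_≡_; _≢_; refl; sym; trans; cong; cong₂; subst; subst₂)
open import Relation.Nullary using (¬_; Dec; yes; no; does)
open import Relation.Nullary.Decidable using (¬?; ⌊_⌋; dec-true; dec-false)
open import Defs


-- Elements are raw lists, many of which are not windows, and neither a length function nor a root
-- system is at hand. `Asc` and `Desc` are therefore separate predicates: a list may satisfy
-- neither, and they are exhaustive only on valid windows. The exchange property and Matsumoto's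
-- theorem are deduced from rank two data alone: an element with two descents is the top of two
-- ascending alternating paths with a common bottom. For B and D this leaves finitely many patterns
-- of a few entries to check. A second obstacle is that the restrictions of a shuffle are words in
-- `B_n` (or `D_n`) and `S_{N+1}`, while braid moves take place in rank `n + N`. Two simulations,
-- one per side, carry ascents and endpoints back and forth. Finally, a disjoint union of sets R(τ)
-- is obtained by sorting a duplicate-free list by group element. A class counts as R(τ) only if it
-- contains every reduced word of τ, which is where closure under braid moves enters; the resulting
-- sums then have all coefficients equal to one.

-- Involutions with ascents and their rank two data.

record Gen (X : Set) : Set₁ where
  field
    act       : X → X
    Asc Desc  : X → Set
    involutive : ∀ x → act (act x) ≡ x
    ascend    : ∀ {x} → Asc x → Desc (act x)
    descend   : ∀ {x} → Desc x → Asc (act x)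
    exclusive : ∀ {x} → Asc x → Desc x → ⊥

open Gen

module _ {X : Set} where

  alternate : Gen X → Gen X → ℕ → X → X
  alternate s t zero    y = y
  alternate s t (suc k) y = act s (alternate t s k y)

  Ascending : Gen X → Gen X → ℕ → X → Set
  Ascending s t zero    y = ⊤
  Ascending s t (suc k) y = Asc s (alternate t s k y) × Ascending t s k y

  -- The local structure of the right cosets of a rank two standard parabolic
  -- subgroup with m(s,t) = order.
  record Dihedral (s t : Gen X) : Set where
    field
      order : ℕ
      2≤order : 2 ≤ order
      bottom : ∀ {x} → Desc s x → Desc t x → ∃ λ y →
               (Ascending s t order y × alternate s t order y ≡ x) ×
               (Ascending t s order y × alternate t s order y ≡ x)
      braidˡ : ∀ {y} → Ascending s t order y →
               Ascending t s order y × alternate t s order y ≡ alternate s t order y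
      braidʳ : ∀ {y} → Ascending t s order y →
               Ascending s t order y × alternate s t order y ≡ alternate t s order y

  open Dihedral

  Dihedral-sym : ∀ {s t} → Dihedral s t → Dihedral t s
  Dihedral-sym D = record
    { order = order D ; 2≤order = 2≤order D
    ; bottom = λ d d′ → let (y , p , q) = bottom D d′ d in y , q , p
    ; braidˡ = braidʳ D ; braidʳ = braidˡ D }

alt : ℕ → ℕ → ℕ → Word
alt i j zero    = []
alt i j (suc k) = i ∷ alt j i k

module Restrict (side : ℕ → Bool) where

  restrict : Bool → Word → Word
  restrict b = filter (λ i → side i Bool.≟ b)

  restrict-yes : ∀ {b i} w → side i ≡ b → restrict b (i ∷ w) ≡ i ∷ restrict b w
  restrict-yes w p = filter-accept (λ i → side i Bool.≟ _) p

  restrict-no : ∀ {b i} w → side i ≢ b → restrict b (i ∷ w) ≡ restrict b w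
  restrict-no w p = filter-reject (λ i → side i Bool.≟ _) p

-- Exchange, Matsumoto's theorem and restrictions in an abstract system.

module CoxeterSystem {X : Set} (g : ℕ → Gen X)
  (dihedral : ∀ {i j} → i ≢ j → Dihedral (g i) (g j))
  (e : X) (e-minimal : ∀ i → ¬ Desc (g i) e) where

  -- Words are read from right to left: the head is the last letter applied.
  ev : X → Word → X
  ev = foldr (λ i → act (g i))

  Up : X → Word → Set
  Up y []      = ⊤
  Up y (i ∷ w) = Asc (g i) (ev y w) × Up y w

  ev-++ : ∀ {y} u v → ev y (u ++ v) ≡ ev (ev y v) u
  ev-++ u v = foldr-++ _ _ u v

  Up-++⁺ : ∀ {y} u v → Up (ev y v) u → Up y v → Up y (u ++ v)
  Up-++⁺ []      v p       q = q
  Up-++⁺ (i ∷ u) v (a , p) q = subst (Asc (g i)) (sym (ev-++ u v)) a , Up-++⁺ u v p q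

  Up-++⁻ˡ : ∀ {y} u v → Up y (u ++ v) → Up (ev y v) u
  Up-++⁻ˡ []      v p       = tt
  Up-++⁻ˡ (i ∷ u) v (a , p) = subst (Asc (g i)) (ev-++ u v) a , Up-++⁻ˡ u v p

  Up-++⁻ʳ : ∀ {y} u v → Up y (u ++ v) → Up y v
  Up-++⁻ʳ []      v p       = p
  Up-++⁻ʳ (i ∷ u) v (a , p) = Up-++⁻ʳ u v p

  ev-alt : ∀ i j k y → ev y (alt i j k) ≡ alternate (g i) (g j) k y
  ev-alt i j zero    y = refl
  ev-alt i j (suc k) y = cong (act (g i)) (ev-alt j i k y)

  Up-alt⁺ : ∀ i j k y → Ascending (g i) (g j) k y → Up y (alt i j k)
  Up-alt⁺ i j zero    y p       = tt
  Up-alt⁺ i j (suc k) y (a , p) = subst (Asc (g i)) (sym (ev-alt j i k y)) a , Up-alt⁺ j i k y p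

  Up-alt⁻ : ∀ i j k y → Up y (alt i j k) → Ascending (g i) (g j) k y
  Up-alt⁻ i j zero    y p       = tt
  Up-alt⁻ i j (suc k) y (a , p) = subst (Asc (g i)) (ev-alt j i k y) a , Up-alt⁻ j i k y p

  infix 4 _~_
  data _~_ : Word → Word → Set where
    ~-refl  : ∀ {w} → w ~ w
    ~-trans : ∀ {u v w} → u ~ v → v ~ w → u ~ w
    ~-cons  : ∀ i {v w} → v ~ w → (i ∷ v) ~ (i ∷ w)
    ~-braid : ∀ {i j} (D : Dihedral (g i) (g j)) v →
              (alt i j (Dihedral.order D) ++ v) ~ (alt j i (Dihedral.order D) ++ v)

  length-alt : ∀ i j k → length (alt i j k) ≡ k
  length-alt i j zero    = refl
  length-alt i j (suc k) = cong suc (length-alt j i k)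

  ~-length : ∀ {v w} → v ~ w → length v ≡ length w
  ~-length ~-refl        = refl
  ~-length (~-trans p q) = trans (~-length p) (~-length q)
  ~-length (~-cons i p)  = cong suc (~-length p)
  ~-length (~-braid {i} {j} D v) = trans (length-++ (alt i j m))
    (trans (cong (_+ length v) (trans (length-alt i j m) (sym (length-alt j i m))))
           (sym (length-++ (alt j i m))))
    where m = Dihedral.order D

  Braided : Word → Word → Set
  Braided w w′ = Up e w′ × ev e w′ ≡ ev e w × w ~ w′

  braid-move : ∀ {i j} (D : Dihedral (g i) (g j)) {y} → let m = Dihedral.order D in
    Up y (alt i j m) → Up y (alt j i m) × ev y (alt j i m) ≡ ev y (alt i j m)
  braid-move {i} {j} D {y} p with Dihedral.braidˡ D (Up-alt⁻ i j (Dihedral.order D) y p)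
  ... | q , eq = Up-alt⁺ j i m y q , trans (ev-alt j i m y) (trans eq (sym (ev-alt i j m y)))
    where m = Dihedral.order D

  mutual
    -- If the head `j` differs from `i`, both are descents of the endpoint, so it is the top of a
    -- rank two coset. Rerouting the tail through the bottom of that coset exposes an alternating
    -- word starting with `j`, and one braid move makes it start with `i`. The fuel `n` drops when
    -- `exchange` passes to the tail; `extract` keeps it and shortens the alternating word instead.
    exchange : ∀ n w i → length w ≤ n → Up e w → Desc (g i) (ev e w) →
               ∃ λ v → Braided w (i ∷ v)
    exchange n       []      i le       p       d = ⊥-elim (e-minimal i d)
    exchange (suc n) (j ∷ w) i (s≤s le) (a , p) d with i ≟ j
    ... | yes refl = w , (a , p) , refl , ~-refl
    ... | no i≢j = exchange-dihedral n w le p a d (dihedral i≢j)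

    exchange-dihedral : ∀ n w {i j} → length w ≤ n → Up e w → Asc (g j) (ev e w) →
      Desc (g i) (act (g j) (ev e w)) → Dihedral (g i) (g j) →
      ∃ λ v → Braided (j ∷ w) (i ∷ v)
    exchange-dihedral n w {i} {j} le p a d D@record { order = suc m ; 2≤order = s≤s _ ; bottom = bottom }
      with bottom d (ascend (g j) a)
    ... | y , (p₁ , e₁) , (p₂ , e₂)
      -- `w` ends one step `j` below the top. Cancelling the last `j` of the second path from `y`
      -- shows that the alternating word of length `m` with head `i` ends there too.
      with extract n w i j m y le p
             (Up-alt⁺ i j m y (proj₂ p₂))
             (trans (sym (involutive (g j) _)) (trans (cong (act (g j)) (trans (sym e₂)
               (cong (act (g j)) (sym (ev-alt i j m y))))) (involutive (g j) _)))
    ... | v , q , refl , r = alt j i m ++ v ,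
          Up-++⁺ (alt i j (suc m)) v (Up-alt⁺ i j (suc m) _ p₁) q ,
          trans (ev-++ (alt i j (suc m)) v) (trans (ev-alt i j (suc m) _) e₁) ,
          ~-trans (~-cons j r) (~-braid (Dihedral-sym D) v)

    -- If x is reached from y by an ascending alternating word, then the path
    -- from e to x can be rerouted through y.
    extract : ∀ n w i j k y → length w ≤ n → Up e w → Up y (alt i j k) →
              ev e w ≡ ev y (alt i j k) →
              ∃ λ v → Up e v × ev e v ≡ y × w ~ (alt i j k ++ v)
    extract n w i j zero    y le p q       eq = w , p , eq , ~-refl
    extract n w i j (suc k) y le p (a , q) eq
      with exchange n w i le p (subst (Desc (g i)) (sym eq) (ascend (g i) a))
    ... | v , (b , r) , eq′ , rel
      with extract n v j i k y
             (≤-trans (n≤1+n _) (≤-trans (≤-reflexive (sym (~-length rel))) le)) r q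
             (trans (sym (involutive (g i) _)) (trans (cong (act (g i)) (trans eq′ eq)) (involutive (g i) _)))
    ... | u , s , eq″ , rel′ = u , s , eq″ , ~-trans rel (~-cons i rel′)

  -- The head of `w` is a descent of the common endpoint, so `exchange` brings it to the front of
  -- `w′` by braid moves. It then cancels, leaving a shorter pair with a common endpoint.
  matsumoto : ∀ w w′ → Up e w → Up e w′ → ev e w ≡ ev e w′ → w ~ w′
  matsumoto []      []       p p′ eq = ~-refl
  matsumoto []      (i ∷ w′) p (a , p′) eq =
    ⊥-elim (e-minimal i (subst (Desc (g i)) (sym eq) (ascend (g i) a)))
  matsumoto (i ∷ w) w′ (a , p) p′ eq
    with exchange _ w′ i ≤-refl p′ (subst (Desc (g i)) eq (ascend (g i) a))
  ... | v , (b , q) , eq′ , rel = ~-trans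
    (~-cons i (matsumoto w v p q
      (trans (sym (involutive (g i) _)) (trans (cong (act (g i)) (trans eq (sym eq′))) (involutive (g i) _)))))
    (~-sym rel)
    where
    ~-sym : ∀ {u v} → u ~ v → v ~ u
    ~-sym ~-refl        = ~-refl
    ~-sym (~-trans p q) = ~-trans (~-sym q) (~-sym p)
    ~-sym (~-cons i p)  = ~-cons i (~-sym p)
    ~-sym (~-braid D v) = ~-braid (Dihedral-sym D) v

  -- `I` selects the letters of the group and `V` the genuine elements, on which every such letter
  -- either ascends or descends.
  module Minimality (I : ℕ → Set) (V : X → Set) (V-e : V e)
    (V-act : ∀ {i x} → I i → V x → V (act (g i) x))
    (dichotomy : ∀ {i x} → I i → V x → Asc (g i) x ⊎ Desc (g i) x) where

    V-ev : ∀ {w} → All I w → V (ev e w)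
    V-ev []       = V-e
    V-ev (i ∷ is) = V-act i (V-ev is)

    -- A form of the deletion condition. When a letter `i` meets a descent of the part already
    -- straightened, `exchange` rewrites that part as `i ∷ v`, the two copies of `i` cancel, and the
    -- word gets strictly shorter.
    straighten : ∀ {w} → All I w → ∃ λ w′ → Up e w′ × ev e w′ ≡ ev e w ×
                 (w′ ≡ w ⊎ length w′ < length w)
    straighten [] = [] , tt , refl , inj₁ refl
    straighten {i ∷ w} (px ∷ pxs) with straighten pxs
    ... | w′ , p , eq , cmp with dichotomy px (V-ev pxs)
    ...   | inj₁ a = i ∷ w′ , (subst (Asc (g i)) (sym eq) a , p) , cong (act (g i)) eq , lift cmp
      where
      lift : w′ ≡ w ⊎ length w′ < length w → i ∷ w′ ≡ i ∷ w ⊎ suc (length w′) < suc (length w)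
      lift (inj₁ refl) = inj₁ refl
      lift (inj₂ lt)   = inj₂ (s≤s lt)
    ...   | inj₂ d with exchange _ w′ i ≤-refl p (subst (Desc (g i)) (sym eq) d)
    ...     | v , (b , q) , eq′ , rel = v , q ,
              trans (sym (involutive (g i) _)) (cong (act (g i)) (trans eq′ eq)) ,
              inj₂ (s≤s (≤-trans (n≤1+n _) (≤-trans (≤-reflexive (sym (~-length rel))) (bound cmp))))
      where
      bound : w′ ≡ w ⊎ length w′ < length w → length w′ ≤ length w
      bound (inj₁ refl) = ≤-refl
      bound (inj₂ lt)   = ≤-trans (n≤1+n _) lt

    -- A competitor straightens to an ascending word that is no longer; by `matsumoto` that word is
    -- braid equivalent to `w`, and braid moves preserve length.
    Up⇒minimal : ∀ {w w′} → Up e w → All I w′ → ev e w′ ≡ ev e w → length w ≤ length w′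
    Up⇒minimal p is eq with straighten is
    ... | u , q , eq′ , cmp = ≤-trans
      (≤-reflexive (~-length (matsumoto _ u p q (sym (trans eq′ eq))))) (bound cmp)
      where
      bound : ∀ {u w} → u ≡ w ⊎ length u < length w → length u ≤ length w
      bound (inj₁ refl) = ≤-refl
      bound (inj₂ lt)   = ≤-trans (n≤1+n _) lt

  module Restriction (side : ℕ → Bool) where

    open Restrict side

    Good : Word → Set
    Good w = ∀ b → Up e (restrict b w)

    Similar : Word → Word → Set
    Similar w w′ = ∀ b → Up e (restrict b w′) × ev e (restrict b w′) ≡ ev e (restrict b w)

    restrict-alt-accept : ∀ {b i j} k v → side i ≡ b → side j ≡ b →
      restrict b (alt i j k ++ v) ≡ alt i j k ++ restrict b v
    restrict-alt-accept zero    v p q = refl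
    restrict-alt-accept (suc k) v p q =
      trans (restrict-yes _ p) (cong (_ ∷_) (restrict-alt-accept k v q p))

    restrict-alt-reject : ∀ {b i j} k v → side i ≢ b → side j ≢ b →
      restrict b (alt i j k ++ v) ≡ restrict b v
    restrict-alt-reject zero    v p q = refl
    restrict-alt-reject (suc k) v p q =
      trans (restrict-no _ p) (restrict-alt-reject k v q p)

    restrict-swap : ∀ {i j} b v → side i ≢ side j → restrict b (i ∷ j ∷ v) ≡ restrict b (j ∷ i ∷ v)
    restrict-swap {i} {j} b v i≢j = by-cases (side i Bool.≟ b) (side j Bool.≟ b)
      where
      by-cases : Dec (side i ≡ b) → Dec (side j ≡ b) → restrict b (i ∷ j ∷ v) ≡ restrict b (j ∷ i ∷ v)
      by-cases (yes p) (yes q) = ⊥-elim (i≢j (trans p (sym q)))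
      by-cases (yes p) (no  q) = trans (restrict-yes _ p) (trans (cong (i ∷_) (restrict-no _ q))
        (sym (trans (restrict-no _ q) (restrict-yes _ p))))
      by-cases (no  p) (yes q) = trans (restrict-no _ p) (trans (restrict-yes _ q)
        (sym (trans (restrict-yes _ q) (cong (j ∷_) (restrict-no _ p)))))
      by-cases (no  p) (no  q) = trans (restrict-no _ p) (trans (restrict-no _ q)
        (sym (trans (restrict-no _ q) (restrict-no _ p))))

    -- On the side of `i` the restriction begins with `i ∷ i`, but after an ascending step `i` is a
    -- descent.
    restrict-repeat : ∀ {i j} v → side i ≢ side j → ¬ Good (i ∷ j ∷ i ∷ v)
    restrict-repeat {i} {j} v i≢j good
      with subst (Up e) (trans (restrict-yes (j ∷ i ∷ v) refl) (cong (i ∷_)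
             (trans (restrict-no (i ∷ v) (λ eq → i≢j (sym eq))) (restrict-yes v refl)))) (good (side i))
    ... | a , b , _ = exclusive (g i) a (ascend (g i) b)

    -- A braid move between letters on different sides cannot occur in a good word
    -- unless it is a commutation, because the restriction to one side would
    -- contain a repeated letter.
    similar-braid : ∀ {i j} (D : Dihedral (g i) (g j)) v → let m = Dihedral.order D in
      Good (alt i j m ++ v) → Similar (alt i j m ++ v) (alt j i m ++ v)
    similar-braid {i} {j} D v good b with side i Bool.≟ side j
    ... | no i≢j with Dihedral.order D | Dihedral.2≤order D
    ...   | suc (suc zero)    | _ rewrite restrict-swap {j} {i} b v (λ q → i≢j (sym q)) = good b , refl
    ...   | suc (suc (suc m)) | _ = ⊥-elim (restrict-repeat _ i≢j good)
    ...   | suc zero          | s≤s ()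
    similar-braid {i} {j} D v good b | yes i≡j with side i Bool.≟ b
    ...   | no q rewrite restrict-alt-reject (Dihedral.order D) v (λ r → q (trans i≡j r)) q
                 = subst (Up e) (restrict-alt-reject (Dihedral.order D) v q (λ r → q (trans i≡j r))) (good b) ,
                   cong (ev e) (sym (restrict-alt-reject (Dihedral.order D) v q (λ r → q (trans i≡j r))))
    ...   | yes refl rewrite restrict-alt-accept (Dihedral.order D) v (sym i≡j) refl
      with subst (Up e) (restrict-alt-accept (Dihedral.order D) v refl (sym i≡j)) (good b)
    ...     | p with braid-move D (Up-++⁻ˡ (alt i j (Dihedral.order D)) _ p)
    ...       | q , eq = Up-++⁺ (alt j i m) _ q (Up-++⁻ʳ (alt i j m) _ p) ,
                  trans (ev-++ (alt j i m) _) (trans eq (sym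
                    (trans (cong (ev e) (restrict-alt-accept m v refl (sym i≡j))) (ev-++ (alt i j m) _))))
      where m = Dihedral.order D

    good-tail : ∀ i {w} → Good (i ∷ w) → Good w
    good-tail i {w} good b = by-cases (side i Bool.≟ b)
      where
      by-cases : Dec (side i ≡ b) → Up e (restrict b w)
      by-cases (yes p) = proj₂ (subst (Up e) (restrict-yes w p) (good b))
      by-cases (no  p) = subst (Up e) (restrict-no w p) (good b)

    -- Induction along the braid moves. Under a common head `i` the ascent carries over because the
    -- restrictions of the two tails end at the same element.
    good-similar : ∀ {w w′} → w ~ w′ → Good w → Similar w w′
    good-similar ~-refl        good b = good b , refl
    good-similar (~-trans p q) good b with good-similar p good
    ... | sim with good-similar q (λ b → proj₁ (sim b)) b
    ...   | r , eq = r , trans eq (proj₂ (sim b))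
    good-similar (~-cons i {v} {w} p) good b = by-cases (side i Bool.≟ b)
      where
      tail = good-similar p (good-tail i good) b
      by-cases : Dec (side i ≡ b) →
        Up e (restrict b (i ∷ w)) × ev e (restrict b (i ∷ w)) ≡ ev e (restrict b (i ∷ v))
      by-cases (no  q) = subst (Up e) (sym (restrict-no w q)) (proj₁ tail) ,
        trans (cong (ev e) (restrict-no w q)) (trans (proj₂ tail) (cong (ev e) (sym (restrict-no v q))))
      by-cases (yes q) = subst (Up e) (sym (restrict-yes w q))
          (subst (Asc (g i)) (sym (proj₂ tail)) (proj₁ (subst (Up e) (restrict-yes v q) (good b))) , proj₁ tail) ,
        trans (cong (ev e) (restrict-yes w q))
          (trans (cong (act (g i)) (proj₂ tail)) (cong (ev e) (sym (restrict-yes v q))))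
    good-similar (~-braid D v) good = similar-braid D v good

    good-class : ∀ {w w′} → Good w → Up e w → Up e w′ → ev e w′ ≡ ev e w → Similar w w′
    good-class good p p′ eq = good-similar (matsumoto _ _ p p′ (sym eq)) good

    module _ (I : ℕ → Set) (V : X → Set) (V-e : V e)
      (V-act : ∀ {i x} → I i → V x → V (act (g i) x))
      (dichotomy : ∀ {i x} → I i → V x → Asc (g i) x ⊎ Desc (g i) x) where

      open Minimality I V V-e V-act dichotomy

      -- Suppose the head `i` were a descent of the tail `w`. Then `w` would be braid equivalent to
      -- some `i ∷ v`, whose restriction to the side of `i` ends where that of `w` does; so `i`
      -- would be a descent of the restricted tail, whereas goodness of `i ∷ w` makes it an ascent
      -- there.
      good⇒Up : ∀ {w} → All I w → Good w → Up e w
      good⇒Up []               good = tt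
      good⇒Up {i ∷ w} (px ∷ pxs) good with good⇒Up pxs (good-tail i good) | dichotomy px (V-ev pxs)
      ... | p | inj₁ a = a , p
      ... | p | inj₂ d with exchange _ w i ≤-refl p d
      ...   | v , q , eq , rel with good-similar rel (good-tail i good) (side i)
      ...     | q′ , eq′ = ⊥-elim (exclusive (g i)
        (proj₁ (subst (Up e) (restrict-yes w refl) (good (side i))))
        (subst (Desc (g i)) (trans (cong (ev e) (sym (restrict-yes v refl))) eq′)
          (ascend (g i) (proj₁ (subst (Up e) (restrict-yes v refl) q′)))))

-- Ways to obtain rank two data: commuting pairs and transport along a map.

record Commuting {X : Set} (s t : Gen X) : Set where
  field
    commute : ∀ x → act s (act t x) ≡ act t (act s x)
    ascˡ  : ∀ {x} → Asc s x → Asc s (act t x)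
    ascʳ  : ∀ {x} → Asc t x → Asc t (act s x)
    descˡ : ∀ {x} → Desc s x → Desc s (act t x)
    descʳ : ∀ {x} → Desc t x → Desc t (act s x)

commuting⇒dihedral : ∀ {X} {s t : Gen X} → Commuting s t → Dihedral s t
commuting⇒dihedral {s = s} {t} c = record
  { order = 2 ; 2≤order = s≤s (s≤s z≤n)
  ; bottom = λ {x} d d′ → act s (act t x) ,
      ((subst (Asc s) (sym (ts-st x)) (descend s d) ,
        subst (Asc t) (sym (commute x)) (descend t (descʳ d′)) , tt) ,
       trans (cong (act s) (ts-st x)) (involutive s x)) ,
      ((subst (Asc t) (sym (involutive s _)) (descend t d′) , descend s (descˡ d) , tt) ,
       trans (cong (act t) (involutive s _)) (involutive t x))
  ; braidˡ = λ {y} (a , b , _) → (ascʳ b , subst (Asc s) (involutive t y) (ascˡ a) , tt) , sym (commute y)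
  ; braidʳ = λ {y} (a , b , _) → (ascˡ b , subst (Asc t) (involutive s y) (ascʳ a) , tt) , commute y
  }
  where
  open Commuting c
  ts-st : ∀ x → act t (act s (act t x)) ≡ act s x
  ts-st x = trans (sym (commute (act t x))) (cong (act s) (involutive t x))

-- Stands for the letter 0, which occurs in the type of words but is no generator. Having neither
-- ascents nor descents, it blocks every alternating path of two steps, so its rank two data are
-- vacuous.
trivial : ∀ {X} → Gen X
trivial = record { act = λ x → x ; Asc = λ _ → ⊥ ; Desc = λ _ → ⊥
  ; involutive = λ _ → refl ; ascend = λ () ; descend = λ () ; exclusive = λ () }

trivial-dihedral : ∀ {X} (t : Gen X) → Dihedral trivial t
trivial-dihedral t = record { order = 2 ; 2≤order = s≤s (s≤s z≤n) ; bottom = λ ()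
  ; braidˡ = λ () ; braidʳ = λ { (_ , () , _) } }

-- `s′` acts as `s` does on each copy `f p` of X inside Y, and ascents and descents of `s′` occur
-- only in such copies. The map is either prepending an entry or a change of sign of the first
-- entry.
record Lifts {P X Y : Set} (f : P → X → Y) (s : Gen X) (s′ : Gen Y) : Set where
  field
    act-f  : ∀ p x → act s′ (f p x) ≡ f p (act s x)
    asc⁺   : ∀ {p x} → Asc s x → Asc s′ (f p x)
    asc⁻   : ∀ {p x} → Asc s′ (f p x) → Asc s x
    desc⁻  : ∀ {p x} → Desc s′ (f p x) → Desc s x
    coverᵃ : ∀ {y} → Asc s′ y → ∃₂ λ p x → y ≡ f p x
    coverᵈ : ∀ {y} → Desc s′ y → ∃₂ λ p x → y ≡ f p x

module _ {P X Y : Set} {f : P → X → Y} where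
  open Lifts

  lift-alternate : ∀ {s t s′ t′} → Lifts f s s′ → Lifts f t t′ → ∀ k p x →
                   alternate s′ t′ k (f p x) ≡ f p (alternate s t k x)
  lift-alternate S T zero    p x = refl
  lift-alternate {s} {t} {s′} S T (suc k) p x =
    trans (cong (act s′) (lift-alternate T S k p x)) (act-f S p _)

  lift-ascending⁺ : ∀ {s t s′ t′} → Lifts f s s′ → Lifts f t t′ → ∀ k p x →
                    Ascending s t k x → Ascending s′ t′ k (f p x)
  lift-ascending⁺ S T zero    p x a       = tt
  lift-ascending⁺ {s′ = s′} S T (suc k) p x (a , as) =
    subst (Asc s′) (sym (lift-alternate T S k p x)) (asc⁺ S a) , lift-ascending⁺ T S k p x as

  lift-ascending⁻ : ∀ {s t s′ t′} → Lifts f s s′ → Lifts f t t′ → ∀ k p x →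
                    Ascending s′ t′ k (f p x) → Ascending s t k x
  lift-ascending⁻ S T zero    p x a       = tt
  lift-ascending⁻ {s′ = s′} S T (suc k) p x (a , as) =
    asc⁻ S (subst (Asc s′) (lift-alternate T S k p x) a) , lift-ascending⁻ T S k p x as

  -- The innermost step of the path is an ascent at `y` itself, so that step alone decides.
  lift-cover : ∀ {s t s′ t′} → Lifts f s s′ → Lifts f t t′ → ∀ k y → 1 ≤ k →
               Ascending s′ t′ k y → ∃₂ λ p x → y ≡ f p x
  lift-cover S T (suc zero)    y _ (a , _) = coverᵃ S a
  lift-cover S T (suc (suc k)) y _ (_ , as) = lift-cover T S (suc k) y (s≤s z≤n) as

  lift-dihedral : ∀ {s t s′ t′} → Lifts f s s′ → Lifts f t t′ → Dihedral s t → Dihedral s′ t′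
  lift-dihedral {s} {t} {s′} {t′} S T D = record
    { order = m ; 2≤order = 2≤order ; bottom = bottom′
    ; braidˡ = braid S T braidˡ ; braidʳ = braid T S braidʳ }
    where
    open Dihedral D renaming (order to m)
    bottom′ : ∀ {y} → Desc s′ y → Desc t′ y → ∃ λ z →
              (Ascending s′ t′ m z × alternate s′ t′ m z ≡ y) ×
              (Ascending t′ s′ m z × alternate t′ s′ m z ≡ y)
    bottom′ d d′ with coverᵈ S d
    ... | p , x , refl with bottom (desc⁻ S d) (desc⁻ T d′)
    ... | z , (a₁ , e₁) , (a₂ , e₂) = f p z ,
      (lift-ascending⁺ S T m p z a₁ , trans (lift-alternate S T m p z) (cong (f p) e₁)) ,
      (lift-ascending⁺ T S m p z a₂ , trans (lift-alternate T S m p z) (cong (f p) e₂))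
    braid : ∀ {s t s′ t′} → Lifts f s s′ → Lifts f t t′ →
      (∀ {x} → Ascending s t m x → Ascending t s m x × alternate t s m x ≡ alternate s t m x) →
      ∀ {y} → Ascending s′ t′ m y → Ascending t′ s′ m y × alternate t′ s′ m y ≡ alternate s′ t′ m y
    braid S T b {y} as with lift-cover S T m y (1≤ 2≤order) as
      where
      1≤ : ∀ {n} → 2 ≤ n → 1 ≤ n
      1≤ (s≤s _) = s≤s z≤n
    ... | p , x , refl with b (lift-ascending⁻ S T m p x as)
    ... | bs , eq = lift-ascending⁺ T S m p x bs ,
      trans (lift-alternate T S m p x) (trans (cong (f p) eq) (sym (lift-alternate S T m p x)))

-- Adjacent transpositions of the entries of a list.

module Swaps {A : Set} (_<_ : A → A → Set) (<-trans : Transitive _<_) (<-asym : Asymmetric _<_)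
  where

  AscSwap : ℕ → List A → Set
  AscSwap zero    (a ∷ b ∷ xs) = a < b
  AscSwap zero    (_ ∷ [])     = ⊥
  AscSwap zero    []           = ⊥
  AscSwap (suc k) []           = ⊥
  AscSwap (suc k) (_ ∷ xs)     = AscSwap k xs

  DescSwap : ℕ → List A → Set
  DescSwap zero    (a ∷ b ∷ xs) = b < a
  DescSwap zero    (_ ∷ [])     = ⊥
  DescSwap zero    []           = ⊥
  DescSwap (suc k) []           = ⊥
  DescSwap (suc k) (_ ∷ xs)     = DescSwap k xs

  swapAt-involutive : ∀ k (xs : List A) → swapAt k (swapAt k xs) ≡ xs
  swapAt-involutive zero    []           = refl
  swapAt-involutive zero    (_ ∷ [])     = refl
  swapAt-involutive zero    (_ ∷ _ ∷ _)  = refl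
  swapAt-involutive (suc k) []           = refl
  swapAt-involutive (suc k) (x ∷ xs)     = cong (x ∷_) (swapAt-involutive k xs)

  swap-ascend : ∀ k {xs} → AscSwap k xs → DescSwap k (swapAt k xs)
  swap-ascend zero    {_ ∷ _ ∷ _} a = a
  swap-ascend (suc k) {_ ∷ xs}    a = swap-ascend k a

  swap-descend : ∀ k {xs} → DescSwap k xs → AscSwap k (swapAt k xs)
  swap-descend zero    {_ ∷ _ ∷ _} a = a
  swap-descend (suc k) {_ ∷ xs}    a = swap-descend k a

  swap-exclusive : ∀ k {xs} → AscSwap k xs → DescSwap k xs → ⊥
  swap-exclusive zero    {_ ∷ _ ∷ _} a d = <-asym a d
  swap-exclusive (suc k) {_ ∷ xs}    a d = swap-exclusive k a d

  swap : ℕ → Gen (List A)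
  swap k = record { act = swapAt k ; Asc = AscSwap k ; Desc = DescSwap k
    ; involutive = swapAt-involutive k ; ascend = swap-ascend k
    ; descend = swap-descend k ; exclusive = swap-exclusive k }

  swap-lifts : ∀ k → Lifts _∷_ (swap k) (swap (suc k))
  swap-lifts k = record { act-f = λ _ _ → refl ; asc⁺ = λ a → a ; asc⁻ = λ a → a ; desc⁻ = λ d → d
    ; coverᵃ = λ { {x ∷ xs} _ → x , xs , refl } ; coverᵈ = λ { {x ∷ xs} _ → x , xs , refl } }

  adjacent : Dihedral (swap 0) (swap 1)
  adjacent = record { order = 3 ; 2≤order = s≤s (s≤s z≤n)
    -- Two descents mean `c < b < a`; the bottom of the coset is the sorted window, and sorting
    -- reverses three entries in three steps.
    ; bottom = λ { {a ∷ b ∷ c ∷ xs} b<a c<b → c ∷ b ∷ a ∷ xs ,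
        ((b<a , <-trans c<b b<a , c<b , tt) , refl) , ((c<b , <-trans c<b b<a , b<a , tt) , refl) }
    ; braidˡ = λ { {a ∷ b ∷ c ∷ xs} (p , q , r , _) → (r , q , p , tt) , refl
                 ; {_ ∷ _ ∷ []} (_ , () , _) }
    ; braidʳ = λ { {a ∷ b ∷ c ∷ xs} (p , q , r , _) → (r , q , p , tt) , refl
                 ; {_ ∷ _ ∷ []} (() , _)
                 ; {_ ∷ []} (() , _) } }

  distant : ∀ k → Commuting (swap 0) (swap (suc (suc k)))
  distant k = record
    { commute = λ { [] → refl ; (_ ∷ []) → refl ; (_ ∷ _ ∷ _) → refl }
    ; ascˡ  = λ { {_ ∷ _ ∷ _} a → a } ; ascʳ  = λ { {_ ∷ _ ∷ _} a → a }
    ; descˡ = λ { {_ ∷ _ ∷ _} d → d } ; descʳ = λ { {_ ∷ _ ∷ _} d → d } }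

  -- As long as neither index is 0 the first entry is a bystander and is stripped off; what remains
  -- is an overlapping or a disjoint pair.
  swap-dihedral : ∀ i j → i ≢ j → Dihedral (swap i) (swap j)
  swap-dihedral zero          zero          i≢j = ⊥-elim (i≢j refl)
  swap-dihedral zero          (suc zero)    i≢j = adjacent
  swap-dihedral zero          (suc (suc j)) i≢j = commuting⇒dihedral (distant j)
  swap-dihedral (suc zero)    zero          i≢j = Dihedral-sym adjacent
  swap-dihedral (suc (suc i)) zero          i≢j = Dihedral-sym (commuting⇒dihedral (distant i))
  swap-dihedral (suc i)       (suc j)       i≢j =
    lift-dihedral (swap-lifts i) (swap-lifts j) (swap-dihedral i j (λ eq → i≢j (cong suc eq)))

  swap-dichotomy : Trichotomous _≡_ _<_ → ∀ k {xs} → suc (suc k) ≤ length xs → Unique xs →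
                   AscSwap k xs ⊎ DescSwap k xs
  swap-dichotomy cmp zero {a ∷ b ∷ xs} _ ((a≢b ∷ _) ∷ _) with cmp a b
  ... | tri< a<b _ _ = inj₁ a<b
  ... | tri≈ _ eq _  = ⊥-elim (a≢b eq)
  ... | tri> _ _ b<a = inj₂ b<a
  swap-dichotomy cmp (suc k) {_ ∷ xs} (s≤s le) (_ ∷ u) = swap-dichotomy cmp k le u
  swap-dichotomy cmp zero {_ ∷ []} (s≤s ())

  ascSwap⇒≤length : ∀ k xs → AscSwap k xs → suc (suc k) ≤ length xs
  ascSwap⇒≤length zero    (_ ∷ _ ∷ _) a = s≤s (s≤s z≤n)
  ascSwap⇒≤length (suc k) (_ ∷ xs)    a = s≤s (ascSwap⇒≤length k xs a)

  swapAt-↭ : ∀ k (xs : List A) → swapAt k xs ↭ xs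
  swapAt-↭ zero    []          = ↭-refl
  swapAt-↭ zero    (_ ∷ [])    = ↭-refl
  swapAt-↭ zero    (x ∷ y ∷ _) = ↭.swap y x ↭-refl
  swapAt-↭ (suc k) []          = ↭-refl
  swapAt-↭ (suc k) (x ∷ xs)    = ↭.prep x (swapAt-↭ k xs)

  swapAt-++ˡ : ∀ k (xs ys : List A) → suc (suc k) ≤ length xs → swapAt k (xs ++ ys) ≡ swapAt k xs ++ ys
  swapAt-++ˡ zero    (_ ∷ _ ∷ _) ys le       = refl
  swapAt-++ˡ zero    (_ ∷ [])    ys (s≤s ())
  swapAt-++ˡ (suc k) (x ∷ xs)    ys (s≤s le) = cong (x ∷_) (swapAt-++ˡ k xs ys le)

  ascSwap-++ˡ : ∀ k (xs ys : List A) → suc (suc k) ≤ length xs → AscSwap k (xs ++ ys) ≡ AscSwap k xs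
  ascSwap-++ˡ zero    (_ ∷ _ ∷ _) ys le       = refl
  ascSwap-++ˡ zero    (_ ∷ [])    ys (s≤s ())
  ascSwap-++ˡ (suc k) (x ∷ xs)    ys (s≤s le) = ascSwap-++ˡ k xs ys le

  swapAt-++ʳ : ∀ (xs ys : List A) k → swapAt (length xs + k) (xs ++ ys) ≡ xs ++ swapAt k ys
  swapAt-++ʳ []       ys k = refl
  swapAt-++ʳ (x ∷ xs) ys k = cong (x ∷_) (swapAt-++ʳ xs ys k)

  ascSwap-++ʳ : ∀ (xs ys : List A) k → AscSwap (length xs + k) (xs ++ ys) ≡ AscSwap k ys
  ascSwap-++ʳ []       ys k = refl
  ascSwap-++ʳ (x ∷ xs) ys k = ascSwap-++ʳ xs ys k

  ¬descSwap-increasing : ∀ f → (∀ i → f i < f (suc i)) → ∀ k n → ¬ DescSwap k (applyUpTo f n)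
  ¬descSwap-increasing f inc zero    (suc (suc n)) d = <-asym d (inc 0)
  ¬descSwap-increasing f inc (suc k) (suc n)       d =
    ¬descSwap-increasing (λ i → f (suc i)) (λ i → inc (suc i)) k n d

-- The generators of types B and D.

open Swaps ℤ._<_ ℤ.<-trans ℤ.<-asym

negFirst : List ℤ → List ℤ
negFirst []       = []
negFirst (x ∷ xs) = ℤ.- x ∷ xs

negFirst-involutive : ∀ xs → negFirst (negFirst xs) ≡ xs
negFirst-involutive []       = refl
negFirst-involutive (x ∷ xs) = cong (_∷ xs) (ℤ.neg-involutive x)

-- The usual descent rule of type B with the convention π(0) = 0: the sign change lengthens π
-- exactly when π(1) > 0.
AscNeg DescNeg : List ℤ → Set
AscNeg []       = ⊥
AscNeg (x ∷ xs) = ℤ.0ℤ ℤ.< x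
DescNeg []       = ⊥
DescNeg (x ∷ xs) = x ℤ.< ℤ.0ℤ

negate : Gen (List ℤ)
negate = record { act = stepB 1 ; Asc = AscNeg ; Desc = DescNeg
  ; involutive = λ { [] → refl ; (x ∷ xs) → negFirst-involutive (x ∷ xs) }
  ; ascend  = λ { {x ∷ xs} a → ℤ.neg-mono-< a }
  ; descend = λ { {x ∷ xs} d → ℤ.neg-mono-< d }
  ; exclusive = λ { {x ∷ xs} a d → ℤ.<-asym a d } }

genB : ℕ → Gen (List ℤ)
genB zero          = trivial
genB (suc zero)    = negate
genB (suc (suc k)) = swap k

negate-distant : ∀ k → Commuting negate (swap (suc k))
negate-distant k = record { commute = λ { [] → refl ; (_ ∷ _) → refl }
  ; ascˡ  = λ { {_ ∷ _} a → a } ; ascʳ  = λ { {_ ∷ _} a → a }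
  ; descˡ = λ { {_ ∷ _} d → d } ; descʳ = λ { {_ ∷ _} d → d } }

-- An ascending alternating path of length four starts at a window p , q , … with 0 < p < q.
negate-adjacent : Dihedral negate (swap 0)
negate-adjacent = record { order = 4 ; 2≤order = s≤s (s≤s z≤n)
  ; bottom = λ { {a ∷ b ∷ xs} a<0 b<a →
      let p = ℤ.neg-mono-< a<0 ; q = ℤ.neg-mono-< (ℤ.<-trans b<a a<0) ; r = ℤ.neg-mono-< b<a
          eq = cong₂ (λ u v → u ∷ v ∷ xs) (ℤ.neg-involutive a) (ℤ.neg-involutive b) in
      ℤ.- a ∷ ℤ.- b ∷ xs ,
      ((p , ℤ.<-trans (ℤ.neg-mono-< q) p , q , r , tt) , eq) ,
      ((ℤ.neg-mono-< r , q , ℤ.<-trans (ℤ.neg-mono-< p) q , p , tt) , eq) }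
  ; braidˡ = λ { {_ ∷ _ ∷ _} (p , _ , q , r , _) →
      (ℤ.neg-mono-< r , q , ℤ.<-trans (ℤ.neg-mono-< p) q , p , tt) , refl
               ; {_ ∷ []} (_ , _ , _ , () , _) }
  ; braidʳ = λ { {_ ∷ _ ∷ _} (r , q , _ , p , _) →
      (p , ℤ.<-trans (ℤ.neg-mono-< q) p , q , ℤ.neg-cancel-< r , tt) , refl
               ; {_ ∷ []} (() , _) } }

dihedralB : ∀ {i j} → i ≢ j → Dihedral (genB i) (genB j)
dihedralB {zero}          {j}             i≢j = trivial-dihedral _
dihedralB {suc i}         {zero}          i≢j = Dihedral-sym (trivial-dihedral _)
dihedralB {1}             {1}             i≢j = ⊥-elim (i≢j refl)
dihedralB {1}             {2}             i≢j = negate-adjacent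
dihedralB {1}             {suc (suc (suc j))} i≢j = commuting⇒dihedral (negate-distant j)
dihedralB {2}             {1}             i≢j = Dihedral-sym negate-adjacent
dihedralB {suc (suc (suc i))} {1}         i≢j = Dihedral-sym (commuting⇒dihedral (negate-distant i))
dihedralB {suc (suc i)}   {suc (suc j)}   i≢j = swap-dihedral i j (λ eq → i≢j (cong (λ k → suc (suc k)) eq))

-- s^D_1 is the conjugate of the transposition of the first two positions by the
-- change of sign of the first entry.
AscD₁ DescD₁ : List ℤ → Set
AscD₁  xs = AscSwap 0 (negFirst xs)
DescD₁ xs = DescSwap 0 (negFirst xs)

swapNegate : Gen (List ℤ)
swapNegate = record { act = stepD 1 ; Asc = AscD₁ ; Desc = DescD₁
  ; involutive = λ { [] → refl ; (_ ∷ []) → refl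
      ; (a ∷ b ∷ xs) → cong₂ (λ u v → u ∷ v ∷ xs) (ℤ.neg-involutive a) (ℤ.neg-involutive b) }
  ; ascend = λ { {a ∷ b ∷ xs} p → subst (ℤ.- a ℤ.<_) (sym (ℤ.neg-involutive b)) p }
  ; descend = λ { {a ∷ b ∷ xs} p → subst (ℤ._< ℤ.- a) (sym (ℤ.neg-involutive b)) p }
  ; exclusive = λ { {a ∷ b ∷ xs} p q → ℤ.<-asym p q } }

genD : ℕ → Gen (List ℤ)
genD zero          = trivial
genD (suc zero)    = swapNegate
genD (suc (suc k)) = swap k

negFirst-cover : ∀ xs → ∃₂ λ (_ : ⊤) ys → xs ≡ negFirst ys
negFirst-cover xs = tt , negFirst xs , sym (negFirst-involutive xs)

-- Transport along conjugation by `negFirst`. There is a single copy, hence the parameter `⊤`; it is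
-- everything because `negFirst` is an involution.
swapNegate-lifts : Lifts (λ (_ : ⊤) → negFirst) (swap 0) swapNegate
swapNegate-lifts = record
  { act-f = λ { _ [] → refl ; _ (_ ∷ []) → refl ; _ (a ∷ b ∷ xs) → cong (λ u → ℤ.- b ∷ u ∷ xs) (ℤ.neg-involutive a) }
  ; asc⁺  = λ {_} {xs} a → subst (AscSwap 0) (sym (negFirst-involutive xs)) a
  ; asc⁻  = λ {_} {xs} a → subst (AscSwap 0) (negFirst-involutive xs) a
  ; desc⁻ = λ {_} {xs} d → subst (DescSwap 0) (negFirst-involutive xs) d
  ; coverᵃ = λ {y} _ → negFirst-cover y ; coverᵈ = λ {y} _ → negFirst-cover y }

distant-lifts : ∀ k → Lifts (λ (_ : ⊤) → negFirst) (swap (suc k)) (swap (suc k))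
distant-lifts k = record
  { act-f = λ { _ [] → refl ; _ (_ ∷ _) → refl }
  ; asc⁺  = λ { {_} {_ ∷ _} a → a } ; asc⁻  = λ { {_} {_ ∷ _} a → a } ; desc⁻ = λ { {_} {_ ∷ _} d → d }
  ; coverᵃ = λ {y} _ → negFirst-cover y ; coverᵈ = λ {y} _ → negFirst-cover y }

swapNegate-swap : Commuting swapNegate (swap 0)
swapNegate-swap = record
  { commute = λ { [] → refl ; (_ ∷ []) → refl ; (_ ∷ _ ∷ _) → refl }
  ; ascˡ  = λ { {a ∷ b ∷ _} p → subst (ℤ.- b ℤ.<_) (ℤ.neg-involutive a) (ℤ.neg-mono-< p) }
  ; ascʳ  = λ { {a ∷ b ∷ _} p → ℤ.neg-mono-< p }
  ; descˡ = λ { {a ∷ b ∷ _} p → subst (ℤ._< ℤ.- b) (ℤ.neg-involutive a) (ℤ.neg-mono-< p) }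
  ; descʳ = λ { {a ∷ b ∷ _} p → ℤ.neg-mono-< p } }

-- The two generators at the fork of the diagram, `s^D_1` and `s^D_2`, commute. Against any later
-- generator `s^D_1` behaves as `s^D_2` does, because conjugation by the first sign change exchanges
-- these two and fixes the later ones.
dihedralD : ∀ {i j} → i ≢ j → Dihedral (genD i) (genD j)
dihedralD {zero}          {j}             i≢j = trivial-dihedral _
dihedralD {suc i}         {zero}          i≢j = Dihedral-sym (trivial-dihedral _)
dihedralD {1}             {1}             i≢j = ⊥-elim (i≢j refl)
dihedralD {1}             {2}             i≢j = commuting⇒dihedral swapNegate-swap
dihedralD {1}             {suc (suc (suc j))} i≢j =
  lift-dihedral swapNegate-lifts (distant-lifts j) (swap-dihedral 0 (suc j) (λ ()))
dihedralD {2}             {1}             i≢j = Dihedral-sym (commuting⇒dihedral swapNegate-swap)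
dihedralD {suc (suc (suc i))} {1}         i≢j =
  lift-dihedral (distant-lifts i) swapNegate-lifts (swap-dihedral (suc i) 0 (λ ()))
dihedralD {suc (suc i)}   {suc (suc j)}   i≢j = swap-dihedral i j (λ eq → i≢j (cong (λ k → suc (suc k)) eq))

-- Reduced words as ascending paths.

foldl-cong : ∀ {A B : Set} {f g : A → B → A} → (∀ x y → f x y ≡ g x y) → ∀ e w → foldl f e w ≡ foldl g e w
foldl-cong eq e []      = refl
foldl-cong {g = g} eq e (y ∷ w) rewrite eq e y = foldl-cong eq (g e y) w

All-reverse : ∀ {a p} {A : Set a} {P : A → Set p} {w} → All P w → All P (reverse w)
All-reverse {w = w} = ↭.All-resp-↭ (↭-sym (↭.↭-reverse w))

module Reducedness {A : Set} (step : ℕ → List A → List A) (g : ℕ → Gen (List A))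
  (act≡step : ∀ i x → act (g i) x ≡ step i x)
  (dihedral : ∀ {i j} → i ≢ j → Dihedral (g i) (g j))
  (e : List A) (e-minimal : ∀ i → ¬ Desc (g i) e)
  (n : ℕ) (V : List A → Set) (V-e : V e)
  (V-act : ∀ {i x} → InRange n i → V x → V (act (g i) x))
  (dichotomy : ∀ {i x} → InRange n i → V x → Asc (g i) x ⊎ Desc (g i) x)
  (asc⇒range : ∀ {i x} → V x → Asc (g i) x → InRange n i) where

  open CoxeterSystem g dihedral e e-minimal public
  open Minimality (InRange n) V V-e V-act dichotomy public

  evalWith≡ev : ∀ w → evalWith step e w ≡ ev e (reverse w)
  evalWith≡ev w = trans (foldl-cong (λ x i → sym (act≡step i x)) e w)
    (sym (reverse-foldr (λ i → act (g i)) e w))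

  -- Needed to let a straightened word compete in the definition of `Reduced`, which ranges over
  -- words with letters at most `n`.
  Up⇒range : ∀ w → Up e w → All (InRange n) w
  Up⇒range []      p       = []
  Up⇒range (i ∷ w) (a , p) = let is = Up⇒range w p in asc⇒range (V-ev is) a ∷ is

  Path : Word → List A → Set
  Path w π = All (InRange n) w × Up e (reverse w) × ev e (reverse w) ≡ π

  -- Straightening either returns the word unchanged, and then it ascends, or yields a strictly
  -- shorter word for the same element, against minimality.
  reduced⇒path : ∀ {w π} → Reduced step e n π w → Path w π
  reduced⇒path {w} (is , refl , minimal) with straighten (All-reverse is)
  ... | w′ , p , eq , inj₁ refl = is , p , sym (evalWith≡ev w)
  ... | w′ , p , eq , inj₂ lt = ⊥-elim (<-irrefl refl (≤-trans lt (≤-trans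
    (≤-reflexive (length-reverse w))
    (≤-trans (minimal (reverse w′) (All-reverse (Up⇒range w′ p))
      (trans (evalWith≡ev (reverse w′)) (trans (cong (ev e) (reverse-involutive w′))
        (trans eq (sym (evalWith≡ev w))))))
      (≤-reflexive (length-reverse w′))))))

  path⇒reduced : ∀ {w π} → Path w π → Reduced step e n π w
  path⇒reduced {w} (is , p , eq) = is , trans (evalWith≡ev w) eq , λ w′ is′ eq′ →
    subst₂ _≤_ (length-reverse w) (length-reverse w′)
      (Up⇒minimal p (All-reverse is′) (trans (sym (evalWith≡ev w′)) (trans eq′ (sym eq))))

-- A simulation of the first system, with generators I and invariant V, inside the second one.
module Simulation {X Y : Set}
  (g : ℕ → Gen X) (dih : ∀ {i j} → i ≢ j → Dihedral (g i) (g j)) (e : X) (e-min : ∀ i → ¬ Desc (g i) e)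
  (g′ : ℕ → Gen Y) (dih′ : ∀ {i j} → i ≢ j → Dihedral (g′ i) (g′ j)) (e′ : Y) (e-min′ : ∀ i → ¬ Desc (g′ i) e′)
  (I : ℕ → Set) (V : X → Set) (V-e : V e) (V-act : ∀ {i x} → I i → V x → V (act (g i) x))
  (r : ℕ → ℕ) (h : X → Y) (h-e : h e ≡ e′)
  (h-act : ∀ {i x} → I i → V x → act (g′ (r i)) (h x) ≡ h (act (g i) x))
  (h-asc⁺ : ∀ {i x} → I i → V x → Asc (g i) x → Asc (g′ (r i)) (h x))
  (h-asc⁻ : ∀ {i x} → I i → V x → Asc (g′ (r i)) (h x) → Asc (g i) x) where

  private
    module S = CoxeterSystem g dih e e-min
    module T = CoxeterSystem g′ dih′ e′ e-min′

  invariant : ∀ {w} → All I w → V (S.ev e w)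
  invariant []       = V-e
  invariant (i ∷ is) = V-act i (invariant is)

  sim-ev : ∀ {w} → All I w → T.ev e′ (map r w) ≡ h (S.ev e w)
  sim-ev []       = sym h-e
  sim-ev (i ∷ is) = trans (cong (act (g′ _)) (sim-ev is)) (h-act i (invariant is))

  sim-Up⁺ : ∀ {w} → All I w → S.Up e w → T.Up e′ (map r w)
  sim-Up⁺ []       p       = tt
  sim-Up⁺ (i ∷ is) (a , p) =
    subst (Asc (g′ _)) (sym (sim-ev is)) (h-asc⁺ i (invariant is) a) , sim-Up⁺ is p

  sim-Up⁻ : ∀ {w} → All I w → T.Up e′ (map r w) → S.Up e w
  sim-Up⁻ []       p       = tt
  sim-Up⁻ (i ∷ is) (a , p) =
    h-asc⁻ i (invariant is) (subst (Asc (g′ _)) (sim-ev is) a) , sim-Up⁻ is p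

-- Signed windows and the common description of types B and D.

swapAt-map : ∀ {A B : Set} (f : A → B) k xs → swapAt k (map f xs) ≡ map f (swapAt k xs)
swapAt-map f zero    []          = refl
swapAt-map f zero    (_ ∷ [])    = refl
swapAt-map f zero    (_ ∷ _ ∷ _) = refl
swapAt-map f (suc k) []          = refl
swapAt-map f (suc k) (x ∷ xs)    = cong (f x ∷_) (swapAt-map f k xs)

idB≡applyUpTo : ∀ n → idB n ≡ applyUpTo (λ i → ℤ.+ suc i) n
idB≡applyUpTo n = map-applyUpTo (λ i → i) (λ i → ℤ.+ suc i) n

¬descSwap-idB : ∀ k n → ¬ DescSwap k (idB n)
¬descSwap-idB k n d = ¬descSwap-increasing (λ i → ℤ.+ suc i) (λ i → ℤ.+<+ ≤-refl) k n
  (subst (DescSwap k) (idB≡applyUpTo n) d)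

length-idB : ∀ n → length (idB n) ≡ n
length-idB n = trans (length-map _ (upTo n)) (length-upTo n)

module SignedPerm {n : ℕ} {x : List ℤ} (perm : IsSignedPerm n x) where

  signedPerm-length : length x ≡ n
  signedPerm-length = trans (sym (length-map ∣_∣ x)) (trans (↭.↭-length perm)
    (trans (length-map suc (upTo n)) (length-upTo n)))

  signedPerm-unique : Unique (map ∣_∣ x)
  signedPerm-unique = ↭Setoid.Unique-resp-↭ (≡.setoid ℕ) (↭.↭⇒↭ₛ (↭-sym perm)) (Unique.map⁺ suc-injective (Unique.upTo⁺ n))

  signedPerm-positive : All (1 ≤_) (map ∣_∣ x)
  signedPerm-positive = ↭.All-resp-↭ (↭-sym perm) (All.map⁺ (All.universal (λ _ → s≤s z≤n) (upTo n)))

open SignedPerm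

signedPerm-swapAt : ∀ {n x} k → IsSignedPerm n x → IsSignedPerm n (swapAt k x)
signedPerm-swapAt {x = x} k p = ↭-trans (↭.map⁺ ∣_∣ (swapAt-↭ k x)) p

signedPerm-idB : ∀ n → IsSignedPerm n (idB n)
signedPerm-idB n = ↭-reflexive (trans (cong (map ∣_∣) (idB≡applyUpTo n))
  (trans (map-applyUpTo (λ i → ℤ.+ suc i) ∣_∣ n) (sym (map-applyUpTo (λ i → i) suc n))))

-- What the argument needs to know about types B and D.
record Series : Set₁ where
  field
    step     : ℕ → List ℤ → List ℤ
    gen      : ℕ → Gen (List ℤ)
    act≡step : ∀ i x → act (gen i) x ≡ step i x
    dihedral : ∀ {i j} → i ≢ j → Dihedral (gen i) (gen j)
    least    : ℕ
    1≤least  : 1 ≤ least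
    minimal  : ∀ n i → ¬ Desc (gen i) (idB n)
    act-perm : ∀ {n i x} → IsSignedPerm n x → IsSignedPerm n (act (gen i) x)
    dichotomy : ∀ {n} → least ≤ n → ∀ {i x} → InRange n i → IsSignedPerm n x →
                Asc (gen i) x ⊎ Desc (gen i) x
    asc⇒range : ∀ {n i x} → IsSignedPerm n x → Asc (gen i) x → InRange n i
    natural  : ∀ f → (∀ a → f (ℤ.- a) ≡ ℤ.- f a) → ∀ i x → act (gen i) (map f x) ≡ map f (act (gen i) x)
    act-++   : ∀ {n i x} → least ≤ n → InRange n i → length x ≡ n → ∀ r → act (gen i) (x ++ r) ≡ act (gen i) x ++ r
    asc-++   : ∀ {n i x} → least ≤ n → InRange n i → length x ≡ n → ∀ r → Asc (gen i) (x ++ r) ≡ Asc (gen i) x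
    gen-swap : ∀ k → gen (suc (suc k)) ≡ swap k
    Element  : Set
    rank     : Element → ℕ
    least≤rank : ∀ x → least ≤ rank x
    window   : Element → List ℤ
    words    : Element → List Word
    enum     : ∀ x → Enumerates (words x) (Reduced step (idB (rank x)) (rank x) (window x))
    build    : ∀ {n} → least ≤ n → ∀ {w} → All (InRange n) w → ∀ {ws} →
               Enumerates ws (Reduced step (idB n) n (evalWith step (idB n) w)) →
               Σ Element λ x → rank x ≡ n × words x ≡ ws

seriesB : Series
seriesB = record
  { step = stepB ; gen = genB ; act≡step = act≡stepB ; dihedral = dihedralB
  ; least = 1 ; 1≤least = ≤-refl ; minimal = minimalB ; act-perm = λ {n} {i} {x} → act-perm i x
  ; dichotomy = λ _ {i} {x} → dichotomyB i x
  ; asc⇒range = λ {n} {i} {x} → asc⇒range i x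
  ; natural = natural
  ; act-++ = λ {n} {i} {x} _ → act-++ i x
  ; asc-++ = λ {n} {i} {x} _ → asc-++ i x
  ; gen-swap = λ _ → refl
  ; Element = GenB ; rank = GenB.n ; least≤rank = GenB.1≤n ; window = GenB.π ; words = GenB.ws ; enum = GenB.enum
  ; build = λ {n} 1≤n {w} is {ws} en → record { n = n ; 1≤n = 1≤n ; isπ = evalPerm w (signedPerm-idB n) ; ws = ws ; enum = en } , refl , refl
  }
  where
  act≡stepB : ∀ i x → act (genB i) x ≡ stepB i x
  act≡stepB zero          x = refl
  act≡stepB (suc zero)    x = refl
  act≡stepB (suc (suc k)) x = refl
  minimalB : ∀ n i → ¬ Desc (genB i) (idB n)
  minimalB (suc n) (suc zero) (ℤ.+<+ ())
  minimalB n (suc (suc k)) d = ¬descSwap-idB k n d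
  act-perm : ∀ {n} i x → IsSignedPerm n x → IsSignedPerm n (act (genB i) x)
  act-perm zero          x        p = p
  act-perm (suc zero)    []       p = p
  act-perm (suc zero)    (x ∷ xs) p rewrite ℤ.∣-i∣≡∣i∣ x = p
  act-perm (suc (suc k)) x        p = signedPerm-swapAt k p
  evalPerm : ∀ {n} w {x} → IsSignedPerm n x → IsSignedPerm n (evalWith stepB x w)
  evalPerm []      p = p
  evalPerm (i ∷ w) {x} p = evalPerm w (subst (IsSignedPerm _) (act≡stepB i x) (act-perm i x p))
  dichotomyB : ∀ {n} i x → InRange n i → IsSignedPerm n x → Asc (genB i) x ⊎ Desc (genB i) x
  dichotomyB (suc zero) [] (_ , le) p =
    ⊥-elim (<-irrefl refl (≤-trans le (≤-reflexive (sym (signedPerm-length {x = []} p)))))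
  dichotomyB (suc zero) (x ∷ xs) _ p with ℤ.<-cmp ℤ.0ℤ x | signedPerm-positive {x = x ∷ xs} p
  ... | tri< a _ _ | _ = inj₁ a
  ... | tri> _ _ d | _ = inj₂ d
  -- A first entry 0 is impossible, since the absolute values in a window are at least 1.
  ... | tri≈ _ refl _ | () ∷ _
  dichotomyB (suc (suc k)) x (_ , le) p = swap-dichotomy ℤ.<-cmp k
    (≤-trans le (≤-reflexive (sym (signedPerm-length p)))) (Unique.map⁻ (signedPerm-unique p))
  asc⇒range : ∀ {n} i x → IsSignedPerm n x → Asc (genB i) x → InRange n i
  asc⇒range (suc zero)    (x ∷ xs) p a = s≤s z≤n , ≤-trans (s≤s z≤n) (≤-reflexive (signedPerm-length {x = x ∷ xs} p))
  asc⇒range (suc (suc k)) x        p a = s≤s z≤n , ≤-trans (ascSwap⇒≤length k x a) (≤-reflexive (signedPerm-length p))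
  natural : ∀ f → (∀ a → f (ℤ.- a) ≡ ℤ.- f a) → ∀ i x → act (genB i) (map f x) ≡ map f (act (genB i) x)
  natural f odd zero          x        = refl
  natural f odd (suc zero)    []       = refl
  natural f odd (suc zero)    (x ∷ xs) = cong (_∷ map f xs) (sym (odd x))
  natural f odd (suc (suc k)) x        = swapAt-map f k x
  act-++ : ∀ {n} i x → InRange n i → length x ≡ n → ∀ r → act (genB i) (x ++ r) ≡ act (genB i) x ++ r
  act-++ (suc zero)    (x ∷ xs) _        eq   r = refl
  act-++ (suc zero)    []       (_ , ()) refl r
  act-++ (suc (suc k)) x        (_ , le) refl r = swapAt-++ˡ k x r le
  asc-++ : ∀ {n} i x → InRange n i → length x ≡ n → ∀ r → Asc (genB i) (x ++ r) ≡ Asc (genB i) x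
  asc-++ (suc zero)    (x ∷ xs) _        eq   r = refl
  asc-++ (suc zero)    []       (_ , ()) refl r
  asc-++ (suc (suc k)) x        (_ , le) refl r = ascSwap-++ˡ k x r le

seriesD : Series
seriesD = record
  { step = stepD ; gen = genD ; act≡step = act≡stepD ; dihedral = dihedralD
  -- On a window with fewer than two entries `stepD 1` is the identity, and appending entries would
  -- change its effect, so `act-++` would fail.
  ; least = 2 ; 1≤least = s≤s z≤n ; minimal = minimalD ; act-perm = λ {n} {i} {x} → act-perm i x
  ; dichotomy = λ 2≤n {i} {x} → dichotomyD 2≤n i x
  ; asc⇒range = λ {n} {i} {x} → asc⇒range i x
  ; natural = natural
  ; act-++ = λ {n} {i} {x} 2≤n → act-++ 2≤n i x
  ; asc-++ = λ {n} {i} {x} 2≤n → asc-++ 2≤n i x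
  ; gen-swap = λ _ → refl
  ; Element = GenD ; rank = GenD.n ; least≤rank = GenD.2≤n ; window = GenD.π ; words = GenD.ws ; enum = GenD.enum
  -- Membership in `D_n` is witnessed by a word, which is why `build` receives an element in the
  -- form of a word.
  ; build = λ {n} 2≤n {w} is {ws} en →
      record { n = n ; 2≤n = 2≤n ; isπ = evalPerm w (signedPerm-idB n) , w , is , refl ; ws = ws ; enum = en } , refl , refl
  }
  where
  act≡stepD : ∀ i x → act (genD i) x ≡ stepD i x
  act≡stepD zero          x = refl
  act≡stepD (suc zero)    x = refl
  act≡stepD (suc (suc k)) x = refl
  minimalD : ∀ n i → ¬ Desc (genD i) (idB n)
  minimalD (suc (suc n)) (suc zero) ()
  minimalD n (suc (suc k)) d = ¬descSwap-idB k n d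
  act-perm : ∀ {n} i x → IsSignedPerm n x → IsSignedPerm n (act (genD i) x)
  act-perm zero          x            p = p
  act-perm (suc zero)    []           p = p
  act-perm (suc zero)    (_ ∷ [])     p = p
  act-perm (suc zero)    (x ∷ y ∷ xs) p rewrite ℤ.∣-i∣≡∣i∣ x | ℤ.∣-i∣≡∣i∣ y = ↭-trans (↭.swap ∣ y ∣ ∣ x ∣ ↭-refl) p
  act-perm (suc (suc k)) x            p = signedPerm-swapAt k p
  evalPerm : ∀ {n} w {x} → IsSignedPerm n x → IsSignedPerm n (evalWith stepD x w)
  evalPerm []      p = p
  evalPerm (i ∷ w) {x} p = evalPerm w (subst (IsSignedPerm _) (act≡stepD i x) (act-perm i x p))
  map-abs-negFirst : ∀ x → map ∣_∣ (negFirst x) ≡ map ∣_∣ x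
  map-abs-negFirst []       = refl
  map-abs-negFirst (x ∷ xs) = cong (_∷ map ∣_∣ xs) (ℤ.∣-i∣≡∣i∣ x)
  -- For `s^D_1` the comparison is made after negating the first entry; absolute values are
  -- unaffected, so the entries stay distinct.
  dichotomyD : ∀ {n} → 2 ≤ n → ∀ i x → InRange n i → IsSignedPerm n x → Asc (genD i) x ⊎ Desc (genD i) x
  dichotomyD 2≤n (suc zero) x _ p = swap-dichotomy ℤ.<-cmp 0
    (≤-trans 2≤n (≤-reflexive (sym (trans (sym (length-map ∣_∣ (negFirst x)))
      (trans (cong length (map-abs-negFirst x)) (trans (length-map ∣_∣ x) (signedPerm-length p)))))))
    (Unique.map⁻ (subst Unique (sym (map-abs-negFirst x)) (signedPerm-unique p)))
  dichotomyD 2≤n (suc (suc k)) x (_ , le) p = swap-dichotomy ℤ.<-cmp k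
    (≤-trans le (≤-reflexive (sym (signedPerm-length p)))) (Unique.map⁻ (signedPerm-unique p))
  asc⇒range : ∀ {n} i x → IsSignedPerm n x → Asc (genD i) x → InRange n i
  asc⇒range (suc zero)    (x ∷ y ∷ xs) p a = s≤s z≤n , ≤-trans (s≤s z≤n) (≤-reflexive (signedPerm-length {x = x ∷ y ∷ xs} p))
  asc⇒range (suc (suc k)) x            p a = s≤s z≤n , ≤-trans (ascSwap⇒≤length k x a) (≤-reflexive (signedPerm-length p))
  natural : ∀ f → (∀ a → f (ℤ.- a) ≡ ℤ.- f a) → ∀ i x → act (genD i) (map f x) ≡ map f (act (genD i) x)
  natural f odd zero          x            = refl
  natural f odd (suc zero)    []           = refl
  natural f odd (suc zero)    (_ ∷ [])     = refl
  natural f odd (suc zero)    (x ∷ y ∷ xs) = cong₂ (λ u v → u ∷ v ∷ map f xs) (sym (odd y)) (sym (odd x))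
  natural f odd (suc (suc k)) x            = swapAt-map f k x
  act-++ : ∀ {n} → 2 ≤ n → ∀ i x → InRange n i → length x ≡ n → ∀ r → act (genD i) (x ++ r) ≡ act (genD i) x ++ r
  act-++ 2≤n      (suc zero)    (_ ∷ _ ∷ _) _        eq   r = refl
  act-++ (s≤s ()) (suc zero)    (_ ∷ [])    _        refl r
  act-++ ()       (suc zero)    []          _        refl r
  act-++ 2≤n      (suc (suc k)) x           (_ , le) refl r = swapAt-++ˡ k x r le
  asc-++ : ∀ {n} → 2 ≤ n → ∀ i x → InRange n i → length x ≡ n → ∀ r → Asc (genD i) (x ++ r) ≡ Asc (genD i) x
  asc-++ 2≤n      (suc zero)    (_ ∷ _ ∷ _) _        eq   r = refl
  asc-++ (s≤s ()) (suc zero)    (_ ∷ [])    _        refl r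
  asc-++ ()       (suc zero)    []          _        refl r
  asc-++ 2≤n      (suc (suc k)) x           (_ , le) refl r = ascSwap-++ˡ k x r le

-- Duplicate-free lists split into classes, and enumeration of reduced words.

-- `r` recovers from an element the block it lies in, so different blocks are disjoint.
concatMap-unique : ∀ {A B : Set} {f : A → List B} (r : B → A) {xs} → Unique xs →
  (∀ {x} → x ∈ xs → Unique (f x)) → (∀ {x y} → x ∈ xs → y ∈ f x → r y ≡ x) → Unique (concatMap f xs)
concatMap-unique r {[]} [] uf rf = []
concatMap-unique {f = f} r {x ∷ xs} (x∉ ∷ u) uf rf = Unique.++⁺ (uf (here refl))
  (concatMap-unique r u (λ p → uf (there p)) (λ p → rf (there p)))
  λ { (p , q) → let (x′ , x′∈ , y∈) = find (∈-concatMap⁻ f {xs = xs} q) in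
      All.lookup x∉ x′∈ (trans (sym (rf (here refl) p)) (rf (there x′∈) y∈)) }

∈-concatMap : ∀ {A B : Set} (f : A → List B) {xs x y} → x ∈ xs → y ∈ f x → y ∈ concatMap f xs
∈-concatMap f x∈ y∈ = ∈-concatMap⁺ f (lose x∈ y∈)

unique-↭ : ∀ {A : Set} {xs ys : List A} → Unique xs → Unique ys →
           (∀ {x} → x ∈ xs → x ∈ ys) → (∀ {x} → x ∈ ys → x ∈ xs) → xs ↭ ys
unique-↭ u v f g = ∼bag⇒↭ (unique∧set⇒bag u v (mk⇔ f g))

module Partition {A K G : Set} (_≟_ : DecidableEquality K) (key : A → K) (members : G → List A) where

  filter-↭ : ∀ k xs → filter (λ x → key x ≟ k) xs ++ filter (λ x → ¬? (key x ≟ k)) xs ↭ xs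
  filter-↭ k []       = ↭-refl
  filter-↭ k (x ∷ xs) with key x ≟ k
  ... | yes _ = _↭_.prep x (filter-↭ k xs)
  ... | no  _ = ↭-trans (↭.shift x (filter (λ x → key x ≟ k) xs) _) (_↭_.prep x (filter-↭ k xs))

  IsFiber : List A → A → G → Set
  IsFiber xs a g = Unique (members g) × (∀ x → (x ∈ members g → x ∈ xs × key x ≡ key a) ×
                                               (x ∈ xs × key x ≡ key a → x ∈ members g))

  -- The whole class of the first element is removed at once; it is the member list of one `g`. The
  -- classes of the other elements lose nothing, since their keys differ. The length of the list
  -- serves as fuel, filtering not being structural.
  partition : ∀ xs → Unique xs → (∀ {a} → a ∈ xs → ∃ (IsFiber xs a)) → ∃ λ gs → xs ↭ concatMap members gs
  partition xs u fib = go (length xs) xs ≤-refl u fib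
    where
    go : ∀ n xs → length xs ≤ n → Unique xs → (∀ {a} → a ∈ xs → ∃ (IsFiber xs a)) →
         ∃ λ gs → xs ↭ concatMap members gs
    go n       []       le       u fib = [] , ↭-refl
    go (suc n) (a ∷ xs) (s≤s le) u fib = proj₁ fiber ∷ proj₁ rest ,
      ↭-trans (↭-sym (filter-↭ (key a) (a ∷ xs)))
        (↭.++⁺ (unique-↭ (Unique.filter⁺ same? u) (proj₁ (proj₂ fiber))
            (λ p → proj₂ (proj₂ (proj₂ fiber) _) (∈-filter⁻ same? {xs = a ∷ xs} p))
            (λ p → let (p∈ , eq) = proj₁ (proj₂ (proj₂ fiber) _) p in ∈-filter⁺ same? p∈ eq))
          (proj₂ rest))
      where
      same? = λ x → key x ≟ key a
      other? = λ x → ¬? (key x ≟ key a)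
      others = filter other? (a ∷ xs)
      fiber = fib (here refl)
      others-length : length others ≤ length xs
      others-length with key a ≟ key a
      ... | yes _ = length-filter other? xs
      ... | no ≢  = ⊥-elim (≢ refl)
      fib′ : ∀ {b} → b ∈ others → ∃ (IsFiber others b)
      fib′ {b} b∈ with ∈-filter⁻ other? {xs = a ∷ xs} b∈
      ... | b∈′ , b≢ with fib b∈′
      ... | g , ug , mem = g , ug , λ x →
        (λ p → let (x∈ , eq) = proj₁ (mem x) p in ∈-filter⁺ other? x∈ (λ q → b≢ (trans (sym eq) q)) , eq) ,
        (λ (p , eq) → proj₂ (mem x) (proj₁ (∈-filter⁻ other? {xs = a ∷ xs} p) , eq))
      rest = go n others (≤-trans others-length le) (Unique.filter⁺ other? u) fib′

wordsOfLength : ℕ → ℕ → List Word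
wordsOfLength n zero    = [ [] ]
wordsOfLength n (suc k) = cartesianProductWith _∷_ (applyUpTo suc n) (wordsOfLength n k)

wordsOfLength-unique : ∀ n k → Unique (wordsOfLength n k)
wordsOfLength-unique n zero    = [] ∷ []
wordsOfLength-unique n (suc k) = Unique.cartesianProductWith⁺ _∷_ ∷-injective
  (Unique.applyUpTo⁺₁ suc n (λ i<j _ eq → ℕ.<⇒≢ i<j (suc-injective eq))) (wordsOfLength-unique n k)

∈-wordsOfLength⁺ : ∀ {n w} → All (InRange n) w → w ∈ wordsOfLength n (length w)
∈-wordsOfLength⁺ [] = here refl
∈-wordsOfLength⁺ {n} {suc i ∷ w} ((_ , le) ∷ is) =
  ∈-cartesianProductWith⁺ _∷_ (∈-applyUpTo⁺ suc le) (∈-wordsOfLength⁺ is)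

∈-wordsOfLength⁻ : ∀ n k {w} → w ∈ wordsOfLength n k → All (InRange n) w × length w ≡ k
∈-wordsOfLength⁻ n zero    (here refl) = [] , refl
∈-wordsOfLength⁻ n (suc k) p
  with ∈-cartesianProductWith⁻ _∷_ (applyUpTo suc n) (wordsOfLength n k) p
... | i , w , i∈ , w∈ , refl with ∈-applyUpTo⁻ suc i∈ | ∈-wordsOfLength⁻ n k w∈
...   | j , j<n , refl | is , eq = (s≤s z≤n , j<n) ∷ is , cong suc eq

-- All reduced words of an element are as long as the given one, so they lie among the finitely many
-- words of that length, where evaluation alone selects them.
enumerate : ∀ {A : Set} → DecidableEquality (List A) → ∀ {step e n π w} → Reduced step e n π w →
            ∃ λ ws → Enumerates ws (Reduced step e n π)
enumerate _≟_ {step} {e} {n} {π} {w} (is , eq , minimal) = ws ,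
  Unique.filter⁺ π? (wordsOfLength-unique n (length w)) , λ v → sound v , complete v
  where
  π? = λ v → evalWith step e v ≟ π
  ws = filter π? (wordsOfLength n (length w))
  sound : ∀ v → v ∈ ws → Reduced step e n π v
  sound v v∈ with ∈-filter⁻ π? {xs = wordsOfLength n (length w)} v∈
  ... | v∈′ , eqv with ∈-wordsOfLength⁻ n (length w) v∈′
  ... | is′ , len = is′ , eqv , λ v′ is″ eq″ → ≤-trans (≤-reflexive len) (minimal v′ is″ eq″)
  complete : ∀ v → Reduced step e n π v → v ∈ ws
  complete v (is′ , eqv , minimal′) = ∈-filter⁺ π?
    (subst (λ k → v ∈ wordsOfLength n k) (ℕ.≤-antisym (minimal′ w is eq) (minimal v is′ eqv)) (∈-wordsOfLength⁺ is′))
    eqv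

-- Shuffles of words whose letters lie on different sides.

∈-shuffles-consˡ : ∀ i {x y z} → z ∈ shuffles x y → i ∷ z ∈ shuffles (i ∷ x) y
∈-shuffles-consˡ i {[]}    {[]}    (here refl) = here refl
∈-shuffles-consˡ i {_ ∷ _} {[]}    (here refl) = here refl
∈-shuffles-consˡ i {x}     {_ ∷ _} p           = ∈-++⁺ˡ (∈-map⁺ (i ∷_) p)

∈-shuffles-consʳ : ∀ i {x y z} → z ∈ shuffles x y → i ∷ z ∈ shuffles x (i ∷ y)
∈-shuffles-consʳ i {[]}     (here refl) = here refl
∈-shuffles-consʳ i {j ∷ x} {y} p = ∈-++⁺ʳ (map (j ∷_) (shuffles x (i ∷ y))) (∈-map⁺ (i ∷_) p)

module RestrictShuffles (side : ℕ → Bool) where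
  open Restrict side

  private
    true≢false : true ≢ false
    true≢false ()

  restrict-all : ∀ {b x} → All (λ i → side i ≡ b) x → restrict b x ≡ x
  restrict-all []                   = refl
  restrict-all {b} {i ∷ x} (p ∷ ps) = trans (restrict-yes x p) (cong (i ∷_) (restrict-all ps))

  restrict-none : ∀ {b x} → All (λ i → side i ≢ b) x → restrict b x ≡ []
  restrict-none []                   = refl
  restrict-none {b} {i ∷ x} (p ∷ ps) = trans (restrict-no x p) (restrict-none ps)

  restrict-reverse : ∀ b w → restrict b (reverse w) ≡ reverse (restrict b w)
  restrict-reverse b [] = refl
  restrict-reverse b (i ∷ w) rewrite unfold-reverse i w
    | filter-++ (λ j → side j Bool.≟ b) (reverse w) [ i ] | restrict-reverse b w
    with side i Bool.≟ b
  ... | yes _ = sym (unfold-reverse i (restrict b w))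
  ... | no  _ = ++-identityʳ _

  True False : Word → Set
  True  = All (λ i → side i ≡ true)
  False = All (λ i → side i ≡ false)

  shuffles-restrict : ∀ {x y} → True x → False y → ∀ {z} → z ∈ shuffles x y →
                      restrict true z ≡ x × restrict false z ≡ y
  shuffles-restrict {[]} t f (here refl) =
    restrict-none (All.map (λ p q → true≢false (trans (sym q) p)) f) , restrict-all f
  shuffles-restrict {i ∷ x} {[]} t f (here refl) =
    restrict-all t , restrict-none (All.map (λ p q → true≢false (trans (sym p) q)) t)
  shuffles-restrict {i ∷ x} {j ∷ y} (p ∷ t) (q ∷ f) {z} z∈
    with ∈-++⁻ (map (i ∷_) (shuffles x (j ∷ y))) z∈
  ... | inj₁ z∈ˡ with ∈-map⁻ (i ∷_) z∈ˡ
  ...   | z′ , z′∈ , refl with shuffles-restrict t (q ∷ f) z′∈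
  ...     | eq₁ , eq₂ = trans (restrict-yes z′ p) (cong (i ∷_) eq₁) ,
                        trans (restrict-no z′ (λ r → true≢false (trans (sym p) r))) eq₂
  shuffles-restrict {i ∷ x} {j ∷ y} (p ∷ t) (q ∷ f) {z} z∈
      | inj₂ z∈ʳ with ∈-map⁻ (j ∷_) z∈ʳ
  ...   | z′ , z′∈ , refl with shuffles-restrict (p ∷ t) f z′∈
  ...     | eq₁ , eq₂ = trans (restrict-no z′ (λ r → true≢false (trans (sym r) q))) eq₁ ,
                        trans (restrict-yes z′ q) (cong (j ∷_) eq₂)

  ∈-shuffles-restrict : ∀ z → z ∈ shuffles (restrict true z) (restrict false z)
  ∈-shuffles-restrict [] = here refl
  ∈-shuffles-restrict (i ∷ z) with side i
  ... | true  = ∈-shuffles-consˡ i {restrict true z} {restrict false z} (∈-shuffles-restrict z)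
  ... | false = ∈-shuffles-consʳ i {restrict true z} {restrict false z} (∈-shuffles-restrict z)

  -- The side of the first letter tells which word it was taken from, so every shuffle occurs
  -- exactly once and the shuffle product has coefficients one.
  shuffles-unique : ∀ {x y} → True x → False y → Unique (shuffles x y)
  shuffles-unique {[]}             t       f       = [] ∷ []
  shuffles-unique {_ ∷ _} {[]}     t       f       = [] ∷ []
  shuffles-unique {i ∷ x} {j ∷ y} (p ∷ t) (q ∷ f) = Unique.++⁺
    (Unique.map⁺ ∷-injectiveʳ (shuffles-unique t (q ∷ f)))
    (Unique.map⁺ ∷-injectiveʳ (shuffles-unique (p ∷ t) f))
    λ (a , b) → let (_ , _ , eq₁) = ∈-map⁻ (i ∷_) a ; (_ , _ , eq₂) = ∈-map⁻ (j ∷_) b in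
      true≢false (trans (sym p) (trans (cong side (∷-injectiveˡ (trans (sym eq₁) eq₂))) q))

-- The symmetric group as an instance.

module SwapsS = Swaps _<_ ℕ.<-trans ℕ.<-asym

genS : ℕ → Gen (List ℕ)
genS zero    = trivial
genS (suc k) = SwapsS.swap k

dihedralS : ∀ {i j} → i ≢ j → Dihedral (genS i) (genS j)
dihedralS {zero}          i≢j = trivial-dihedral _
dihedralS {suc i} {zero}  i≢j = Dihedral-sym (trivial-dihedral _)
dihedralS {suc i} {suc j} i≢j = SwapsS.swap-dihedral i j (λ eq → i≢j (cong suc eq))

idS≡applyUpTo : ∀ N → idS N ≡ applyUpTo suc (suc N)
idS≡applyUpTo N = map-applyUpTo (λ i → i) suc (suc N)

minimalS : ∀ N i → ¬ Desc (genS i) (idS N)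
minimalS N (suc k) d = SwapsS.¬descSwap-increasing suc (λ i → ≤-refl) k (suc N)
  (subst (SwapsS.DescSwap k) (idS≡applyUpTo N) d)

permS-length : ∀ {N x} → IsPermS N x → length x ≡ suc N
permS-length {N} p = trans (↭.↭-length p) (trans (cong length (idS≡applyUpTo N)) (length-applyUpTo suc (suc N)))

permS-unique : ∀ {N x} → IsPermS N x → Unique x
permS-unique {N} p = ↭Setoid.Unique-resp-↭ (≡.setoid ℕ) (↭.↭⇒↭ₛ (↭-sym p)) (Unique.map⁺ suc-injective (Unique.upTo⁺ (suc N)))

act≡stepS : ∀ i x → act (genS i) x ≡ stepS i x
act≡stepS zero    x = refl
act≡stepS (suc k) x = refl

permS-act : ∀ {N i x} → InRange N i → IsPermS N x → IsPermS N (act (genS i) x)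
permS-act {i = zero}      _ p = p
permS-act {i = suc k} {x} _ p = ↭-trans (SwapsS.swapAt-↭ k x) p

permS-dichotomy : ∀ {N i x} → InRange N i → IsPermS N x → Asc (genS i) x ⊎ Desc (genS i) x
permS-dichotomy {i = suc k} (_ , le) p =
  SwapsS.swap-dichotomy ℕ.<-cmp k (≤-trans (s≤s le) (≤-reflexive (sym (permS-length p)))) (permS-unique p)

permS-asc⇒range : ∀ {N i x} → IsPermS N x → Asc (genS i) x → InRange N i
permS-asc⇒range {i = suc k} {x} p a =
  s≤s z≤n , ℕ.≤-pred (≤-trans (SwapsS.ascSwap⇒≤length k x a) (≤-reflexive (permS-length p)))

module TypeS (N : ℕ) = Reducedness stepS genS act≡stepS dihedralS (idS N) (minimalS N)
  N (IsPermS N) ↭-refl permS-act permS-dichotomy permS-asc⇒range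

-- Left multiplication and factors of reduced words.

nth : List ℤ → ℕ → ℤ
nth []       i       = ℤ.0ℤ
nth (x ∷ xs) zero    = x
nth (x ∷ xs) (suc i) = nth xs i

applyUpTo-nth : ∀ α → applyUpTo (nth α) (length α) ≡ α
applyUpTo-nth []      = refl
applyUpTo-nth (x ∷ α) = cong (x ∷_) (applyUpTo-nth α)

-- The extension of the window α to an odd function on ℤ, with junk value 0 beyond the window.
leftMultiply : List ℤ → ℤ → ℤ
leftMultiply α (ℤ.+ zero)  = ℤ.0ℤ
leftMultiply α (ℤ.+ suc i) = nth α i
leftMultiply α ℤ.-[1+ i ]  = ℤ.- nth α i

leftMultiply-odd : ∀ α a → leftMultiply α (ℤ.- a) ≡ ℤ.- leftMultiply α a
leftMultiply-odd α (ℤ.+ zero)  = refl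
leftMultiply-odd α (ℤ.+ suc i) = refl
leftMultiply-odd α ℤ.-[1+ i ]  = sym (ℤ.neg-involutive (nth α i))

map-leftMultiply : ∀ α → map (leftMultiply α) (idB (length α)) ≡ α
map-leftMultiply α = trans (cong (map _) (idB≡applyUpTo (length α)))
  (trans (map-applyUpTo _ (leftMultiply α) (length α)) (applyUpTo-nth α))

applyUpTo-++ : ∀ {A : Set} (f : ℕ → A) a b → applyUpTo f (a + b) ≡ applyUpTo f a ++ applyUpTo (λ i → f (a + i)) b
applyUpTo-++ f zero    b = refl
applyUpTo-++ f (suc a) b = cong (f 0 ∷_) (applyUpTo-++ (λ i → f (suc i)) a b)

splits : Word → List (Word × Word)
splits w = map (λ i → take i w , drop i w) (upTo (suc (length w)))

∈-splits⁻ : ∀ {w u v} → (u , v) ∈ splits w → u ++ v ≡ w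
∈-splits⁻ {w} p with ∈-map⁻ (λ i → take i w , drop i w) {xs = upTo (suc (length w))} p
... | i , _ , refl = take++drop≡id i w

∈-splits⁺ : ∀ u v → (u , v) ∈ splits (u ++ v)
∈-splits⁺ u v = subst (_∈ splits (u ++ v)) (cong₂ _,_ (take-length u) (drop-length u))
  (∈-map⁺ (λ i → take i (u ++ v) , drop i (u ++ v))
    (∈-upTo⁺ (s≤s (≤-trans (m≤m+n (length u) (length v)) (≤-reflexive (sym (length-++ u)))))))
  where
  take-length : ∀ u → take (length u) (u ++ v) ≡ u
  take-length []      = refl
  take-length (i ∷ u) = cong (i ∷_) (take-length u)
  drop-length : ∀ u → drop (length u) (u ++ v) ≡ v
  drop-length []      = refl
  drop-length (i ∷ u) = drop-length u

splits-unique : ∀ w → Unique (splits w)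
-- The prefixes of the successive cuts have lengths 0, 1, 2, ..., all different.
splits-unique w = Unique.map⁻ {f = λ p → length (proj₁ p)} (subst Unique lengths (Unique.upTo⁺ (suc (length w))))
  where
  lengths : upTo (suc (length w)) ≡ map (λ p → length (proj₁ p)) (splits w)
  lengths = trans (sym (map-id _)) (trans (map-cong-local (All.tabulate (λ {i} i∈ →
      sym (trans (length-take i w) (ℕ.m≤n⇒m⊓n≡m (ℕ.≤-pred (∈-upTo⁻ i∈))))))) (map-∘ (upTo (suc (length w)))))

module OfSeries (series : Series) where
  open Series series

  module Rank {n : ℕ} (le : least ≤ n) = Reducedness step gen act≡step dihedral (idB n) (minimal n)
    n (IsSignedPerm n) (signedPerm-idB n) (λ _ → act-perm) (dichotomy le) asc⇒range

  eval : ℕ → Word → List ℤ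
  eval n = evalWith step (idB n)

  ReducedWord : ℕ → Word → Set
  ReducedWord n w = Reduced step (idB n) n (eval n w) w

  OfRank : ℕ → Set
  OfRank n = Σ Element λ x → rank x ≡ n

  wordsOf : ∀ {n} → OfRank n → List Word
  wordsOf (x , _) = words x

  _≟ℤ_ : DecidableEquality (List ℤ)
  _≟ℤ_ = ≡-dec ℤ._≟_

  element : ∀ {n} → least ≤ n → ∀ {w} → ReducedWord n w →
            Σ (OfRank n) λ x → Unique (wordsOf x) × (∀ v → (v ∈ wordsOf x → Reduced step (idB n) n (eval n w) v) ×
                                                            (Reduced step (idB n) n (eval n w) v → v ∈ wordsOf x))
  element le red@(is , _) with enumerate _≟ℤ_ red
  ... | ws , en with build le is en
  ... | x , eq , refl = (x , eq) , en

  -- Generators act on positions and signs, `f` acts on values and is odd: right multiplication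
  -- commutes with left multiplication.
  evalWith-map : ∀ {f} → (∀ a → f (ℤ.- a) ≡ ℤ.- f a) → ∀ w x →
                 evalWith step (map f x) w ≡ map f (evalWith step x w)
  evalWith-map odd []      x = refl
  evalWith-map {f} odd (i ∷ w) x = trans (cong (λ y → evalWith step y w)
    (trans (sym (act≡step i (map f x))) (trans (natural f odd i x) (cong (map f) (act≡step i x)))))
    (evalWith-map odd w (step i x))

  eval-perm : ∀ {n} w → IsSignedPerm n (eval n w)
  eval-perm {n} w = go w (signedPerm-idB n)
    where
    go : ∀ w {x} → IsSignedPerm n x → IsSignedPerm n (evalWith step x w)
    go []      p = p
    go (i ∷ w) {x} p = go w (subst (IsSignedPerm n) (act≡step i x) (act-perm p))

  -- The composition law of the group in window form. A computation started at the window of `u` is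
  -- the entrywise image of the one started at the identity; hence each factor may be replaced by
  -- any other word for the same element.
  eval-++ : ∀ n u v → eval n (u ++ v) ≡ map (leftMultiply (eval n u)) (eval n v)
  eval-++ n u v = trans (foldl-++ _ _ u v) (trans
    (cong (λ x → evalWith step x v) (sym (trans
      (cong (λ k → map (leftMultiply (eval n u)) (idB k)) (sym (SignedPerm.signedPerm-length (eval-perm u))))
      (map-leftMultiply (eval n u)))))
    (evalWith-map (leftMultiply-odd (eval n u)) v (idB n)))

  eval-++-cong : ∀ n {u u′ v v′} → eval n u ≡ eval n u′ → eval n v ≡ eval n v′ →
                 eval n (u ++ v) ≡ eval n (u′ ++ v′)
  eval-++-cong n {u} {u′} {v} {v′} eq eq′ =
    trans (eval-++ n u v) (trans (cong₂ (λ α → map (leftMultiply α)) eq eq′) (sym (eval-++ n u′ v′)))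

  -- Replacing the factors keeps the product, so minimality of `u ++ v` applies. Keeping one factor
  -- fixed and cancelling its length yields that the factors of a reduced word are reduced.
  ++-minimal : ∀ {n} u v → ReducedWord n (u ++ v) → ∀ u′ v′ → All (InRange n) u′ → All (InRange n) v′ →
    eval n u′ ≡ eval n u → eval n v′ ≡ eval n v → length u + length v ≤ length u′ + length v′
  ++-minimal {n} u v (_ , _ , min) u′ v′ is is′ eq eq′ = subst₂ _≤_ (length-++ u) (length-++ u′)
    (min (u′ ++ v′) (All.++⁺ is is′) (eval-++-cong n {u′} {u} eq eq′))

  reduced-++⁻ˡ : ∀ {n} u v → ReducedWord n (u ++ v) → ReducedWord n u
  reduced-++⁻ˡ u v red@(is , _) = All.++⁻ˡ u is , refl , λ u′ is′ eq →
    +-cancelʳ-≤ (length v) _ _ (++-minimal u v red u′ v is′ (All.++⁻ʳ u is) eq refl)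

  reduced-++⁻ʳ : ∀ {n} u v → ReducedWord n (u ++ v) → ReducedWord n v
  reduced-++⁻ʳ u v red@(is , _) = All.++⁻ʳ u is , refl , λ v′ is′ eq →
    +-cancelˡ-≤ (length u) _ _ (++-minimal u v red u v′ (All.++⁻ˡ u is) is′ refl eq)

  -- Reduced words for the two factors are no longer than `u` and `v`, so together they are no
  -- longer than a reduced word of π.
  reduced-++ : ∀ {n π} u v {u′ v′} → Reduced step (idB n) n π (u ++ v) →
    Reduced step (idB n) n (eval n u) u′ → Reduced step (idB n) n (eval n v) v′ →
    Reduced step (idB n) n π (u′ ++ v′)
  reduced-++ {n} u v {u′} {v′} (is , eq , min) (is₁ , eq₁ , min₁) (is₂ , eq₂ , min₂) =
    All.++⁺ is₁ is₂ , trans (eval-++-cong n {u′} {u} eq₁ eq₂) eq , λ w is″ eq″ →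
    ≤-trans (subst₂ _≤_ (sym (length-++ u′)) (sym (length-++ u))
      (ℕ.+-mono-≤ (min₁ u (All.++⁻ˡ u is) refl) (min₂ v (All.++⁻ʳ u is) refl))) (min w is″ eq″)

  pairs : ∀ {n} → OfRank n × OfRank n → List (Word × Word)
  pairs (g , h) = cartesianProduct (wordsOf g) (wordsOf h)

  -- Cuts are sorted by the pair of elements (α , β) of their factors. Reduced words for α and β can
  -- be substituted freely, and factors are always reduced, so each class is exactly R(α) × R(β).
  splits-partition : ∀ x → ∃ λ (gs : List (OfRank (rank x) × OfRank (rank x))) →
                     concatMap splits (words x) ↭ concatMap pairs gs
  splits-partition x = partition (concatMap splits (words x))
    (concatMap-unique (λ (u , v) → u ++ v) (proj₁ (enum x)) (λ {w} _ → splits-unique w) (λ _ → ∈-splits⁻))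
    fiber
    where
    n = rank x
    open Partition (×.≡-dec _≟ℤ_ _≟ℤ_) (λ (u , v) → eval n u , eval n v) pairs
    fiber : ∀ {a} → a ∈ concatMap splits (words x) → ∃ (IsFiber (concatMap splits (words x)) a)
    fiber {u , v} p with find (∈-concatMap⁻ splits p)
    ... | w , w∈ , q with ∈-splits⁻ q
    ... | refl with proj₁ (proj₂ (enum x) (u ++ v)) w∈
    ... | red@(is , eq , min) with element (least≤rank x) (reduced-++⁻ˡ u v red′) | element (least≤rank x) (reduced-++⁻ʳ u v red′)
      where
      -- The lemmas on factors refer to an element through one of its words, so the window of `x` is
      -- replaced by the value of `u ++ v`.
      red′ : ReducedWord n (u ++ v)
      red′ = is , refl , λ w is′ eq′ → min w is′ (trans eq′ eq)
    ... | g , ug , mg | h , uh , mh = (g , h) , Unique.cartesianProduct⁺ ug uh , λ (u′ , v′) →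
      (λ r → let (u∈ , v∈) = ∈-cartesianProduct⁻ (wordsOf g) (wordsOf h) r
                 ru = proj₁ (mg u′) u∈ ; rv = proj₁ (mh v′) v∈ in
        ∈-concatMap splits (proj₂ (proj₂ (enum x) (u′ ++ v′)) (reduced-++ u v red ru rv)) (∈-splits⁺ u′ v′) ,
        cong₂ _,_ (proj₁ (proj₂ ru)) (proj₁ (proj₂ rv))) ,
      λ (r , eqs) → let (w′ , w∈′ , q′) = find (∈-concatMap⁻ splits r)
                        red₂ = proj₁ (proj₂ (enum x) (u′ ++ v′)) (subst (_∈ words x) (sym (∈-splits⁻ q′)) w∈′)
                        red₃ = proj₁ red₂ , refl , λ w is′ eq′ → proj₂ (proj₂ red₂) w is′ (trans eq′ (proj₁ (proj₂ red₂)))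
                    in ∈-cartesianProduct⁺
        (proj₂ (mg u′) (subst (λ α → Reduced step (idB n) n α u′) (cong proj₁ eqs) (reduced-++⁻ˡ u′ v′ red₃)))
        (proj₂ (mh v′) (subst (λ α → Reduced step (idB n) n α v′) (cong proj₂ eqs) (reduced-++⁻ʳ u′ v′ red₃)))

-- Shuffles of reduced words are unions of sets of reduced words.

ascSwap-map⁺ : ∀ m k {y} → SwapsS.AscSwap k y → AscSwap k (map (λ a → ℤ.+ (m + a)) y)
ascSwap-map⁺ m zero    {_ ∷ _ ∷ _} a = ℤ.+<+ (ℕ.+-monoʳ-< m a)
ascSwap-map⁺ m (suc k) {_ ∷ _}     a = ascSwap-map⁺ m k a

ascSwap-map⁻ : ∀ m k {y} → AscSwap k (map (λ a → ℤ.+ (m + a)) y) → SwapsS.AscSwap k y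
ascSwap-map⁻ m zero    {_ ∷ _ ∷ _} (ℤ.+<+ a) = ℕ.+-cancelˡ-< m _ _ a
ascSwap-map⁻ m (suc k) {_ ∷ _}     a         = ascSwap-map⁻ m k a

-- The letters ≤ n generate the parabolic subgroup fixing the positions beyond n, and the
-- letters > n a copy of S_{N+1} permuting the positions n, …, n + N.
module Parabolic (series : Series) (n′ N : ℕ) (le : Series.least series ≤ suc n′) where
  open Series series
  open OfSeries series

  n = suc n′

  le′ : least ≤ n + N
  le′ = ≤-trans le (m≤m+n n N)

  module Small = Rank le
  module Big   = Rank le′
  module Sym   = TypeS N

  rest : List ℤ
  rest = applyUpTo (λ i → ℤ.+ suc (n + i)) N

  idB-low : idB n ++ rest ≡ idB (n + N)
  idB-low = trans (cong (_++ rest) (idB≡applyUpTo n))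
    (trans (sym (applyUpTo-++ (λ i → ℤ.+ suc i) n N)) (sym (idB≡applyUpTo (n + N))))

  module Low = Simulation gen dihedral (idB n) (minimal n) gen dihedral (idB (n + N)) (minimal (n + N))
    (InRange n) (IsSignedPerm n) (signedPerm-idB n) (λ _ → act-perm) (λ i → i) (_++ rest) idB-low
    (λ i p → act-++ le i (SignedPerm.signedPerm-length p) rest)
    (λ i p → subst (λ T → T) (sym (asc-++ le i (SignedPerm.signedPerm-length p) rest)))
    (λ i p → subst (λ T → T) (asc-++ le i (SignedPerm.signedPerm-length p) rest))

  -- Letter `n + i` exchanges positions `n + i - 1` and `n + i`. The copy of S_{N+1} thus begins at
  -- position `n`, shared with the first block, and only `n′ = n - 1` entries stay fixed.
  place : List ℕ → List ℤ
  place y = idB n′ ++ map (λ a → ℤ.+ (n′ + a)) y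

  idB-high : place (idS N) ≡ idB (n + N)
  idB-high = trans (cong₂ _++_ (idB≡applyUpTo n′) (trans (cong (map _) (idS≡applyUpTo N))
      (trans (map-applyUpTo suc _ (suc N)) (sym (trans (sym (map-applyUpTo (λ i → i) _ (suc N)))
        (trans (map-cong (λ i → cong ℤ.+_ (sym (+-suc n′ i))) _) (map-applyUpTo (λ i → i) _ (suc N))))))))
    (trans (sym (applyUpTo-++ (λ i → ℤ.+ suc i) n′ (suc N)))
      (trans (cong (applyUpTo _) (+-suc n′ N)) (sym (idB≡applyUpTo (n + N)))))

  gen-high : ∀ i → gen (n + suc i) ≡ swap (length (idB n′) + i)
  gen-high i = trans (cong (λ k → gen (suc k)) (+-suc n′ i))
    (trans (gen-swap (n′ + i)) (cong (λ k → swap (k + i)) (sym (length-idB n′))))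

  place-act : ∀ {i x} → InRange N i → ⊤ → act (gen (n + i)) (place x) ≡ place (act (genS i) x)
  place-act {suc i} {x} _ _ = trans (cong (λ g → act g (place x)) (gen-high i))
    (trans (swapAt-++ʳ (idB n′) _ i) (cong (idB n′ ++_) (swapAt-map _ i x)))

  place-asc⁺ : ∀ {i x} → InRange N i → ⊤ → Asc (genS i) x → Asc (gen (n + i)) (place x)
  place-asc⁺ {suc i} {x} _ _ a = subst (λ g → Asc g (place x)) (sym (gen-high i))
    (subst (λ T → T) (sym (ascSwap-++ʳ (idB n′) _ i)) (ascSwap-map⁺ n′ i a))

  place-asc⁻ : ∀ {i x} → InRange N i → ⊤ → Asc (gen (n + i)) (place x) → Asc (genS i) x
  place-asc⁻ {suc i} {x} _ _ a = ascSwap-map⁻ n′ i (subst (λ T → T) (ascSwap-++ʳ (idB n′) _ i)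
    (subst (λ g → Asc g (place x)) (gen-high i) a))

  module High = Simulation genS dihedralS (idS N) (minimalS N) gen dihedral (idB (n + N)) (minimal (n + N))
    (InRange N) (λ _ → ⊤) tt (λ _ _ → tt) (n +_) place idB-high place-act place-asc⁺ place-asc⁻

  place-injective : ∀ {x y} → place x ≡ place y → x ≡ y
  place-injective eq = map-injective (λ eq → +-cancelˡ-≡ n′ _ _ (ℤ.+-injective eq)) (++-cancelˡ (idB n′) _ _ eq)

  low : ℕ → Bool
  low i = does (i ≤? n)

  low-true : ∀ {i} → i ≤ n → low i ≡ true
  low-true {i} = dec-true (i ≤? n)

  low-false : ∀ {i} → n < i → low i ≡ false
  low-false {i} n<i = dec-false (i ≤? n) (λ i≤n → <-irrefl refl (≤-trans n<i i≤n))

  low-true⁻ : ∀ {i} → low i ≡ true → i ≤ n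
  low-true⁻ {i} eq = ℕ.≤ᵇ⇒≤ i n (subst T (sym eq) tt)

  low-false⁻ : ∀ {i} → low i ≡ false → n < i
  low-false⁻ {i} eq = ≰⇒> λ i≤n → subst T (trans (sym (low-true i≤n)) eq) tt

  open Restrict low
  open RestrictShuffles low
  open Big.Restriction low using (Good; good⇒Up; good-class)

  shift unshift : Word → Word
  shift   = map (n +_)
  unshift = map (_∸ n)

  unshift-shift : ∀ u → unshift (shift u) ≡ u
  unshift-shift u = trans (sym (map-∘ u)) (trans (map-cong (m+n∸m≡n n) u) (map-id u))

  range⇒True : ∀ {w} → All (InRange n) w → True w
  range⇒True = All.map (λ (_ , i≤n) → low-true i≤n)

  shift-False : ∀ {u} → All (InRange N) u → False (shift u)
  shift-False is = All.map⁺ (All.map (λ { {suc i} _ → low-false (≤-trans (s≤s (m≤m+n n i)) (≤-reflexive (sym (+-suc n i)))) }) is)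

  restrict-side : ∀ b {z} → All (InRange (n + N)) z → All (λ i → InRange (n + N) i × low i ≡ b) (restrict b z)
  restrict-side b {z} is = All.tabulate λ i∈ →
    let (i∈z , eq) = ∈-filter⁻ (λ i → low i Bool.≟ b) {xs = z} i∈ in All.lookup is i∈z , eq

  restrict-true-range : ∀ {z} → All (InRange (n + N)) z → All (InRange n) (restrict true z)
  restrict-true-range is = All.map (λ {i} ((1≤i , _) , eq) → 1≤i , low-true⁻ {i} eq) (restrict-side true is)

  unshift-range : ∀ {z} → All (InRange (n + N)) z → All (InRange N) (unshift (restrict false z))
  unshift-range is = All.map⁺ (All.map (λ {i} ((_ , i≤) , eq) →
      ℕ.m<n⇒0<n∸m (low-false⁻ {i} eq) , ≤-trans (ℕ.∸-monoˡ-≤ n i≤) (≤-reflexive (m+n∸m≡n n N)))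
    (restrict-side false is))

  shift-unshift : ∀ {z} → All (InRange (n + N)) z → shift (unshift (restrict false z)) ≡ restrict false z
  shift-unshift {z} is = trans (sym (map-∘ (restrict false z))) (trans
    (map-cong-local (All.map (λ {i} (_ , eq) → m+[n∸m]≡n (ℕ.<⇒≤ (low-false⁻ {i} eq))) (restrict-side false is)))
    (map-id (restrict false z)))

  shuffle-range : ∀ {z w u} → All (InRange n) w → All (InRange N) u →
    restrict true z ≡ w → restrict false z ≡ shift u → All (InRange (n + N)) z
  shuffle-range {z} {w} {u} is js refl eq = All.tabulate λ {i} i∈ → by-side i∈ (low i) refl
    where
    by-side : ∀ {i} → i ∈ z → ∀ b → low i ≡ b → InRange (n + N) i
    by-side i∈ true  p = let (1≤i , i≤n) = All.lookup is (∈-filter⁺ (λ i → low i Bool.≟ true) i∈ p) in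
      1≤i , ≤-trans i≤n (m≤m+n n N)
    by-side i∈ false p with ∈-map⁻ (n +_) (subst (_ ∈_) eq (∈-filter⁺ (λ i → low i Bool.≟ false) i∈ p))
    ... | j , j∈ , refl = s≤s z≤n , ℕ.+-monoʳ-≤ n (proj₂ (All.lookup js j∈))

  -- Membership in the product, phrased through restrictions because these are what braid moves
  -- control.
  IsShuffle : List ℤ → List ℕ → Word → Set
  IsShuffle π σ z = Reduced step (idB n) n π (restrict true z) ×
    ∃ λ u → ReducedS N σ u × restrict false z ≡ shift u

  module _ {π σ z} (sh : IsShuffle π σ z) where
    private
      u    = proj₁ (proj₂ sh)
      redS = proj₁ (proj₂ (proj₂ sh))
      eq   = proj₂ (proj₂ (proj₂ sh))
      pathˡ = Small.reduced⇒path (proj₁ sh)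
      pathʳ = Sym.reduced⇒path redS

    low-restrict : restrict true (reverse z) ≡ map (λ i → i) (reverse (restrict true z))
    low-restrict = trans (restrict-reverse true z) (sym (map-id _))

    high-restrict : restrict false (reverse z) ≡ shift (reverse u)
    high-restrict = trans (restrict-reverse false z) (trans (cong reverse eq) (sym (reverse-map (n +_) u)))

    good : Good (reverse z)
    good true  = subst (Big.Up (idB (n + N))) (sym low-restrict)
      (Low.sim-Up⁺ (All-reverse (proj₁ pathˡ)) (proj₁ (proj₂ pathˡ)))
    good false = subst (Big.Up (idB (n + N))) (sym high-restrict)
      (High.sim-Up⁺ (All-reverse (proj₁ pathʳ)) (proj₁ (proj₂ pathʳ)))

    range : All (InRange (n + N)) z
    range = shuffle-range (proj₁ pathˡ) (proj₁ pathʳ) refl eq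

    shuffle-Up : Big.Up (idB (n + N)) (reverse z)
    shuffle-Up = good⇒Up (InRange (n + N)) (IsSignedPerm (n + N)) (signedPerm-idB (n + N)) (λ _ → act-perm)
      (dichotomy le′) (All-reverse range) good

    shuffle-reduced : ReducedWord (n + N) z
    shuffle-reduced = Big.path⇒reduced (range , shuffle-Up , sym (Big.evalWith≡ev z))

    -- By `good-class` the restrictions of `z′` ascend and end where those of `z` do. The
    -- simulations pull this back to the small groups, where injectivity of `_++ rest` and of
    -- `place` identifies the endpoints as π and σ.
    shuffle-class : ∀ {z′} → Reduced step (idB (n + N)) (n + N) (eval (n + N) z) z′ → IsShuffle π σ z′
    shuffle-class {z′} red′ = Small.path⇒reduced (range₁ , up₁ , ev₁) , unshift (restrict false z′) ,
      Sym.path⇒reduced (range₂ , up₂ , ev₂) , sym (shift-unshift range′)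
      where
      path′ = Big.reduced⇒path red′
      range′ = proj₁ path′
      similar = good-class good shuffle-Up (proj₁ (proj₂ path′)) (trans (proj₂ (proj₂ path′)) (Big.evalWith≡ev z))
      range₁ = restrict-true-range range′
      eq₁ : restrict true (reverse z′) ≡ map (λ i → i) (reverse (restrict true z′))
      eq₁ = trans (restrict-reverse true z′) (sym (map-id _))
      up₁ = Low.sim-Up⁻ (All-reverse range₁) (subst (Big.Up (idB (n + N))) eq₁ (proj₁ (similar true)))
      ev₁ : Small.ev (idB n) (reverse (restrict true z′)) ≡ π
      ev₁ = trans (++-cancelʳ rest _ _ (trans (sym (Low.sim-ev (All-reverse range₁)))
        (trans (cong (Big.ev (idB (n + N))) (sym eq₁)) (trans (proj₂ (similar true))
          (trans (cong (Big.ev (idB (n + N))) low-restrict) (Low.sim-ev (All-reverse (proj₁ pathˡ))))))))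
        (proj₂ (proj₂ pathˡ))
      range₂ = unshift-range range′
      eq₂ : restrict false (reverse z′) ≡ shift (reverse (unshift (restrict false z′)))
      eq₂ = trans (restrict-reverse false z′) (trans (cong reverse (sym (shift-unshift range′)))
        (sym (reverse-map (n +_) (unshift (restrict false z′)))))
      up₂ = High.sim-Up⁻ (All-reverse range₂) (subst (Big.Up (idB (n + N))) eq₂ (proj₁ (similar false)))
      ev₂ : Sym.ev (idS N) (reverse (unshift (restrict false z′))) ≡ σ
      ev₂ = trans (place-injective (trans (sym (High.sim-ev (All-reverse range₂)))
        (trans (cong (Big.ev (idB (n + N))) (sym eq₂)) (trans (proj₂ (similar false))
          (trans (cong (Big.ev (idB (n + N))) high-restrict) (High.sim-ev (All-reverse (proj₁ pathʳ))))))))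
        (proj₂ (proj₂ pathʳ))

  module Product (x : OfRank n) (ws : List Word) (σ : List ℕ) (enumS : Enumerates ws (ReducedS N σ)) where

    enumˣ : Enumerates (wordsOf x) (Reduced step (idB n) n (window (proj₁ x)))
    enumˣ = subst (λ k → Enumerates (wordsOf x) (Reduced step (idB k) k (window (proj₁ x)))) (proj₂ x) (enum (proj₁ x))

    product : List Word
    product = concatMap (λ w → concatMap (λ u → shuffles w (shift u)) ws) (wordsOf x)

    private
      trueˣ : ∀ {w} → w ∈ wordsOf x → True w
      trueˣ w∈ = range⇒True (proj₁ (proj₁ (proj₂ enumˣ _) w∈))
      falseˢ : ∀ {u} → u ∈ ws → False (shift u)
      falseˢ u∈ = shift-False (proj₁ (proj₁ (proj₂ enumS _) u∈))

    ∈-product⁻ : ∀ {z} → z ∈ product → IsShuffle (window (proj₁ x)) σ z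
    ∈-product⁻ {z} z∈ with find (∈-concatMap⁻ _ {xs = wordsOf x} z∈)
    ... | w , w∈ , z∈′ with find (∈-concatMap⁻ _ {xs = ws} z∈′)
    ... | u , u∈ , z∈″ with shuffles-restrict (trueˣ w∈) (falseˢ u∈) z∈″
    ... | refl , eq = proj₁ (proj₂ enumˣ w) w∈ , u , proj₁ (proj₂ enumS u) u∈ , eq

    ∈-product⁺ : ∀ {z} → IsShuffle (window (proj₁ x)) σ z → z ∈ product
    ∈-product⁺ {z} (red , u , redS , eq) = ∈-concatMap _ (proj₂ (proj₂ enumˣ _) red)
      (∈-concatMap _ (proj₂ (proj₂ enumS u) redS)
        (subst (λ y → z ∈ shuffles (restrict true z) y) eq (∈-shuffles-restrict z)))

    -- Both factors are recovered from a shuffle: the first by restricting to the low letters, the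
    -- second by restricting to the high ones and undoing the shift.
    product-unique : Unique product
    product-unique = concatMap-unique (restrict true) (proj₁ enumˣ)
      (λ w∈ → concatMap-unique (λ z → unshift (restrict false z)) (proj₁ enumS)
        (λ u∈ → shuffles-unique (trueˣ w∈) (falseˢ u∈))
        (λ {u} u∈ z∈ → trans (cong unshift (proj₂ (shuffles-restrict (trueˣ w∈) (falseˢ u∈) z∈))) (unshift-shift u)))
      (λ w∈ z∈ → let (u , u∈ , z∈′) = find (∈-concatMap⁻ _ {xs = ws} z∈) in
        proj₁ (shuffles-restrict (trueˣ w∈) (falseˢ u∈) z∈′))

    open Partition _≟ℤ_ (eval (n + N)) (wordsOf {n + N})

    -- Sorted by the element τ of rank `n + N`, a class that contains one shuffle contains all of
    -- R(τ) by `shuffle-class`, and nothing else because every shuffle is reduced.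
    product-partition : ∃ λ (gs : List (OfRank (n + N))) → product ↭ concatMap wordsOf gs
    product-partition = partition product product-unique λ {z} z∈ →
      let sh = ∈-product⁻ z∈ ; (g , ug , mg) = element le′ {z} (shuffle-reduced {z = z} sh) in
      g , ug , λ z′ →
        (λ z′∈ → let red = proj₁ (mg z′) z′∈ in ∈-product⁺ {z′} (shuffle-class {z = z} sh red) , proj₁ (proj₂ red)) ,
        (λ (z′∈ , eq) → proj₂ (mg z′) (subst (λ α → Reduced step (idB (n + N)) (n + N) α z′) eq
          (shuffle-reduced {z = z′} (∈-product⁻ z′∈))))

-- Formal combinations and their pairing with functionals.

module LinearAlgebra {c ℓ} (F : Field c ℓ) where
  open Field F renaming (Carrier to K; _+_ to _+K_; _*_ to _*K_; refl to ≈-refl; sym to ≈-sym; trans to ≈-trans; reflexive to ≈-reflexive) hiding (zero)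
  open W F
  open import Relation.Binary.Reasoning.Setoid setoid
  open import Algebra.Properties.CommutativeSemigroup +-commutativeSemigroup using (interchange)
  open import Algebra.Properties.CommutativeSemigroup *-commutativeSemigroup using (x∙yz≈y∙xz)

  ∑ : ∀ {a} {A : Set a} → List A → (A → K) → K
  ∑ xs f = sumK (map f xs)

  module _ {a} {A : Set a} where

    ∑-cong : ∀ (xs : List A) {f g} → (∀ x → f x ≈ g x) → ∑ xs f ≈ ∑ xs g
    ∑-cong []       eq = ≈-refl
    ∑-cong (x ∷ xs) eq = +-cong (eq x) (∑-cong xs eq)

    ∑-++ : ∀ (xs ys : List A) f → ∑ (xs ++ ys) f ≈ ∑ xs f +K ∑ ys f
    ∑-++ []       ys f = ≈-sym (+-identityˡ _)
    ∑-++ (x ∷ xs) ys f = ≈-trans (+-congˡ (∑-++ xs ys f)) (≈-sym (+-assoc _ _ _))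

    ∑-0 : ∀ (xs : List A) → ∑ xs (λ _ → 0#) ≈ 0#
    ∑-0 []       = ≈-refl
    ∑-0 (x ∷ xs) = ≈-trans (+-identityˡ _) (∑-0 xs)

    ∑-+ : ∀ (xs : List A) f g → ∑ xs (λ x → f x +K g x) ≈ ∑ xs f +K ∑ xs g
    ∑-+ []       f g = ≈-sym (+-identityˡ _)
    ∑-+ (x ∷ xs) f g = ≈-trans (+-congˡ (∑-+ xs f g)) (interchange _ _ _ _)

    ∑-*ˡ : ∀ k (xs : List A) f → ∑ xs (λ x → k *K f x) ≈ k *K ∑ xs f
    ∑-*ˡ k []       f = ≈-sym (zeroʳ k)
    ∑-*ˡ k (x ∷ xs) f = ≈-trans (+-congˡ (∑-*ˡ k xs f)) (≈-sym (distribˡ k _ _))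

    ∑-↭ : ∀ {xs ys : List A} f → xs ↭ ys → ∑ xs f ≈ ∑ ys f
    ∑-↭ f ↭.refl          = ≈-refl
    ∑-↭ f (↭.prep x p)    = +-congˡ (∑-↭ f p)
    ∑-↭ f (↭.swap x y p)  = ≈-trans (+-congˡ (+-congˡ (∑-↭ f p)))
      (≈-trans (≈-sym (+-assoc _ _ _)) (≈-trans (+-congʳ (+-comm _ _)) (+-assoc _ _ _)))
    ∑-↭ f (↭.trans p q)   = ≈-trans (∑-↭ f p) (∑-↭ f q)

  module _ {a} {A : Set a} where

    ∑-map : ∀ {b} {B : Set b} (h : B → A) xs f → ∑ (map h xs) f ≡ ∑ xs (λ x → f (h x))
    ∑-map h xs f = cong sumK (≡.sym (map-∘ xs))

    ∑-concatMap : ∀ {b} {B : Set b} (h : B → List A) xs f → ∑ (concatMap h xs) f ≈ ∑ xs (λ x → ∑ (h x) f)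
    ∑-concatMap h []       f = ≈-refl
    ∑-concatMap h (x ∷ xs) f = ≈-trans (∑-++ (h x) _ f) (+-congˡ (∑-concatMap h xs f))

    ∑-swap : ∀ {b} {B : Set b} (xs : List A) (ys : List B) (f : A → B → K) →
             ∑ xs (λ x → ∑ ys (f x)) ≈ ∑ ys (λ y → ∑ xs (λ x → f x y))
    ∑-swap []       ys f = ≈-sym (∑-0 ys)
    ∑-swap (x ∷ xs) ys f = ≈-trans (+-congˡ (∑-swap xs ys f)) (≈-sym (∑-+ ys (f x) _))

  -- The value at v of the linear functional with values φ on the basis X.
  pair : ∀ {x} {X : Set x} → List (K × X) → (X → K) → K
  pair v φ = ∑ v (λ (k , b) → k *K φ b)

  module _ {x} {X : Set x} where

    pair-cong : ∀ (v : List (K × X)) {φ ψ} → (∀ b → φ b ≈ ψ b) → pair v φ ≈ pair v ψ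
    pair-cong v eq = ∑-cong v (λ (k , b) → *-congˡ (eq b))

    pair-++ : ∀ (v u : List (K × X)) φ → pair (v ++ u) φ ≈ pair v φ +K pair u φ
    pair-++ v u φ = ∑-++ v u _

    pair-* : ∀ k (v : List (K × X)) φ → pair v (λ b → k *K φ b) ≈ k *K pair v φ
    pair-* k v φ = ≈-trans (∑-cong v (λ (k′ , b) → x∙yz≈y∙xz k′ k (φ b))) (∑-*ˡ k v _)

    pair-∑ : ∀ {a} {A : Set a} (v : List (K × X)) (xs : List A) (φ : A → X → K) →
             pair v (λ b → ∑ xs (λ x → φ x b)) ≈ ∑ xs (λ x → pair v (φ x))
    pair-∑ v xs φ = ≈-trans (∑-cong v (λ (k , b) → ≈-sym (∑-*ˡ k xs (λ x → φ x b))))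
      (∑-swap v xs (λ (k , b) x → k *K φ x b))

  module _ {x} {X : Set x} where

    pair-concatMap : ∀ {y} {Y : Set y} (h : K × Y → List (K × X)) v {φ ψ} →
      (∀ k b → pair (h (k , b)) φ ≈ k *K ψ b) → pair (concatMap h v) φ ≈ pair v ψ
    pair-concatMap h v {φ} eq = ≈-trans (∑-concatMap h v _) (∑-cong v (λ (k , b) → eq k b))

    pair-concatMap* : ∀ {y} {Y : Set y} l (h : K × Y → List (K × X)) v {φ ψ} →
      (∀ k b → pair (h (k , b)) φ ≈ (l *K k) *K ψ b) → pair (concatMap h v) φ ≈ l *K pair v ψ
    pair-concatMap* l h v {φ} {ψ} eq = ≈-trans (pair-concatMap h v {ψ = λ b → l *K ψ b}
      (λ k b → ≈-trans (eq k b) (≈-trans (*-congʳ (*-comm l k)) (*-assoc k l _)))) (pair-* l v ψ)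

    pair-map : ∀ {a} {A : Set a} k (h : A → X) xs φ → pair (map (λ x → k , h x) xs) φ ≈ k *K ∑ xs (λ x → φ (h x))
    pair-map k h xs φ = ≈-trans (≈-reflexive (∑-map (λ x → k , h x) xs _)) (∑-*ˡ k xs _)

  pair-swap : ∀ {x y} {X : Set x} {Y : Set y} (v : List (K × X)) (u : List (K × Y)) (φ : X → Y → K) →
              pair v (λ a → pair u (φ a)) ≈ pair u (λ b → pair v (λ a → φ a b))
  pair-swap v u φ = ≈-trans (∑-cong v (λ (k , a) → ≈-sym (pair-* k u (φ a))))
    (≈-sym (pair-∑ u v (λ x b → proj₁ x *K φ (proj₂ x) b)))

  indicator : Bool → K
  indicator b = if b then 1# else 0#

  if-indicator : ∀ b k → (if b then k else 0#) ≈ k *K indicator b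
  if-indicator true  k = ≈-sym (*-identityʳ k)
  if-indicator false k = ≈-sym (zeroʳ k)

  δ : Basis → Basis → K
  δ b b′ = indicator ⌊ b ≟B b′ ⌋

  coeff-pair : ∀ b v → coeff b v ≈ pair v (δ b)
  coeff-pair b []             = ≈-refl
  coeff-pair b ((k , b′) ∷ v) = +-cong (if-indicator ⌊ b ≟B b′ ⌋ k) (coeff-pair b v)

  coeffT-pair : ∀ a b t → coeffT a b t ≈ pair t (λ (a′ , b′) → δ a a′ *K δ b b′)
  coeffT-pair a b []                  = ≈-refl
  coeffT-pair a b ((k , a′ , b′) ∷ t) = +-cong (cell ⌊ a ≟B a′ ⌋ ⌊ b ≟B b′ ⌋) (coeffT-pair a b t)
    where
    cell : ∀ p q → (if p then (if q then k else 0#) else 0#) ≈ k *K (indicator p *K indicator q)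
    cell true  q = ≈-trans (if-indicator q k) (*-congˡ (≈-sym (*-identityˡ _)))
    cell false q = ≈-sym (≈-trans (*-congˡ (zeroˡ _)) (zeroʳ k))

  infix 4 _≋_
  -- Every operation on vectors has an adjoint on functionals, so identities of composite operations
  -- become identities of nested finite sums, whatever lists represent the vectors.
  _≋_ : ∀ {x} {X : Set x} → List (K × X) → List (K × X) → Set _
  v ≋ u = ∀ φ → pair v φ ≈ pair u φ

  ≋⇒≈V : ∀ {v u} → v ≋ u → v ≈V u
  ≋⇒≈V {v} {u} eq b = ≈-trans (coeff-pair b v) (≈-trans (eq _) (≈-sym (coeff-pair b u)))

  ≋⇒≈T : ∀ {t s : Tens} → t ≋ s → t ≈T s
  ≋⇒≈T {t} {s} eq a b = ≈-trans (coeffT-pair a b t) (≈-trans (eq _) (≈-sym (coeffT-pair a b s)))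

  ∑-single : ∀ k b {bs} (φ : Basis → K) → Unique bs → b ∈ bs → ∑ bs (λ b′ → (if ⌊ b′ ≟B b ⌋ then k else 0#) *K φ b′) ≈ k *K φ b
  ∑-single k b {b′ ∷ bs} φ (b′∉ ∷ u) b∈ with b′ ≟B b
  ... | yes refl = ≈-trans (+-congˡ (vanish bs b′∉)) (+-identityʳ _)
    where
    vanish : ∀ bs → All (b ≢_) bs → ∑ bs (λ b′ → (if ⌊ b′ ≟B b ⌋ then k else 0#) *K φ b′) ≈ 0#
    vanish []        []         = ≈-refl
    vanish (b″ ∷ bs) (b≢ ∷ all) with b″ ≟B b
    ... | yes eq = ⊥-elim (b≢ (≡.sym eq))
    ... | no  _  = ≈-trans (+-cong (zeroˡ (φ b″)) (vanish bs all)) (+-identityˡ _)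
  ∑-single k b {b′ ∷ bs} φ (b′∉ ∷ u) (here eq)  | no b′≢b = ⊥-elim (b′≢b (≡.sym eq))
  ∑-single k b {b′ ∷ bs} φ (b′∉ ∷ u) (there b∈) | no b′≢b =
    ≈-trans (+-cong (zeroˡ (φ b′)) (∑-single k b φ u b∈)) (+-identityˡ _)

  pair-coeff : ∀ v {bs} (φ : Basis → K) → Unique bs → (∀ {b} → b ∈ map proj₂ v → b ∈ bs) → pair v φ ≈ ∑ bs (λ b → coeff b v *K φ b)
  pair-coeff []            {bs} φ u ⊆ = ≈-sym (≈-trans (∑-cong bs (λ b → zeroˡ (φ b))) (∑-0 bs))
  pair-coeff ((k , b) ∷ v) {bs} φ u ⊆ = begin
    k *K φ b +K pair v φ
      ≈⟨ +-cong (≈-sym (∑-single k b {bs} φ u (⊆ (here refl)))) (pair-coeff v φ u (λ p → ⊆ (there p))) ⟩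
    ∑ bs (λ b′ → (if ⌊ b′ ≟B b ⌋ then k else 0#) *K φ b′) +K ∑ bs (λ b′ → coeff b′ v *K φ b′)
      ≈⟨ ∑-+ bs (λ b′ → (if ⌊ b′ ≟B b ⌋ then k else 0#) *K φ b′) _ ⟨
    ∑ bs (λ b′ → (if ⌊ b′ ≟B b ⌋ then k else 0#) *K φ b′ +K coeff b′ v *K φ b′)
      ≈⟨ ∑-cong bs (λ b′ → distribʳ (φ b′) _ _) ⟨
    ∑ bs (λ b′ → coeff b′ ((k , b) ∷ v) *K φ b′) ∎

  -- Both vectors are regrouped over one duplicate-free list of basis symbols containing both
  -- supports; the value of a functional is then expressed by coefficients.
  ≈V⇒≋ : ∀ {v u} → v ≈V u → v ≋ u
  ≈V⇒≋ {v} {u} eq φ = begin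
    pair v φ                      ≈⟨ pair-coeff v φ unique (λ p → ∈-deduplicate⁺ _≟B_ (∈-++⁺ˡ p)) ⟩
    ∑ bs (λ b → coeff b v *K φ b) ≈⟨ ∑-cong bs (λ b → *-congʳ (eq b)) ⟩
    ∑ bs (λ b → coeff b u *K φ b) ≈⟨ pair-coeff u φ unique (λ p → ∈-deduplicate⁺ _≟B_ (∈-++⁺ʳ (map proj₂ v) p)) ⟨
    pair u φ                      ∎
    where
    bs = deduplicate _≟B_ (map proj₂ v ++ map proj₂ u)
    unique = UniqueDec.deduplicate-! _≟B_ (map proj₂ v ++ map proj₂ u)

  -- Shuffle and deconcatenation identities for words.

  Sh : Word → Word → (Word → K) → K
  Sh x y = ∑ (shuffles x y)

  Cut : Word → (Word → Word → K) → K
  Cut z Φ = ∑ (splits z) (λ (a , b) → Φ a b)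

  Sh-cong : ∀ x y {f g} → (∀ z → f z ≈ g z) → Sh x y f ≈ Sh x y g
  Sh-cong x y = ∑-cong (shuffles x y)

  Sh-[]ˡ : ∀ y f → Sh [] y f ≈ f y
  Sh-[]ˡ y f = +-identityʳ (f y)

  Sh-[]ʳ : ∀ x f → Sh x [] f ≈ f x
  Sh-[]ʳ []      f = +-identityʳ _
  Sh-[]ʳ (_ ∷ _) f = +-identityʳ _

  Sh-∷ : ∀ i j x y f → Sh (i ∷ x) (j ∷ y) f ≈ Sh x (j ∷ y) (λ z → f (i ∷ z)) +K Sh (i ∷ x) y (λ z → f (j ∷ z))
  Sh-∷ i j x y f = ≈-trans (∑-++ (map (i ∷_) (shuffles x (j ∷ y))) _ f)
    (+-cong (≈-reflexive (∑-map (i ∷_) (shuffles x (j ∷ y)) f)) (≈-reflexive (∑-map (j ∷_) (shuffles (i ∷ x) y) f)))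

  Cut-cong : ∀ z {Φ Ψ} → (∀ a b → Φ a b ≈ Ψ a b) → Cut z Φ ≈ Cut z Ψ
  Cut-cong z eq = ∑-cong (splits z) (λ (a , b) → eq a b)

  Cut-[] : ∀ Φ → Cut [] Φ ≈ Φ [] []
  Cut-[] Φ = +-identityʳ _

  Cut-∷ : ∀ i z Φ → Cut (i ∷ z) Φ ≈ Φ [] (i ∷ z) +K Cut z (λ a b → Φ (i ∷ a) b)
  Cut-∷ i z Φ = +-congˡ (≈-reflexive (≡.trans (∑-map _ (applyUpTo suc (suc (length z))) _)
    (≡.trans (cong sumK (map-applyUpTo suc _ (suc (length z))))
      (≡.sym (≡.trans (∑-map _ (upTo (suc (length z))) _) (cong sumK (map-applyUpTo (λ i → i) _ (suc (length z)))))))))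

  Cut-+ : ∀ z Φ Ψ → Cut z (λ a b → Φ a b +K Ψ a b) ≈ Cut z Φ +K Cut z Ψ
  Cut-+ z Φ Ψ = ∑-+ (splits z) _ _

  Sh-map : ∀ (h : ℕ → ℕ) x y f → Sh (map h x) (map h y) f ≈ Sh x y (λ z → f (map h z))
  Sh-map h []      y       f = ≈-refl
  Sh-map h (i ∷ x) []      f = ≈-refl
  Sh-map h (i ∷ x) (j ∷ y) f = ≈-trans (Sh-∷ _ _ (map h x) (map h y) f)
    (≈-trans (+-cong (Sh-map h x (j ∷ y) _) (Sh-map h (i ∷ x) y _)) (≈-sym (Sh-∷ i j x y _)))

  Cut-map : ∀ (h : ℕ → ℕ) z Φ → Cut (map h z) Φ ≈ Cut z (λ a b → Φ (map h a) (map h b))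
  Cut-map h []      Φ = ≈-refl
  Cut-map h (i ∷ z) Φ = ≈-trans (Cut-∷ (h i) (map h z) Φ)
    (≈-trans (+-congˡ (Cut-map h z _)) (≈-sym (Cut-∷ i z _)))

  -- Both sides are sorted by the first letter `i`, `j` or `k` of the triple shuffle, and each group
  -- is an instance of the induction hypothesis. The two sums starting with `k` must first be merged
  -- back into one shuffle of the first two words.
  Sh-assoc : ∀ x y z f → Sh x y (λ s → Sh s z f) ≈ Sh y z (λ s → Sh x s f)
  Sh-assoc []      y       z       f = ≈-trans (Sh-[]ˡ y (λ s → Sh s z f)) (Sh-cong y z (λ s → ≈-sym (Sh-[]ˡ s f)))
  Sh-assoc (i ∷ x) []      z       f = ≈-trans (Sh-[]ʳ (i ∷ x) (λ s → Sh s z f)) (≈-sym (Sh-[]ˡ z (λ s → Sh (i ∷ x) s f)))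
  Sh-assoc (i ∷ x) (j ∷ y) []      f =
    ≈-trans (Sh-cong (i ∷ x) (j ∷ y) (λ s → Sh-[]ʳ s f)) (≈-sym (Sh-[]ʳ (j ∷ y) (λ s → Sh (i ∷ x) s f)))
  Sh-assoc ix@(i ∷ x) jy@(j ∷ y) kz@(k ∷ z) f = begin
    Sh ix jy (λ s → Sh s kz f)
      ≈⟨ Sh-∷ i j x y _ ⟩
    Sh x jy (λ s → Sh (i ∷ s) kz f) +K Sh ix y (λ s → Sh (j ∷ s) kz f)
      ≈⟨ +-cong (≈-trans (Sh-cong x jy (λ s → Sh-∷ i k s z f)) (∑-+ (shuffles x jy) _ _))
                (≈-trans (Sh-cong ix y (λ s → Sh-∷ j k s z f)) (∑-+ (shuffles ix y) _ _)) ⟩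
    (Sh x jy (λ s → Sh s kz (f ∘∷ i)) +K Sh x jy (λ s → Sh (i ∷ s) z (f ∘∷ k))) +K
    (Sh ix y (λ s → Sh s kz (f ∘∷ j)) +K Sh ix y (λ s → Sh (j ∷ s) z (f ∘∷ k)))
      ≈⟨ interchange _ _ _ _ ⟩
    (Sh x jy (λ s → Sh s kz (f ∘∷ i)) +K Sh ix y (λ s → Sh s kz (f ∘∷ j))) +K
    (Sh x jy (λ s → Sh (i ∷ s) z (f ∘∷ k)) +K Sh ix y (λ s → Sh (j ∷ s) z (f ∘∷ k)))
      ≈⟨ +-congˡ (Sh-∷ i j x y _) ⟨
    (Sh x jy (λ s → Sh s kz (f ∘∷ i)) +K Sh ix y (λ s → Sh s kz (f ∘∷ j))) +K Sh ix jy (λ s → Sh s z (f ∘∷ k))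
      ≈⟨ +-cong (+-cong (Sh-assoc x jy kz _) (Sh-assoc ix y kz _)) (Sh-assoc ix jy z _) ⟩
    (Sh jy kz (λ s → Sh x s (f ∘∷ i)) +K Sh y kz (λ s → Sh ix s (f ∘∷ j))) +K Sh jy z (λ s → Sh ix s (f ∘∷ k))
      ≈⟨ +-congʳ (+-congʳ (Sh-∷ j k y z _)) ⟩
    ((Sh y kz (λ s → Sh x (j ∷ s) (f ∘∷ i)) +K Sh jy z (λ s → Sh x (k ∷ s) (f ∘∷ i))) +K
      Sh y kz (λ s → Sh ix s (f ∘∷ j))) +K Sh jy z (λ s → Sh ix s (f ∘∷ k))
      ≈⟨ ≈-trans (+-assoc _ _ _) (interchange _ _ _ _) ⟩
    (Sh y kz (λ s → Sh x (j ∷ s) (f ∘∷ i)) +K Sh y kz (λ s → Sh ix s (f ∘∷ j))) +K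
    (Sh jy z (λ s → Sh x (k ∷ s) (f ∘∷ i)) +K Sh jy z (λ s → Sh ix s (f ∘∷ k)))
      ≈⟨ +-cong (≈-trans (Sh-cong y kz (λ s → Sh-∷ i j x s f)) (∑-+ (shuffles y kz) _ _))
                (≈-trans (Sh-cong jy z (λ s → Sh-∷ i k x s f)) (∑-+ (shuffles jy z) _ _)) ⟨
    Sh y kz (λ s → Sh ix (j ∷ s) f) +K Sh jy z (λ s → Sh ix (k ∷ s) f)
      ≈⟨ Sh-∷ j k y z _ ⟨
    Sh jy kz (λ s → Sh ix s f) ∎
    where
    _∘∷_ : (Word → K) → ℕ → Word → K
    (f ∘∷ i) s = f (i ∷ s)

  -- Multiplicativity of deconcatenation. On the left the cut with empty prefix is set apart, and
  -- every other prefix keeps the first letter, `i` or `j`. On the right the terms are grouped by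
  -- which of the prefixes of the two words are empty.
  Sh-Cut : ∀ x y Φ → Sh x y (λ z → Cut z Φ) ≈
           Cut x (λ x₁ x₂ → Cut y (λ y₁ y₂ → Sh x₁ y₁ (λ z₁ → Sh x₂ y₂ (Φ z₁))))
  Sh-Cut []         y          Φ = begin
    Sh [] y (λ z → Cut z Φ)                                     ≈⟨ Sh-[]ˡ y (λ z → Cut z Φ) ⟩
    Cut y Φ                                                     ≈⟨ Cut-cong y (λ a b → ≈-trans (Sh-[]ˡ a (λ z₁ → Sh [] b (Φ z₁))) (Sh-[]ˡ b (Φ a))) ⟨
    Cut y (λ y₁ y₂ → Sh [] y₁ (λ z₁ → Sh [] y₂ (Φ z₁)))         ≈⟨ Cut-[] (λ x₁ x₂ → Cut y (λ y₁ y₂ → Sh x₁ y₁ (λ z₁ → Sh x₂ y₂ (Φ z₁)))) ⟨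
    Cut [] (λ x₁ x₂ → Cut y (λ y₁ y₂ → Sh x₁ y₁ (λ z₁ → Sh x₂ y₂ (Φ z₁)))) ∎
  Sh-Cut x@(_ ∷ _)  []         Φ = ≈-trans (Sh-[]ʳ x (λ z → Cut z Φ))
    (Cut-cong x (λ a b → ≈-sym (≈-trans (Cut-[] (λ y₁ y₂ → Sh a y₁ (λ z₁ → Sh b y₂ (Φ z₁))))
      (≈-trans (Sh-[]ʳ a (λ z₁ → Sh b [] (Φ z₁))) (Sh-[]ʳ b (Φ a))))))
  Sh-Cut ix@(i ∷ x) jy@(j ∷ y) Φ = begin
    Sh ix jy (λ z → Cut z Φ)
      ≈⟨ Sh-∷ i j x y _ ⟩
    Sh x jy (λ z → Cut (i ∷ z) Φ) +K Sh ix y (λ z → Cut (j ∷ z) Φ)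
      ≈⟨ +-cong (≈-trans (Sh-cong x jy (λ z → Cut-∷ i z Φ)) (∑-+ (shuffles x jy) _ _))
                (≈-trans (Sh-cong ix y (λ z → Cut-∷ j z Φ)) (∑-+ (shuffles ix y) _ _)) ⟩
    (Sh x jy (λ z → Φ [] (i ∷ z)) +K Sh x jy (λ z → Cut z (Φ ∘∷ i))) +K
    (Sh ix y (λ z → Φ [] (j ∷ z)) +K Sh ix y (λ z → Cut z (Φ ∘∷ j)))
      ≈⟨ interchange _ _ _ _ ⟩
    (Sh x jy (λ z → Φ [] (i ∷ z)) +K Sh ix y (λ z → Φ [] (j ∷ z))) +K
    (Sh x jy (λ z → Cut z (Φ ∘∷ i)) +K Sh ix y (λ z → Cut z (Φ ∘∷ j)))
      ≈⟨ +-cong (≈-sym (Sh-∷ i j x y _)) (+-cong (Sh-Cut x jy (Φ ∘∷ i)) (Sh-Cut ix y (Φ ∘∷ j))) ⟩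
    Sh ix jy (Φ []) +K (Cut x (λ a b → Cut jy (term (Φ ∘∷ i) a b)) +K Cut ix (λ a b → Cut y (term (Φ ∘∷ j) a b)))
      ≈⟨ +-congˡ (+-cong (≈-trans (Cut-cong x (λ a b → Cut-∷ j y _)) (Cut-+ x _ _)) (Cut-∷ i x _)) ⟩
    Sh ix jy (Φ []) +K
    ((Cut x (λ a b → term (Φ ∘∷ i) a b [] jy) +K Cut x (λ a b → Cut y (λ c d → term (Φ ∘∷ i) a b (j ∷ c) d))) +K
     (Cut y (λ c d → term (Φ ∘∷ j) [] ix c d) +K Cut x (λ a b → Cut y (λ c d → term (Φ ∘∷ j) (i ∷ a) b c d))))
      ≈⟨ +-congˡ (≈-trans (interchange _ _ _ _) (≈-trans (+-congʳ (+-comm _ _)) (+-assoc _ _ _))) ⟩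
    Sh ix jy (Φ []) +K
    (Cut y (λ c d → term (Φ ∘∷ j) [] ix c d) +K
     (Cut x (λ a b → term (Φ ∘∷ i) a b [] jy) +K
      (Cut x (λ a b → Cut y (λ c d → term (Φ ∘∷ i) a b (j ∷ c) d)) +K
       Cut x (λ a b → Cut y (λ c d → term (Φ ∘∷ j) (i ∷ a) b c d)))))
      -- When both prefixes are nonempty, the summands with first letter `i` and those with first
      -- letter `j` together form the shuffles of the two prefixes.
      ≈⟨ +-cong (≈-sym (Sh-[]ˡ [] (λ z₁ → Sh ix jy (Φ z₁)))) (+-cong (Cut-cong y (λ c d → ≈-trans (Sh-[]ˡ c (λ z₁ → Sh ix d (Φ (j ∷ z₁)))) (≈-sym (Sh-[]ˡ (j ∷ c) (λ z₁ → Sh ix d (Φ z₁))))))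
           (+-cong (Cut-cong x (λ a b → ≈-trans (Sh-[]ʳ a (λ z₁ → Sh b jy (Φ (i ∷ z₁)))) (≈-sym (Sh-[]ʳ (i ∷ a) (λ z₁ → Sh b jy (Φ z₁))))))
             (≈-trans (≈-sym (Cut-+ x _ _)) (Cut-cong x (λ a b → ≈-trans (≈-sym (Cut-+ y _ _))
               (Cut-cong y (λ c d → ≈-sym (Sh-∷ i j a c _)))))))) ⟩
    term Φ [] ix [] jy +K
    (Cut y (λ c d → term Φ [] ix (j ∷ c) d) +K
     (Cut x (λ a b → term Φ (i ∷ a) b [] jy) +K Cut x (λ a b → Cut y (λ c d → term Φ (i ∷ a) b (j ∷ c) d))))
      ≈⟨ +-assoc _ _ _ ⟨
    (term Φ [] ix [] jy +K Cut y (λ c d → term Φ [] ix (j ∷ c) d)) +K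
    (Cut x (λ a b → term Φ (i ∷ a) b [] jy) +K Cut x (λ a b → Cut y (λ c d → term Φ (i ∷ a) b (j ∷ c) d)))
      ≈⟨ +-cong (Cut-∷ j y _) (≈-trans (Cut-cong x (λ a b → Cut-∷ j y _)) (Cut-+ x _ _)) ⟨
    Cut jy (term Φ [] ix) +K Cut x (λ a b → Cut jy (term Φ (i ∷ a) b))
      ≈⟨ Cut-∷ i x _ ⟨
    Cut ix (λ a b → Cut jy (term Φ a b)) ∎
    where
    _∘∷_ : (Word → Word → K) → ℕ → Word → Word → K
    (Φ ∘∷ i) a = Φ (i ∷ a)
    term : (Word → Word → K) → Word → Word → Word → Word → K
    term Φ x₁ x₂ y₁ y₂ = Sh x₁ y₁ (λ z₁ → Sh x₂ y₂ (Φ z₁))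

  -- The structure maps of W on functionals, and the bialgebra identities.

  pair-scale : ∀ k v φ → pair (scale k v) φ ≈ k *K pair v φ
  pair-scale k []             φ = ≈-sym (zeroʳ k)
  pair-scale k ((l , b) ∷ v) φ = ≈-trans (+-cong (*-assoc k l (φ b)) (pair-scale k v φ)) (≈-sym (distribˡ k _ _))

  pair-scaleT : ∀ k (t : Tens) φ → pair (scaleT k t) φ ≈ k *K pair t φ
  pair-scaleT k []             φ = ≈-sym (zeroʳ k)
  pair-scaleT k ((l , b) ∷ t) φ = ≈-trans (+-cong (*-assoc k l (φ b)) (pair-scaleT k t φ)) (≈-sym (distribˡ k _ _))

  -- The adjoint of the product: the value of φ on the product of two basis symbols.
  μ : (Basis → K) → Basis → Basis → K
  μ φ (x , M) (y , N) = Sh x (map (M +_) y) (λ z → φ (z , M + N))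

  pair-mul : ∀ v u φ → pair (mul v u) φ ≈ pair v (λ a → pair u (μ φ a))
  pair-mul v u φ = pair-concatMap _ v (λ { k (x , M) → pair-concatMap* k _ u (λ { l (y , N) →
    pair-map (k *K l) (λ z → z , M + N) (shuffles x (map (M +_) y)) φ }) })

  pair-Δ : ∀ v φ → pair (Δ v) φ ≈ pair v (λ (x , N) → Cut x (λ a b → φ ((a , N) , (b , N))))
  pair-Δ v φ = pair-concatMap _ v (λ { k (x , N) →
    ≈-trans (pair-map k (λ i → (take i x , N) , (drop i x , N)) (upTo (suc (length x))) φ)
      (*-congˡ (≈-reflexive (≡.sym (∑-map (λ i → take i x , drop i x) (upTo (suc (length x))) _)))) })

  pair-⊗ : ∀ v u φ → pair (v ⊗ u) φ ≈ pair v (λ a → pair u (λ b → φ (a , b)))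
  pair-⊗ v u φ = pair-concatMap _ v (λ k a → ≈-trans
    (≈-reflexive (∑-map _ u _)) (≈-trans (∑-cong u (λ (l , b) → *-assoc k l (φ (a , b)))) (∑-*ˡ k u _)))

  pair-mulT : ∀ t s φ → pair (mulT t s) φ ≈ pair t (λ { ((x₁ , M₁) , (x₂ , M₂)) →
    pair s (λ { ((y₁ , N₁) , (y₂ , N₂)) → Sh x₁ (map (M₁ +_) y₁) (λ z₁ → Sh x₂ (map (M₂ +_) y₂) (λ z₂ →
      φ ((z₁ , M₁ + N₁) , (z₂ , M₂ + N₂)))) }) })
  pair-mulT t s φ = pair-concatMap _ t (λ { k ((x₁ , M₁) , (x₂ , M₂)) →
    pair-concatMap* k _ s (λ { l ((y₁ , N₁) , (y₂ , N₂)) →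
      ≈-trans (∑-concatMap _ (shuffles x₁ (map (M₁ +_) y₁)) _)
        (≈-trans (∑-cong (shuffles x₁ (map (M₁ +_) y₁))
            (λ z₁ → pair-map (k *K l) (λ z₂ → (z₁ , M₁ + N₁) , (z₂ , M₂ + N₂)) (shuffles x₂ (map (M₂ +_) y₂)) φ))
          (∑-*ˡ (k *K l) (shuffles x₁ (map (M₁ +_) y₁)) _)) }) })

  ε₀ : Word → K
  ε₀ []      = 1#
  ε₀ (_ ∷ _) = 0#

  ε-pair : ∀ v → ε v ≈ pair v (λ (x , _) → ε₀ x)
  ε-pair []                     = ≈-refl
  ε-pair ((k , []    , N) ∷ v) = +-cong (≈-sym (*-identityʳ k)) (ε-pair v)
  ε-pair ((k , _ ∷ _ , N) ∷ v) = +-cong (≈-sym (zeroʳ k)) (ε-pair v)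

  Sh-ε : ∀ x y → Sh x y ε₀ ≈ ε₀ x *K ε₀ y
  Sh-ε []      y       = ≈-trans (Sh-[]ˡ y ε₀) (≈-sym (*-identityˡ _))
  Sh-ε (i ∷ x) []      = ≈-trans (Sh-[]ʳ (i ∷ x) ε₀) (≈-sym (zeroˡ _))
  Sh-ε (i ∷ x) (j ∷ y) = ≈-trans (Sh-∷ i j x y ε₀)
    (≈-trans (+-cong (∑-0 (shuffles x (j ∷ y))) (∑-0 (shuffles (i ∷ x) y))) (≈-trans (+-identityˡ _) (≈-sym (zeroˡ _))))

  -- The adjoint of `proj`. The test is the boolean to which the filter in `proj` reduces, so that
  -- one case distinction serves both sides.
  inDegree : ℕ → (Basis → K) → Basis → K
  inDegree d φ (x , N) = if length x ≡ᵇ d then φ (x , N) else 0#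

  pair-proj : ∀ d v φ → pair (proj d v) φ ≈ pair v (inDegree d φ)
  pair-proj d []                φ = ≈-refl
  pair-proj d ((k , x , N) ∷ v) φ with length x ≡ᵇ d
  ... | true  = +-congˡ (pair-proj d v φ)
  ... | false = ≈-trans (pair-proj d v φ) (≈-sym (≈-trans (+-congʳ (zeroʳ k)) (+-identityˡ _)))

  homog-pair : ∀ {d v} → Homog d v → ∀ φ → pair v φ ≈ pair v (inDegree d φ)
  homog-pair {d} {v} h φ = ≈-trans (≈V⇒≋ {v} {proj d v} h φ) (pair-proj d v φ)

  shuffles-length : ∀ x y → All (λ z → length z ≡ length x + length y) (shuffles x y)
  shuffles-length []      y       = refl ∷ []
  shuffles-length (i ∷ x) []      = cong suc (≡.sym (ℕ.+-identityʳ (length x))) ∷ []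
  shuffles-length (i ∷ x) (j ∷ y) = All.++⁺
    (All.map⁺ (All.map (cong suc) (shuffles-length x (j ∷ y))))
    (All.map⁺ (All.map (λ eq → cong suc (≡.trans eq (≡.sym (ℕ.+-suc (length x) (length y))))) (shuffles-length (i ∷ x) y)))

  ∑-cong-All : ∀ {a} {A : Set a} {xs : List A} {f g} → All (λ x → f x ≈ g x) xs → ∑ xs f ≈ ∑ xs g
  ∑-cong-All []         = ≈-refl
  ∑-cong-All (eq ∷ eqs) = +-cong eq (∑-cong-All eqs)

  inDegree-yes : ∀ {d} φ b → length (proj₁ b) ≡ d → inDegree d φ b ≈ φ b
  inDegree-yes {d} φ b eq with length (proj₁ b) ≡ᵇ d | ℕ.≡⇒≡ᵇ (length (proj₁ b)) d eq
  ... | true | _ = ≈-refl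

  inDegree-no : ∀ {d} φ b → length (proj₁ b) ≢ d → inDegree d φ b ≈ 0#
  inDegree-no {d} φ b ≢d with length (proj₁ b) ≡ᵇ d | ℕ.≡ᵇ⇒≡ (length (proj₁ b)) d
  ... | true  | p = ⊥-elim (≢d (p tt))
  ... | false | _ = ≈-refl

  inDegree-cong : ∀ {d} φ ψ b → (length (proj₁ b) ≡ d → φ b ≈ ψ b) → inDegree d φ b ≈ inDegree d ψ b
  inDegree-cong {d} φ ψ b eq with length (proj₁ b) ≡ᵇ d | ℕ.≡ᵇ⇒≡ (length (proj₁ b)) d
  ... | true  | p = eq (p tt)
  ... | false | _ = ≈-refl

  μ-inDegree : ∀ {d e} φ a b → length (proj₁ a) ≡ d → length (proj₁ b) ≡ e → μ φ a b ≈ μ (inDegree (d + e) φ) a b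
  μ-inDegree φ (x , M) (y , N) refl refl = ∑-cong-All (All.map
    (λ {z} eq → ≈-sym (inDegree-yes φ (z , M + N) (≡.trans eq (cong (length x +_) (length-map (M +_) y)))))
    (shuffles-length x (map (M +_) y)))

  mul-cong : ∀ m m′ b b′ → m ≈V m′ → b ≈V b′ → mul m b ≈V mul m′ b′
  mul-cong m m′ b b′ m≈ b≈ = ≋⇒≈V {mul m b} {mul m′ b′} λ φ → begin
    pair (mul m b) φ                 ≈⟨ pair-mul m b φ ⟩
    pair m (λ a → pair b (μ φ a))    ≈⟨ pair-cong m (λ a → ≈V⇒≋ {b} {b′} b≈ (μ φ a)) ⟩
    pair m (λ a → pair b′ (μ φ a))   ≈⟨ ≈V⇒≋ {m} {m′} m≈ _ ⟩
    pair m′ (λ a → pair b′ (μ φ a))  ≈⟨ pair-mul m′ b′ φ ⟨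
    pair (mul m′ b′) φ               ∎

  mul-+ˡ : ∀ m m′ b → mul (m ++ m′) b ≈V (mul m b ++ mul m′ b)
  mul-+ˡ m m′ b = ≋⇒≈V {mul (m ++ m′) b} {mul m b ++ mul m′ b} λ φ → begin
    pair (mul (m ++ m′) b) φ                                           ≈⟨ pair-mul (m ++ m′) b φ ⟩
    pair (m ++ m′) (λ a → pair b (μ φ a))                              ≈⟨ pair-++ m m′ _ ⟩
    pair m (λ a → pair b (μ φ a)) +K pair m′ (λ a → pair b (μ φ a))    ≈⟨ +-cong (pair-mul m b φ) (pair-mul m′ b φ) ⟨
    pair (mul m b) φ +K pair (mul m′ b) φ                              ≈⟨ pair-++ (mul m b) (mul m′ b) φ ⟨
    pair (mul m b ++ mul m′ b) φ                                       ∎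

  mul-+ʳ : ∀ m b b′ → mul m (b ++ b′) ≈V (mul m b ++ mul m b′)
  mul-+ʳ m b b′ = ≋⇒≈V {mul m (b ++ b′)} {mul m b ++ mul m b′} λ φ → begin
    pair (mul m (b ++ b′)) φ                                           ≈⟨ pair-mul m (b ++ b′) φ ⟩
    pair m (λ a → pair (b ++ b′) (μ φ a))                              ≈⟨ pair-cong m (λ a → pair-++ b b′ (μ φ a)) ⟩
    pair m (λ a → pair b (μ φ a) +K pair b′ (μ φ a))                   ≈⟨ ∑-cong m (λ (k , a) → distribˡ k _ _) ⟩
    ∑ m (λ (k , a) → k *K pair b (μ φ a) +K k *K pair b′ (μ φ a))      ≈⟨ ∑-+ m _ _ ⟩
    pair m (λ a → pair b (μ φ a)) +K pair m (λ a → pair b′ (μ φ a))    ≈⟨ +-cong (pair-mul m b φ) (pair-mul m b′ φ) ⟨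
    pair (mul m b) φ +K pair (mul m b′) φ                              ≈⟨ pair-++ (mul m b) (mul m b′) φ ⟨
    pair (mul m b ++ mul m b′) φ                                       ∎

  mul-scaleˡ : ∀ k m b → mul (scale k m) b ≈V scale k (mul m b)
  mul-scaleˡ k m b = ≋⇒≈V {mul (scale k m) b} {scale k (mul m b)} λ φ → begin
    pair (mul (scale k m) b) φ              ≈⟨ pair-mul (scale k m) b φ ⟩
    pair (scale k m) (λ a → pair b (μ φ a)) ≈⟨ pair-scale k m _ ⟩
    k *K pair m (λ a → pair b (μ φ a))      ≈⟨ *-congˡ (pair-mul m b φ) ⟨
    k *K pair (mul m b) φ                   ≈⟨ pair-scale k (mul m b) φ ⟨
    pair (scale k (mul m b)) φ              ∎

  mul-scaleʳ : ∀ k m b → mul m (scale k b) ≈V scale k (mul m b)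
  mul-scaleʳ k m b = ≋⇒≈V {mul m (scale k b)} {scale k (mul m b)} λ φ → begin
    pair (mul m (scale k b)) φ              ≈⟨ pair-mul m (scale k b) φ ⟩
    pair m (λ a → pair (scale k b) (μ φ a)) ≈⟨ pair-cong m (λ a → pair-scale k b (μ φ a)) ⟩
    pair m (λ a → k *K pair b (μ φ a))      ≈⟨ pair-* k m _ ⟩
    k *K pair m (λ a → pair b (μ φ a))      ≈⟨ *-congˡ (pair-mul m b φ) ⟨
    k *K pair (mul m b) φ                   ≈⟨ pair-scale k (mul m b) φ ⟨
    pair (scale k (mul m b)) φ              ∎

  -- Shifting by `M + N` is shifting by `N` and then by `M`, and the outer shift passes through the
  -- inner shuffle by `Sh-map`; the rest is associativity for words.
  μ-assoc : ∀ φ a b d → μ (λ s → μ φ s d) a b ≈ μ (μ φ a) b d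
  μ-assoc φ (x , M) (y , N) (w , L) = begin
    Sh x My (λ s → Sh s (map (M + N +_) w) (λ t → φ (t , M + N + L)))
      ≈⟨ Sh-cong x My (λ s → ≈-reflexive (cong₂ (λ w′ R → Sh s w′ (λ t → φ (t , R)))
           (≡.trans (map-cong (ℕ.+-assoc M N) w) (map-∘ w)) (ℕ.+-assoc M N L))) ⟩
    Sh x My (λ s → Sh s (map (M +_) Nw) ψ)
      ≈⟨ Sh-assoc x My (map (M +_) Nw) ψ ⟩
    Sh My (map (M +_) Nw) (λ s → Sh x s ψ)
      ≈⟨ Sh-map (M +_) y Nw _ ⟩
    Sh y Nw (λ s → Sh x (map (M +_) s) ψ) ∎
    where
    My = map (M +_) y
    Nw = map (N +_) w
    ψ : Word → K
    ψ t = φ (t , M + (N + L))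

  mul-assoc : ∀ m b b′ → mul (mul m b) b′ ≈V mul m (mul b b′)
  mul-assoc m b b′ = ≋⇒≈V {mul (mul m b) b′} {mul m (mul b b′)} λ φ → begin
    pair (mul (mul m b) b′) φ
      ≈⟨ pair-mul (mul m b) b′ φ ⟩
    pair (mul m b) (λ s → pair b′ (μ φ s))
      ≈⟨ pair-mul m b _ ⟩
    pair m (λ a → pair b (μ (λ s → pair b′ (μ φ s)) a))
      ≈⟨ pair-cong m (λ a → pair-cong b (λ c → pair-∑ b′ (shuffles (proj₁ a) (map (proj₂ a +_) (proj₁ c))) _)) ⟨
    pair m (λ a → pair b (λ c → pair b′ (λ d → μ (λ s → μ φ s d) a c)))
      ≈⟨ pair-cong m (λ a → pair-cong b (λ c → pair-cong b′ (μ-assoc φ a c))) ⟩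
    pair m (λ a → pair b (λ c → pair b′ (μ (μ φ a) c)))
      ≈⟨ pair-cong m (λ a → pair-mul b b′ (μ φ a)) ⟨
    pair m (λ a → pair (mul b b′) (μ φ a))
      ≈⟨ pair-mul m (mul b b′) φ ⟨
    pair (mul m (mul b b′)) φ ∎

  mul-unit : ∀ m → mul m unitV ≈V m
  mul-unit m = ≋⇒≈V {mul m unitV} {m} λ φ → ≈-trans (pair-mul m unitV φ) (pair-cong m (λ { (x , M) →
    ≈-trans (+-identityʳ _) (≈-trans (*-identityˡ _) (≈-trans (Sh-[]ʳ x (λ z → φ (z , M + 0)))
      (≈-reflexive (cong (λ R → φ (x , R)) (ℕ.+-identityʳ M))))) }))

  -- Homogeneity lets the functionals be cut down to words of lengths `d` and `e`. Their shuffles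
  -- have length `d + e`, so truncating φ to that degree changes no value.
  mul-homog : ∀ d e m b → Homog d m → Homog e b → Homog (d + e) (mul m b)
  mul-homog d e m b hm hb = ≋⇒≈V {mul m b} {proj (d + e) (mul m b)} λ φ → begin
    pair (mul m b) φ
      ≈⟨ expand φ ⟩
    pair m (inDegree d (λ a → pair b (inDegree e (μ φ a))))
      ≈⟨ pair-cong m (λ a → inDegree-cong (λ a → pair b (inDegree e (μ φ a)))
           (λ a → pair b (inDegree e (μ (inDegree (d + e) φ) a))) a (λ p → pair-cong b (λ c →
             inDegree-cong (μ φ a) (μ (inDegree (d + e) φ) a) c (λ q → μ-inDegree φ a c p q)))) ⟩
    pair m (inDegree d (λ a → pair b (inDegree e (μ (inDegree (d + e) φ) a))))
      ≈⟨ expand (inDegree (d + e) φ) ⟨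
    pair (mul m b) (inDegree (d + e) φ)
      ≈⟨ pair-proj (d + e) (mul m b) φ ⟨
    pair (proj (d + e) (mul m b)) φ ∎
    where
    expand : ∀ φ → pair (mul m b) φ ≈ pair m (inDegree d (λ a → pair b (inDegree e (μ φ a))))
    expand φ = ≈-trans (pair-mul m b φ) (≈-trans (homog-pair {d} {m} hm _)
      (pair-cong m (λ a → inDegree-cong (λ a → pair b (μ φ a)) (λ a → pair b (inDegree e (μ φ a))) a (λ _ → homog-pair {e} {b} hb (μ φ a)))))

  mul-Δ : ∀ m b → Δ (mul m b) ≈T mulT (Δ m) (Δ b)
  mul-Δ m b = ≋⇒≈T {Δ (mul m b)} {mulT (Δ m) (Δ b)} λ φ → begin
    pair (Δ (mul m b)) φ
      ≈⟨ pair-Δ (mul m b) φ ⟩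
    pair (mul m b) (λ (z , L) → Cut z (λ a c → φ ((a , L) , (c , L))))
      ≈⟨ pair-mul m b _ ⟩
    pair m (λ (x , M) → pair b (λ (y , N) → Sh x (map (M +_) y) (λ z → Cut z (λ a c → φ ((a , M + N) , (c , M + N))))))
      ≈⟨ pair-cong m (λ { (x , M) → pair-cong b (λ { (y , N) →
           ≈-trans (Sh-Cut x (map (M +_) y) _) (Cut-cong x (λ x₁ x₂ → Cut-map (M +_) y _)) }) }) ⟩
    pair m (λ (x , M) → pair b (λ (y , N) → Cut x (λ x₁ x₂ → Cut y (λ y₁ y₂ → summand φ x₁ x₂ M y₁ y₂ N))))
      -- The sum over the cuts of `x` is moved outside the pairing with `b`, so that the inner sum
      -- is a value on `Δ b` and the outer one a value on `Δ m`.
      ≈⟨ pair-cong m (λ { (x , M) → pair-∑ b (splits x) (λ { (x₁ , x₂) (y , N) → Cut y (λ y₁ y₂ → summand φ x₁ x₂ M y₁ y₂ N) }) }) ⟩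
    pair m (λ (x , M) → Cut x (λ x₁ x₂ → pair b (λ (y , N) → Cut y (λ y₁ y₂ → summand φ x₁ x₂ M y₁ y₂ N))))
      ≈⟨ pair-cong m (λ { (x , M) → Cut-cong x (λ x₁ x₂ → pair-Δ b _) }) ⟨
    pair m (λ (x , M) → Cut x (λ x₁ x₂ → pair (Δ b) (λ { ((y₁ , N₁) , (y₂ , N₂)) →
      Sh x₁ (map (M +_) y₁) (λ z₁ → Sh x₂ (map (M +_) y₂) (λ z₂ → φ ((z₁ , M + N₁) , (z₂ , M + N₂)))) })))
      ≈⟨ pair-Δ m _ ⟨
    pair (Δ m) _
      ≈⟨ pair-mulT (Δ m) (Δ b) φ ⟨
    pair (mulT (Δ m) (Δ b)) φ ∎
    where
    summand : (Basis × Basis → K) → Word → Word → ℕ → Word → Word → ℕ → K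
    summand φ x₁ x₂ M y₁ y₂ N = Sh x₁ (map (M +_) y₁) (λ z₁ → Sh x₂ (map (M +_) y₂) (λ z₂ →
      φ ((z₁ , M + N) , (z₂ , M + N))))

  mul-ε : ∀ m b → ε (mul m b) ≈ (ε m *K ε b)
  mul-ε m b = begin
    ε (mul m b)                                              ≈⟨ ε-pair (mul m b) ⟩
    pair (mul m b) (λ (z , _) → ε₀ z)                        ≈⟨ pair-mul m b _ ⟩
    pair m (λ (x , M) → pair b (λ (y , N) → Sh x (map (M +_) y) ε₀))
      ≈⟨ pair-cong m (λ { (x , M) → pair-cong b (λ { (y , N) → ≈-trans (Sh-ε x (map (M +_) y)) (*-congˡ (≈-reflexive (ε₀-map M y))) }) }) ⟩
    pair m (λ (x , M) → pair b (λ (y , N) → ε₀ x *K ε₀ y))   ≈⟨ pair-cong m (λ { (x , M) → pair-* (ε₀ x) b _ }) ⟩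
    pair m (λ (x , M) → ε₀ x *K εb)                          ≈⟨ pair-cong m (λ { (x , M) → *-comm (ε₀ x) εb }) ⟩
    pair m (λ (x , M) → εb *K ε₀ x)                          ≈⟨ pair-* εb m _ ⟩
    εb *K pair m (λ (x , _) → ε₀ x)                          ≈⟨ *-comm _ _ ⟩
    pair m (λ (x , _) → ε₀ x) *K εb                          ≈⟨ *-cong (ε-pair m) (ε-pair b) ⟨
    ε m *K ε b                                               ∎
    where
    εb = pair b (λ (y , _) → ε₀ y)
    ε₀-map : ∀ M y → ε₀ (map (M +_) y) ≡ ε₀ y
    ε₀-map M []      = refl
    ε₀-map M (_ ∷ _) = refl

  -- From generators to their spans.

  linear : {G : Set} → (G → Vect) → List (K × G) → Vect
  linear gen = concatMap (λ { (k , g) → scale k (gen g) })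

  pair-linear : ∀ {G : Set} (gen : G → Vect) cs φ → pair (linear gen cs) φ ≈ pair cs (λ g → pair (gen g) φ)
  pair-linear gen cs φ = pair-concatMap _ cs (λ k g → pair-scale k (gen g) φ)

  -- No coefficients are recorded: the expansions of generators come from disjoint unions, so each
  -- term has coefficient one.
  SumOf : {G X : Set} → (G → List (K × X)) → List (K × X) → List G → Set _
  SumOf gen v gs = ∀ φ → pair v φ ≈ ∑ gs (λ g → pair (gen g) φ)

  substitute : {G H : Set} → (G → List H) → List (K × G) → List (K × H)
  substitute f = concatMap (λ (k , g) → map (k ,_) (f g))

  pair-substitute : ∀ {G H : Set} (f : G → List H) cs (ψ : H → K) →
                    pair (substitute f cs) ψ ≈ pair cs (λ g → ∑ (f g) ψ)
  pair-substitute f cs ψ = pair-concatMap _ cs (λ k g → pair-map k (λ h → h) (f g) ψ)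

  -- By linearity the expansions of the generators may be substituted into any combination
  -- representing `v`; replacing `v` by that combination is legitimate because functionals see only
  -- coefficients.
  subCoalgebra : {G : Set} (gen : G → Vect) →
    (∀ g → ∃ (SumOf (λ (h , h′) → gen h ⊗ gen h′) (Δ (gen g)))) →
    (∀ d g → ∃ (SumOf gen (proj d (gen g)))) →
    IsGradedSubCoalgebra gen
  subCoalgebra {G} gen split homogeneous = record { Δ-closed = Δ-closed ; graded = graded }
    where
    Δ-closed : ∀ v → InSpan gen v → InSpan⊗ gen (Δ v)
    Δ-closed v (cs , eq) = ds , ≋⇒≈T {Δ v} {concatMap (λ { (k , g , h) → scaleT k (gen g ⊗ gen h) }) ds} λ φ → begin
      pair (Δ v) φ                                         ≈⟨ pair-Δ v φ ⟩
      pair v _                                             ≈⟨ ≈V⇒≋ {v} {linear gen cs} eq _ ⟩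
      pair (linear gen cs) _                               ≈⟨ pair-linear gen cs _ ⟩
      pair cs (λ g → pair (gen g) _)                       ≈⟨ pair-cong cs (λ g → pair-Δ (gen g) φ) ⟨
      pair cs (λ g → pair (Δ (gen g)) φ)                   ≈⟨ pair-cong cs (λ g → proj₂ (split g) φ) ⟩
      pair cs (λ g → ∑ (proj₁ (split g)) (λ (h , h′) → pair (gen h ⊗ gen h′) φ))
        ≈⟨ pair-substitute (λ g → proj₁ (split g)) cs _ ⟨
      pair ds (λ (h , h′) → pair (gen h ⊗ gen h′) φ)
        ≈⟨ pair-concatMap _ ds (λ { k (g , h) → pair-scaleT k (gen g ⊗ gen h) φ }) ⟨
      pair (concatMap (λ { (k , g , h) → scaleT k (gen g ⊗ gen h) }) ds) φ ∎
      where
      ds = substitute (λ g → proj₁ (split g)) cs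
    graded : ∀ d v → InSpan gen v → InSpan gen (proj d v)
    graded d v (cs , eq) = ds , ≋⇒≈V {proj d v} {linear gen ds} λ φ → begin
      pair (proj d v) φ                             ≈⟨ pair-proj d v φ ⟩
      pair v (inDegree d φ)                         ≈⟨ ≈V⇒≋ {v} {linear gen cs} eq _ ⟩
      pair (linear gen cs) (inDegree d φ)           ≈⟨ pair-linear gen cs _ ⟩
      pair cs (λ g → pair (gen g) (inDegree d φ))   ≈⟨ pair-cong cs (λ g → pair-proj d (gen g) φ) ⟨
      pair cs (λ g → pair (proj d (gen g)) φ)       ≈⟨ pair-cong cs (λ g → proj₂ (homogeneous d g) φ) ⟩
      pair cs (λ g → ∑ (proj₁ (homogeneous d g)) (λ h → pair (gen h) φ))
        ≈⟨ pair-substitute (λ g → proj₁ (homogeneous d g)) cs _ ⟨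
      pair ds (λ h → pair (gen h) φ)                ≈⟨ pair-linear gen ds φ ⟨
      pair (linear gen ds) φ                        ∎
      where
      ds = substitute (λ g → proj₁ (homogeneous d g)) cs

  moduleCoalgebra : {G H : Set} (gen : G → Vect) (gen′ : H → Vect) →
    (∀ g h → ∃ (SumOf gen (mul (gen g) (gen′ h)))) →
    IsGradedRightModuleCoalgebra gen gen′
  moduleCoalgebra {G} {H} gen gen′ product = record
    { act-closed = act-closed
    ; act-cong   = λ m m′ b b′ _ _ _ _ → mul-cong m m′ b b′
    ; act-+ˡ     = λ m m′ b _ _ _ → mul-+ˡ m m′ b
    ; act-+ʳ     = λ m b b′ _ _ _ → mul-+ʳ m b b′
    ; act-scaleˡ = λ k m b _ _ → mul-scaleˡ k m b
    ; act-scaleʳ = λ k m b _ _ → mul-scaleʳ k m b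
    ; act-assoc  = λ m b b′ _ _ _ → mul-assoc m b b′
    ; act-unit   = λ m _ → mul-unit m
    ; act-graded = λ d e m b _ _ → mul-homog d e m b
    ; act-Δ      = λ m b _ _ → mul-Δ m b
    ; act-ε      = λ m b _ _ → mul-ε m b }
    where
    act-closed : ∀ m b → InSpan gen m → InSpan gen′ b → InSpan gen (mul m b)
    act-closed m b (cs , eq) (ds , eq′) = es , ≋⇒≈V {mul m b} {linear gen es} λ φ → begin
      pair (mul m b) φ
        ≈⟨ ≈V⇒≋ {mul m b} {mul (linear gen cs) (linear gen′ ds)} (mul-cong m (linear gen cs) b (linear gen′ ds) eq eq′) φ ⟩
      pair (mul (linear gen cs) (linear gen′ ds)) φ
        ≈⟨ pair-mul (linear gen cs) (linear gen′ ds) φ ⟩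
      pair (linear gen cs) (λ a → pair (linear gen′ ds) (μ φ a))
        ≈⟨ pair-linear gen cs _ ⟩
      pair cs (λ g → pair (gen g) (λ a → pair (linear gen′ ds) (μ φ a)))
        ≈⟨ pair-cong cs (λ g → pair-cong (gen g) (λ a → pair-linear gen′ ds (μ φ a))) ⟩
      pair cs (λ g → pair (gen g) (λ a → pair ds (λ h → pair (gen′ h) (μ φ a))))
        -- The coefficients of the second combination are moved outside the pairing with `gen g`,
        -- which isolates the product of two generators.
        ≈⟨ pair-cong cs (λ g → pair-swap (gen g) ds _) ⟩
      pair cs (λ g → pair ds (λ h → pair (gen g) (λ a → pair (gen′ h) (μ φ a))))
        ≈⟨ pair-cong cs (λ g → pair-cong ds (λ h → pair-mul (gen g) (gen′ h) φ)) ⟨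
      pair cs (λ g → pair ds (λ h → pair (mul (gen g) (gen′ h)) φ))
        ≈⟨ pair-cong cs (λ g → pair-cong ds (λ h → proj₂ (product g h) φ)) ⟩
      pair cs (λ g → pair ds (λ h → ∑ (proj₁ (product g h)) (λ g′ → pair (gen g′) φ)))
        ≈⟨ pair-concatMap _ cs (λ k g → pair-concatMap* k _ ds (λ l h → pair-map (k *K l) (λ g′ → g′) (proj₁ (product g h)) _)) ⟨
      pair es (λ g → pair (gen g) φ)
        ≈⟨ pair-linear gen es φ ⟨
      pair (linear gen es) φ ∎
      where
      es : List (K × G)
      es = concatMap (λ (k , g) → concatMap (λ (l , h) → map (k *K l ,_) (proj₁ (product g h))) ds) cs

-- The combinatorial partitions turned into identities of vectors.

module SeriesModule {c ℓ} (F : Field c ℓ) (series : Series) where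
  open Field F renaming (Carrier to K; _+_ to _+K_; _*_ to _*K_; refl to ≈-refl; sym to ≈-sym; trans to ≈-trans; reflexive to ≈-reflexive) hiding (zero)
  open W F
  open LinearAlgebra F
  open import Relation.Binary.Reasoning.Setoid setoid
  open Series series
  open OfSeries series

  gen⟦_⟧ : Element → Vect
  gen⟦ x ⟧ = wordSum (rank x) (words x)

  pair-wordSum : ∀ n ws φ → pair (wordSum n ws) φ ≈ ∑ ws (λ w → φ (w , n))
  pair-wordSum n ws φ = ≈-trans (pair-map 1# (λ w → w , n) ws φ) (*-identityˡ _)

  pair-OfRank : ∀ {n} (x : OfRank n) φ → pair gen⟦ proj₁ x ⟧ φ ≈ ∑ (wordsOf x) (λ w → φ (w , n))
  pair-OfRank (x , refl) φ = pair-wordSum (rank x) (words x) φ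

  ∑-cartesianProduct : ∀ {A B : Set} (xs : List A) (ys : List B) f →
    ∑ (cartesianProduct xs ys) f ≈ ∑ xs (λ x → ∑ ys (λ y → f (x , y)))
  ∑-cartesianProduct []       ys f = ≈-refl
  ∑-cartesianProduct (x ∷ xs) ys f = ≈-trans (∑-++ (map (x ,_) ys) _ f)
    (+-cong (≈-reflexive (∑-map (x ,_) ys f)) (∑-cartesianProduct xs ys f))

  -- A permutation of a list leaves the sum of any function over it unchanged, so the partition of
  -- the cuts into products R(α) × R(β) becomes an expansion into tensors of generators.
  Δ-gen : ∀ x → ∃ (SumOf (λ (g , h) → gen⟦ g ⟧ ⊗ gen⟦ h ⟧) (Δ gen⟦ x ⟧))
  Δ-gen x with splits-partition x
  ... | gs , perm = map (λ (g , h) → proj₁ g , proj₁ h) gs , λ φ → begin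
    pair (Δ gen⟦ x ⟧) φ
      ≈⟨ pair-Δ gen⟦ x ⟧ φ ⟩
    pair gen⟦ x ⟧ (λ (w , N) → Cut w (λ a b → φ ((a , N) , (b , N))))
      ≈⟨ pair-wordSum n (words x) _ ⟩
    ∑ (words x) (λ w → ∑ (splits w) (value φ))
      ≈⟨ ∑-concatMap splits (words x) (value φ) ⟨
    ∑ (concatMap splits (words x)) (value φ)
      ≈⟨ ∑-↭ (value φ) perm ⟩
    ∑ (concatMap pairs gs) (value φ)
      ≈⟨ ∑-concatMap pairs gs (value φ) ⟩
    ∑ gs (λ p → ∑ (pairs p) (value φ))
      ≈⟨ ∑-cong gs (λ (g , h) → ≈-trans (∑-cartesianProduct (wordsOf g) (wordsOf h) (value φ))
           (≈-sym (≈-trans (pair-⊗ gen⟦ proj₁ g ⟧ gen⟦ proj₁ h ⟧ φ) (≈-trans (pair-OfRank g _)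
             (∑-cong (wordsOf g) (λ u → pair-OfRank h _)))))) ⟩
    ∑ gs (λ (g , h) → pair (gen⟦ proj₁ g ⟧ ⊗ gen⟦ proj₁ h ⟧) φ)
      ≈⟨ ≈-reflexive (∑-map (λ (g , h) → proj₁ g , proj₁ h) gs _) ⟨
    ∑ (map (λ (g , h) → proj₁ g , proj₁ h) gs) (λ (g , h) → pair (gen⟦ g ⟧ ⊗ gen⟦ h ⟧) φ) ∎
    where
    n = rank x
    value : (Basis × Basis → K) → Word × Word → K
    value φ (u , v) = φ ((u , n) , (v , n))

  words-length : ∀ x {v w} → v ∈ words x → w ∈ words x → length v ≡ length w
  words-length x {v} {w} v∈ w∈ with proj₁ (proj₂ (enum x) v) v∈ | proj₁ (proj₂ (enum x) w) w∈
  ... | is , eq , min | is′ , eq′ , min′ = ℕ.≤-antisym (min w is′ eq′) (min′ v is eq)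

  -- All reduced words have the same length, so the component of degree d of a generator
  -- is the generator itself or zero.
  proj-gen : ∀ d x → ∃ (SumOf gen⟦_⟧ (proj d gen⟦ x ⟧))
  proj-gen d x = by-words (words x) refl
    where
    expand : ∀ φ → pair (proj d gen⟦ x ⟧) φ ≈ ∑ (words x) (λ w → inDegree d φ (w , rank x))
    expand φ = ≈-trans (pair-proj d gen⟦ x ⟧ φ) (pair-wordSum (rank x) (words x) _)
    by-words : ∀ ws → words x ≡ ws → ∃ (SumOf gen⟦_⟧ (proj d gen⟦ x ⟧))
    by-words []       eq = [] , λ φ → ≈-trans (expand φ)
      (≈-reflexive (cong (λ ws → ∑ ws (λ w → inDegree d φ (w , rank x))) eq))
    by-words (v ∷ ws) eq with length v ℕ.≟ d
    ... | yes p = x ∷ [] , λ φ → begin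
      pair (proj d gen⟦ x ⟧) φ                         ≈⟨ expand φ ⟩
      ∑ (words x) (λ w → inDegree d φ (w , rank x))
        ≈⟨ ∑-cong-All (All.tabulate (λ {w} w∈ → inDegree-yes φ (w , rank x) (≡.trans (words-length x w∈ v∈) p))) ⟩
      ∑ (words x) (λ w → φ (w , rank x))               ≈⟨ pair-wordSum (rank x) (words x) φ ⟨
      pair gen⟦ x ⟧ φ                                  ≈⟨ +-identityʳ _ ⟨
      pair gen⟦ x ⟧ φ +K 0#                            ∎
      where v∈ = subst (v ∈_) (≡.sym eq) (here refl)
    ... | no ¬p = [] , λ φ → begin
      pair (proj d gen⟦ x ⟧) φ                         ≈⟨ expand φ ⟩
      ∑ (words x) (λ w → inDegree d φ (w , rank x))
        ≈⟨ ∑-cong-All (All.tabulate (λ {w} w∈ → inDegree-no φ (w , rank x)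
             (λ p → ¬p (≡.trans (words-length x v∈ w∈) p)))) ⟩
      ∑ (words x) (λ _ → 0#)                           ≈⟨ ∑-0 (words x) ⟩
      0#                                               ∎
      where v∈ = subst (v ∈_) (≡.sym eq) (here refl)

  mul-gen : ∀ x y → ∃ (SumOf gen⟦_⟧ (mul gen⟦ x ⟧ [ y ]S))
  mul-gen x y = by-rank (rank x) refl
    where
    open GenS y using (N; ws)
    by-rank : ∀ n → rank x ≡ n → ∃ (SumOf gen⟦_⟧ (mul gen⟦ x ⟧ [ y ]S))
    -- `Parabolic` is set up for rank `suc n′`, since position `n` is shared by the two blocks; rank
    -- 0 is excluded by `1≤least`.
    by-rank zero     eq with ≤-trans 1≤least (subst (least ≤_) eq (least≤rank x))
    ... | ()
    by-rank (suc n′) eq = map proj₁ gs , λ φ → begin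
      pair (mul gen⟦ x ⟧ [ y ]S) φ
        ≈⟨ pair-mul gen⟦ x ⟧ [ y ]S φ ⟩
      pair gen⟦ x ⟧ (λ a → pair [ y ]S (μ φ a))
        ≈⟨ pair-OfRank (x , eq) _ ⟩
      ∑ (words x) (λ w → pair [ y ]S (μ φ (w , n)))
        ≈⟨ ∑-cong (words x) (λ w → pair-wordSum N ws _) ⟩
      ∑ (words x) (λ w → ∑ ws (λ u → ∑ (shuffles w (shift u)) (value φ)))
        ≈⟨ ∑-cong (words x) (λ w → ∑-concatMap (λ u → shuffles w (shift u)) ws (value φ)) ⟨
      ∑ (words x) (λ w → ∑ (concatMap (λ u → shuffles w (shift u)) ws) (value φ))
        ≈⟨ ∑-concatMap _ (words x) (value φ) ⟨
      ∑ product (value φ)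
        ≈⟨ ∑-↭ (value φ) (proj₂ product-partition) ⟩
      ∑ (concatMap wordsOf gs) (value φ)
        ≈⟨ ∑-concatMap wordsOf gs (value φ) ⟩
      ∑ gs (λ g → ∑ (wordsOf g) (value φ))
        ≈⟨ ∑-cong gs (λ g → pair-OfRank g φ) ⟨
      ∑ gs (λ g → pair gen⟦ proj₁ g ⟧ φ)
        ≈⟨ ≈-reflexive (∑-map proj₁ gs _) ⟨
      ∑ (map proj₁ gs) (λ g → pair gen⟦ g ⟧ φ) ∎
      where
      open Parabolic series n′ N (subst (least ≤_) eq (least≤rank x))
      open Product (x , eq) ws (GenS.π y) (GenS.enum y)
      gs = proj₁ product-partition
      value : (Basis → K) → Word → K
      value φ z = φ (z , n + N)

  series-subCoalgebra : IsGradedSubCoalgebra gen⟦_⟧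
  series-subCoalgebra = subCoalgebra gen⟦_⟧ Δ-gen proj-gen

  series-moduleCoalgebra : IsGradedRightModuleCoalgebra gen⟦_⟧ [_]S
  series-moduleCoalgebra = moduleCoalgebra gen⟦_⟧ [_]S mul-gen

theorem6p6 : ∀ {c ℓ} (F : Field c ℓ) → CharZero F →
    let open W F in
    (IsGradedSubCoalgebra [_]B × IsGradedRightModuleCoalgebra [_]B [_]S) ×
    (IsGradedSubCoalgebra [_]D × IsGradedRightModuleCoalgebra [_]D [_]S)
theorem6p6 F _ = (B.series-subCoalgebra , B.series-moduleCoalgebra) , (D.series-subCoalgebra , D.series-moduleCoalgebra)
  where
  module B = SeriesModule F seriesB
  module D = SeriesModule F seriesD
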